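{- Let $G$ be a finite simple graph of order $n$. If $\sigma^*(G)\geq n$, then either $G$ has a 2-proper partition $\mathcal{P}$ with $|\mathcal{P}|\leq \alpha^*(G)$, or $G$ is isomorphic to a graph in $\{K_2, F_5\}\cup\mathcal{F}_{11}\cup\mathcal{F}_{12}\cup\mathcal{H}_n$.
   Context: All graphs are finite and simple. For a graph $G$, $d_G(u)$ is the degree of $u$. An independent set $I$ of $G$ here means a nonempty set of pairwise non-adjacent vertices. For such $I$, let $\delta_G(I)=\min\{d_G(u): u\in I\}$ and $w_G(I)=\sum_{u\in I}d_G(u)$. $I$ is called large if $|I|\geq \delta_G(I)+1$, and light if $w_G(I)\leq |V(G)|-1$. Define $\sigma^*(G)=\min\{w_G(I): I \text{ a large independent set of } G\}$, with $\sigma^*(G)=+\infty$ if $G$ has no large independent set (this case is allowed). Define $\alpha^*(G)=\max\{|I|: I \text{ a light independent set of } G\}$. A graph is 2-connected if it has more than 2 vertices and remains connected after deleting any single vertex. A 2-proper partition of $G$ is a partition $\mathcal{P}$ of $V(G)$ such that every $P\in\mathcal{P}$ induces a 2-connected subgraph of $G$. Exceptional graphs: $K_2$ is the complete graph on 2 vertices. $F_5$ has vertex set $\{a,b_1,b_2,b_3,b_4\}$ and edge set $\{ab_1,ab_2,ab_3,ab_4,b_1b_2,b_3b_4\}$. $\mathcal{F}_{11}$ is the family of graphs with vertex set $\{a,b_1,b_2,c_1,\dots,c_8\}$ and edge set $\{ac_i: i\in[8]\}\cup\{b_1c_i: i\in[4]\}\cup\{b_2c_i: 5\le i\le 8\}\cup\{c_1c_2,c_3c_4,c_5c_6,c_7c_8\}\cup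 L$, where $L$ is any subset of $\{ab_1,ab_2\}$. $\mathcal{F}_{12}$ is the family of graphs with vertex set $\{a,b_1,b_2,c_1,\dots,c_9\}$ and edge set $\{ac_i: i\in[8]\}\cup\{b_1c_i: i\in[4]\}\cup\{b_2c_i: 5\le i\le 8\}\cup\{c_1c_2,c_3c_4,c_5c_6,c_7c_9,c_8c_9\}\cup L$, where $L\subseteq\{ab_1,ab_2,ac_9,b_2c_9\}$ with $L\cap\{ac_9,b_2c_9\}\neq\emptyset$. For integers $2\le s\le t$, let $S_1,S_2$ be vertex-disjoint complete graphs of orders $s-1$ and $t-1$; $H_{s,t}$ is obtained from $S_1\cup S_2$ by adding four new vertices $a,b,c_1,c_2$ and the edges $\{ax,bx: x\in V(S_1)\cup V(S_2)\}\cup\{ab,ac_1,ac_2,c_1c_2\}$, and $H_{s,t}^-=H_{s,t}-ab$ (both have $s+t+2$ vertices). For $n\ge 6$, $\mathcal{H}_n=\{H_{s,t},H_{s,t}^-: 2\le s\le t,\ s+t+2=n\}$; for $n<6$, $\mathcal{H}_n=\emptyset$. -}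

module Defs where

open import Data.Nat using (ℕ; zero; suc; _+_; _∸_; _≤_; _<_; _⊓_; _⊔_; _≤ᵇ_; _≡ᵇ_)
open import Data.Bool using (Bool; true; false; not; _∧_; _∨_; if_then_else_; T)
open import Data.Fin using (Fin; zero; suc; toℕ)
open import Data.List using (List; []; _∷_; _++_; map; foldr; allFin)
open import Data.Nat.ListAction using (sum)
open import Data.Bool.ListAction using (any; all)
open import Data.Product using (Σ; ∃; _×_; _,_; proj₁)
open import Data.Sum using (_⊎_)
open import Function.Bundles using (_↔_; Inverse)
open import Relation.Binary.PropositionalEquality using (_≡_)

Adj : ℕ → Set
Adj n = Fin n → Fin n → Bool

Simple : ∀ {n} → Adj n → Set
Simple {n} G = (∀ (u v : Fin n) → G u v ≡ G v u) × (∀ (u : Fin n) → G u u ≡ false)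

VSet : ℕ → Set
VSet n = Fin n → Bool

_==_ : ∀ {n} → Fin n → Fin n → Bool
u == v = toℕ u ≡ᵇ toℕ v

countB : ∀ {n} → (Fin n → Bool) → ℕ
countB {n} f = sum (map (λ v → if f v then 1 else 0) (allFin n))

size : ∀ {n} → VSet n → ℕ
size = countB

deg : ∀ {n} → Adj n → Fin n → ℕ
deg G u = countB (G u)

w : ∀ {n} → Adj n → VSet n → ℕ
w {n} G I = sum (map (λ u → if I u then deg G u else 0) (allFin n))

-- δ_G(I) = min degree over I (start value n exceeds every degree,
-- so for nonempty I this is the true minimum)
δ : ∀ {n} → Adj n → VSet n → ℕ
δ {n} G I = foldr (λ u m → if I u then deg G u ⊓ m else m) n (allFin n)

indep? : ∀ {n} → Adj n → VSet n → Bool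
indep? {n} G I = any I (allFin n)
  ∧ all (λ u → all (λ v → not (I u ∧ I v ∧ G u v)) (allFin n)) (allFin n)

Large : ∀ {n} → Adj n → VSet n → Set
Large G I = δ G I + 1 ≤ size I

light? : ∀ {n} → Adj n → VSet n → Bool
light? {n} G I = w G I ≤ᵇ n ∸ 1

-- σ*(G) ≥ m  (σ* = min of w over large independent sets, +∞ if none)
SigmaStarGe : ∀ {n} → Adj n → ℕ → Set
SigmaStarGe {n} G m = ∀ (I : VSet n) → T (indep? G I) → Large G I → m ≤ w G I

allSubsets : ∀ n → List (VSet n)
allSubsets zero = (λ ()) ∷ []
allSubsets (suc n) =
  map (λ S → λ { zero → true ; (suc i) → S i }) (allSubsets n)
  ++ map (λ S → λ { zero → false ; (suc i) → S i }) (allSubsets n)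

alphaStar : ∀ {n} → Adj n → ℕ
alphaStar {n} G =
  foldr _⊔_ 0 (map (λ I → if indep? G I ∧ light? G I then size I else 0) (allSubsets n))

-- walks from u inside the vertex set T (u itself assumed in T)
data Reach {n} (G : Adj n) (T' : VSet n) (u : Fin n) : Fin n → Set where
  here : Reach G T' u u
  step : ∀ {v x} → Reach G T' u v → G v x ≡ true → T' x ≡ true → Reach G T' u x

Connected : ∀ {n} → Adj n → VSet n → Set
Connected {n} G S = ∀ (u v : Fin n) → S u ≡ true → S v ≡ true → Reach G S u v

TwoConnected : ∀ {n} → Adj n → VSet n → Set
TwoConnected {n} G S =
  2 < size S × (∀ (x : Fin n) → S x ≡ true → Connected G (λ y → S y ∧ not (y == x)))

TwoProperPartition : ∀ {n k} → Adj n → (Fin k → VSet n) → Set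
TwoProperPartition {n} {k} G P =
  (∀ (u : Fin n) → ∃ λ (i : Fin k) → P i u ≡ true)
  × (∀ (u : Fin n) (i j : Fin k) → P i u ≡ true → P j u ≡ true → i ≡ j)
  × (∀ (i : Fin k) → TwoConnected G (P i))

_≅_ : ∀ {n m} → Adj n → Adj m → Set
_≅_ {n} {m} G H = Σ (Fin n ↔ Fin m) λ f →
  ∀ (u v : Fin n) → H (Inverse.to f u) (Inverse.to f v) ≡ G u v

edgeIn : List (ℕ × ℕ) → ℕ → ℕ → Bool
edgeIn es x y = any (λ { (a , b) → (a ≡ᵇ x) ∧ (b ≡ᵇ y) }) es

fromEdges : ∀ k → List (ℕ × ℕ) → Adj k
fromEdges k es u v =
  not (u == v) ∧ (edgeIn es (toℕ u) (toℕ v) ∨ edgeIn es (toℕ v) (toℕ u))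

opt : Bool → ℕ × ℕ → List (ℕ × ℕ)
opt true e = e ∷ []
opt false e = []

K2 : Adj 2
K2 = fromEdges 2 ((0 , 1) ∷ [])

-- F_5 : a = 0, b_i = i
F5 : Adj 5
F5 = fromEdges 5 ((0 , 1) ∷ (0 , 2) ∷ (0 , 3) ∷ (0 , 4) ∷ (1 , 2) ∷ (3 , 4) ∷ [])

-- common part of F_11 / F_12: a = 0, b1 = 1, b2 = 2, c_i = i + 2
baseEdges : List (ℕ × ℕ)
baseEdges =
  (0 , 3) ∷ (0 , 4) ∷ (0 , 5) ∷ (0 , 6) ∷ (0 , 7) ∷ (0 , 8) ∷ (0 , 9) ∷ (0 , 10) ∷
  (1 , 3) ∷ (1 , 4) ∷ (1 , 5) ∷ (1 , 6) ∷
  (2 , 7) ∷ (2 , 8) ∷ (2 , 9) ∷ (2 , 10) ∷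
  (3 , 4) ∷ (5 , 6) ∷ (7 , 8) ∷ []

-- member of 𝓕_11 determined by L ⊆ {ab1, ab2} (flags l1, l2)
F11 : Bool → Bool → Adj 11
F11 l1 l2 = fromEdges 11
  (baseEdges ++ ((9 , 10) ∷ []) ++ opt l1 (0 , 1) ++ opt l2 (0 , 2))

-- member of 𝓕_12 determined by L ⊆ {ab1, ab2, ac9, b2c9} (c9 = 11)
F12 : Bool → Bool → Bool → Bool → Adj 12
F12 l1 l2 l3 l4 = fromEdges 12
  (baseEdges ++ ((9 , 11) ∷ (10 , 11) ∷ [])
   ++ opt l1 (0 , 1) ++ opt l2 (0 , 2) ++ opt l3 (0 , 11) ++ opt l4 (2 , 11))

-- H_{s,t} (ab = true) and H⁻_{s,t} (ab = false) on s+t+2 vertices: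
-- indices 0..s-2 : S1,  s-1..s+t-3 : S2,  s+t-2 : a,  s+t-1 : b,  s+t : c1,  s+t+1 : c2
data Cls : Set where
  cS1 cS2 cA cB cC1 cC2 : Cls

cls : ℕ → ℕ → ℕ → Cls
cls s t i =
  if i + 1 ≤ᵇ s ∸ 1 then cS1
  else if i + 1 ≤ᵇ s + t ∸ 2 then cS2
  else if i ≡ᵇ s + t ∸ 2 then cA
  else if i ≡ᵇ s + t ∸ 1 then cB
  else if i ≡ᵇ s + t then cC1
  else cC2

clsE : Bool → Cls → Cls → Bool
clsE ab cS1 cS1 = true
clsE ab cS2 cS2 = true
clsE ab cS1 cA = true
clsE ab cS1 cB = true
clsE ab cS2 cA = true
clsE ab cS2 cB = true
clsE ab cA cB = ab
clsE ab cA cC1 = true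
clsE ab cA cC2 = true
clsE ab cC1 cC2 = true
clsE ab _ _ = false

H : Bool → (s t : ℕ) → Adj (s + t + 2)
H ab s t u v =
  not (u == v) ∧ (clsE ab (c u) (c v) ∨ clsE ab (c v) (c u))
  where
  c : Fin (s + t + 2) → Cls
  c x = cls s t (toℕ x)

-- G ≅ some member of 𝓗_n (empty for n < 6 automatically)
InHn : ∀ {n} → Adj n → Set
InHn {n} G = Σ ℕ λ s → Σ ℕ λ t → Σ Bool λ ab →
  2 ≤ s × s ≤ t × s + t + 2 ≡ n × G ≅ H ab s t

Exceptional : ∀ {n} → Adj n → Set
Exceptional G =
  G ≅ K2
  ⊎ G ≅ F5
  ⊎ (Σ Bool λ l1 → Σ Bool λ l2 → G ≅ F11 l1 l2)
  ⊎ (Σ Bool λ l1 → Σ Bool λ l2 → Σ Bool λ l3 → Σ Bool λ l4 →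
       T (l3 ∨ l4) × G ≅ F12 l1 l2 l3 l4)
  ⊎ InHn G

{-# OPTIONS --safe #-}
module Submission where

-- Call an independent set J light in U if its degrees in G[U] add up to less than |U|; the hypothesis says
-- that every vertex of a light set J has degree at least |J|. By induction on |U| we partition U into
-- 2-connected sets, each with a representative, so that the representatives form a light set. If G[U] has
-- a cut vertex, take a minimal lobe D at a cut vertex a, so that D ∪ {a} induces a nonseparable graph.
-- If D contains a vertex x with 2 d(x) ≤ |D| + 1, remove the part D ∪ {a}: the gap between d(x) and |D|
-- pays for the edges from a to all later representatives. Otherwise D is so dense that, up to vertices that
-- can be moved elsewhere, it is 2-connected by itself; remove D and remember that a may be moved to it.
-- Such vertices a are collected in A; they are never representatives, and each raises the guaranteed degrees
-- by one. The induction fails only when it ends in K₂ or in a triangle hanging at a. In the second case an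
-- Ore-type condition on the rest gives F₅ or H_{s,t}. An exceptional graph has tight vertices, whose degree
-- equals the size of a light set containing them; when it is left over by the removal of D ∪ {a}, they are
-- all adjacent to a, and both sides of a are exceptional, which leaves only 𝓕₁₁ and 𝓕₁₂.

-- The obstacle is that a cut vertex `a` can belong to only one part, and when its lobe D is removed
-- it is not yet clear to which. Taking `a` along costs every later representative adjacent to it
-- one degree; leaving it behind may cost `a` itself up to |D|. The threshold 2 d(x) ≤ |D| + 1
-- decides. Below it, a light set J of the rest has at most d(x) vertices, since otherwise d(x) of
-- them together with x would be a light set too large for x; so x and the edges from `a` to J weigh
-- at most 2 d(x), which fits into |D| + 1. Above it, two nonadjacent vertices have degree sum at
-- least |D| + 2 within |D| - 1 available vertices, hence three common neighbours: one may be `a`,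
-- one a cut vertex, and the third keeps D together. The choice for `a` is then postponed by putting
-- it into A. Every light set of the rest extends by x, which is why each postponement raises the
-- guaranteed degrees by one. When D ⊕ a is removed, the gain from x and the loss of the edge to `a`
-- cancel, so a vertex that is tight in the rest must be adjacent to `a`.

module Arithmetic where
  open import Data.Nat using (ℕ; suc; _+_; _≤_; _<_)
  open import Data.Nat.Properties using (+-mono-≤; +-cancelʳ-≤; +-monoʳ-≤; *-cancelˡ-≤; ≤-trans; m≤m+n; ≤-reflexive)
  open import Data.Nat.Tactic.RingSolver using (solve)
  open import Data.List using (List; []; _∷_)
  open import Relation.Binary.PropositionalEquality using (_≡_; refl)

  infixr 6 _⊞_
  _⊞_ : ∀ {a b c d : ℕ} → a ≤ b → c ≤ d → a + c ≤ b + d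
  _⊞_ = +-mono-≤

  -- Adding the hypotheses up gives l ≤ r; the slack s makes the remaining identity exact.
  farkas : ∀ {l r x y : ℕ} (s : ℕ) → l ≤ r → x + r + s ≡ y + l → x ≤ y
  farkas {l} {r} {x} {y} s h e =
    +-cancelʳ-≤ l x y (≤-trans (+-monoʳ-≤ x h) (≤-trans (m≤m+n (x + r) s) (≤-reflexive e)))

  interchange : ∀ a b c d → (a + b) + (c + d) ≡ (a + c) + (b + d)
  interchange a b c d = solve (a ∷ b ∷ c ∷ d ∷ [])

  add-at-hub : ∀ {a b c e D} → a ≤ b + D → c ≤ e → a + c ≤ b + e + D
  add-at-hub {a} {b} {c} {e} {D} h l = farkas 0 (h ⊞ l) (solve (a ∷ b ∷ c ∷ e ∷ D ∷ []))

  add-off-hub : ∀ {a b c e D} → a ≤ b → c ≤ e + D → a + c ≤ b + e + D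
  add-off-hub {a} {b} {c} {e} {D} h l = farkas 0 (h ⊞ l) (solve (a ∷ b ∷ c ∷ e ∷ D ∷ []))

  add-one-each : ∀ {a b c e D} → a ≤ suc b → c ≤ e + D → a + c ≤ b + e + suc D
  add-one-each {a} {b} {c} {e} {D} h l = farkas 0 (h ⊞ l) (solve (a ∷ b ∷ c ∷ e ∷ D ∷ []))

  -- Here and below, x, u, v are degrees or weights in U, f is a weight inside the remainder, and D,
  -- F, U are orders. The summand 1 in U = 1 + D + F is the cut vertex, and the trailing 0 comes
  -- from the weight of the empty list.
  pair-light : ∀ {x v D F U} → x ≤ D → v ≤ F → U ≡ suc D + F → x + (v + 0) < U
  pair-light {x} {v} {D} {F} h l refl = farkas 0 (h ⊞ l) (solve (x ∷ v ∷ D ∷ F ∷ []))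

  rich-light : ∀ {x u f F D U} → u ≤ f + x → f < F → x + x ≤ suc D → U ≡ suc D + F → x + u < U
  rich-light {x} {u} {f} {F} {D} h l r refl = farkas 0 (h ⊞ l ⊞ r) (solve (x ∷ u ∷ f ∷ F ∷ D ∷ []))

  absorb-light : ∀ {u f D F U} → u ≤ f + D → f < F → U ≡ D + F → u < U
  absorb-light {u} {f} {D} {F} h l refl = farkas 0 (h ⊞ l) (solve (u ∷ f ∷ D ∷ F ∷ []))

  absorb-degree : ∀ {j A u f D A'} → j + A ≤ u → u ≤ f + D → A ≡ D + A' → j + A' ≤ f
  absorb-degree {j} {_} {u} {f} {D} {A'} h l refl = farkas 0 (h ⊞ l) (solve (j ∷ u ∷ f ∷ D ∷ A' ∷ []))

  detach-light : ∀ {x u f D F U} → u ≤ f → f < F → x ≤ D → U ≡ D + F → x + u < U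
  detach-light {x} {u} {f} {D} {F} h l r refl = farkas 0 (h ⊞ l ⊞ r) (solve (x ∷ u ∷ f ∷ D ∷ F ∷ []))

  -- The degree bounds are doubled, so the other hypotheses are counted twice and the factor 2 is
  -- cancelled at the end. Contradictions are stated as `W < W` here and below, to keep the shape
  -- that `farkas` expects.
  dense-common : ∀ {x y W V D} → 2 + D ≤ x + x → 2 + D ≤ y + y → x + y ≤ W + V → suc W ≡ D → V ≤ 2 → W < W
  dense-common {x} {y} {W} {V} h l r refl t =
    *-cancelˡ-≤ 2 (farkas 0 (h ⊞ l ⊞ r ⊞ r ⊞ t ⊞ t) (solve (x ∷ y ∷ W ∷ V ∷ [])))

  sum-< : ∀ {a b A c e C} → a ≤ b → b < A → c ≤ e → e < C → a + c < A + C
  sum-< {a} {b} {A} {c} {e} {C} h l r t = farkas 1 (h ⊞ l ⊞ r ⊞ t) (solve (a ∷ b ∷ A ∷ c ∷ e ∷ C ∷ []))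

  triple-light : ∀ {x u v D F U} → x ≤ D → u + v < suc F → U ≡ suc D + F → x + (u + (v + 0)) < U
  triple-light {x} {u} {v} {D} {F} h l refl = farkas 0 (h ⊞ l) (solve (x ∷ u ∷ v ∷ D ∷ F ∷ []))

  ore-components : ∀ {u v F P Q} → suc F ≤ u + v → u ≤ P → v ≤ Q → P + Q ≤ F → F < F
  ore-components {u} {v} {F} {P} {Q} h l r t = farkas 0 (h ⊞ l ⊞ r ⊞ t) (solve (u ∷ v ∷ F ∷ P ∷ Q ∷ []))

  ore-cut : ∀ {u v F P Q} → suc F ≤ u + v → suc u ≤ suc P → v ≤ suc Q → P + Q < F → F < F
  ore-cut {u} {v} {F} {P} {Q} h l r t = farkas 0 (h ⊞ l ⊞ r ⊞ t) (solve (u ∷ v ∷ F ∷ P ∷ Q ∷ []))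

  hs-tight-light : ∀ {c x K L} → c ≤ 2 → x ≤ suc K → 1 ≤ L → c + (x + 0) < K + L + 4
  hs-tight-light {c} {x} {K} {L} h l r = farkas 1 (h ⊞ l ⊞ r) (solve (c ∷ x ∷ K ∷ L ∷ []))

  f5-tight-light : ∀ {x y} → x ≤ 2 → y ≤ 2 → x + (y + 0) < 5
  f5-tight-light {x} {y} h l = farkas 0 (h ⊞ l) (solve (x ∷ y ∷ []))

  big-tight-light : ∀ {x y z} → x ≤ 3 → y ≤ 3 → z ≤ 3 → x + (y + (z + 0)) < 11
  big-tight-light {x} {y} {z} h l r = farkas 1 (h ⊞ l ⊞ r) (solve (x ∷ y ∷ z ∷ []))

  hs-order : ∀ {K L} → 1 ≤ K → 5 ≤ K + L + 4
  hs-order {K} {L} h = farkas L h (solve (K ∷ L ∷ []))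

  big-weak-light : ∀ {c x y z P Q} → c ≤ 3 → x ≤ 4 → y ≤ 4 → z ≤ 4 → 11 ≤ P → 5 ≤ Q → c + (x + (y + (z + 0))) < suc P + Q
  big-weak-light {c} {x} {y} {z} {P} {Q} h₁ h₂ h₃ h₄ h₅ h₆ =
    farkas 1 (h₁ ⊞ h₂ ⊞ h₃ ⊞ h₄ ⊞ h₅ ⊞ h₆) (solve (c ∷ x ∷ y ∷ z ∷ P ∷ Q ∷ []))

  big-big-light : ∀ {a b x y z P Q} → a ≤ 4 → b ≤ 4 → x ≤ 4 → y ≤ 4 → z ≤ 4 → 11 ≤ P → 11 ≤ Q →
           a + (b + (x + (y + (z + 0)))) < suc P + Q
  big-big-light {a} {b} {x} {y} {z} {P} {Q} h₀ h₁ h₂ h₃ h₄ h₅ h₆ =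
    farkas 2 (h₀ ⊞ h₁ ⊞ h₂ ⊞ h₃ ⊞ h₄ ⊞ h₅ ⊞ h₆) (solve (a ∷ b ∷ x ∷ y ∷ z ∷ P ∷ Q ∷ []))

  hs-hs-light : ∀ {c k c' k' K L K' L' P Q} → c ≤ 3 → k ≤ suc (suc K) → c' ≤ 3 → k' ≤ suc (suc K') → 1 ≤ L → 1 ≤ L' →
           K + L + 4 ≤ P → K' + L' + 4 ≤ Q → c + (k + (c' + (k' + 0))) < suc P + Q
  hs-hs-light {c} {k} {c'} {k'} {K} {L} {K'} {L'} {P} {Q} h₀ h₁ h₂ h₃ h₄ h₅ h₆ h₇ =
    farkas 0 (h₀ ⊞ h₁ ⊞ h₂ ⊞ h₃ ⊞ h₄ ⊞ h₅ ⊞ h₆ ⊞ h₇) (solve (c ∷ k ∷ c' ∷ k' ∷ K ∷ L ∷ K' ∷ L' ∷ P ∷ Q ∷ []))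

  -- The weight is at most 3 + 3 + 3 + (K + 2) and the order at least 1 + 5 + (K + L + 4).
  other-side-small : ∀ {x y c k K L P Q} → suc P + Q ≤ x + (y + (c + (k + 0))) → x ≤ 3 → y ≤ 3 → c ≤ 3 → k ≤ suc (suc K) →
           5 ≤ P → K + L + 4 ≤ Q → L ≤ 1
  other-side-small {x} {y} {c} {k} {K} {L} {P} {Q} h₀ h₁ h₂ h₃ h₄ h₅ h₆ =
    farkas 0 (h₀ ⊞ h₁ ⊞ h₂ ⊞ h₃ ⊞ h₄ ⊞ h₅ ⊞ h₆) (solve (x ∷ y ∷ c ∷ k ∷ K ∷ L ∷ P ∷ Q ∷ []))

  other-side-empty : ∀ {x y c k K L P Q} → suc P + Q ≤ x + (y + (c + (k + 0))) → x ≤ 3 → y ≤ 3 → c ≤ 3 → k ≤ suc K →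
           5 ≤ P → K + L + 4 ≤ Q → L ≤ 0
  other-side-empty {x} {y} {c} {k} {K} {L} {P} {Q} h₀ h₁ h₂ h₃ h₄ h₅ h₆ =
    farkas 0 (h₀ ⊞ h₁ ⊞ h₂ ⊞ h₃ ⊞ h₄ ⊞ h₅ ⊞ h₆) (solve (x ∷ y ∷ c ∷ k ∷ K ∷ L ∷ P ∷ Q ∷ []))

  corner-light : ∀ {b c x P Q} → b ≤ 2 → c ≤ 3 → x ≤ 3 → 5 ≤ P → 5 ≤ Q → b + (c + (x + 0)) < suc P + Q
  corner-light {b} {c} {x} {P} {Q} h₀ h₁ h₂ h₃ h₄ =
    farkas 2 (h₀ ⊞ h₁ ⊞ h₂ ⊞ h₃ ⊞ h₄) (solve (b ∷ c ∷ x ∷ P ∷ Q ∷ []))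

  tight-no-A : ∀ {j A u f} → suc j + A ≤ u → u ≤ suc f → f ≤ j → A ≤ 0
  tight-no-A {j} {A} {u} {f} h₀ h₁ h₂ = farkas 0 (h₀ ⊞ h₁ ⊞ h₂) (solve (j ∷ A ∷ u ∷ f ∷ []))

  lone-light₄ : ∀ {u v P Q Y D c k K L F U} → u ≤ suc P → v ≤ suc Q → P + Q ≤ Y → suc Y ≤ D → c ≤ 3 → k ≤ suc K → 1 ≤ L →
           K + L + 4 ≤ F → U ≡ suc D + F → u + (v + (c + (k + 0))) < U
  lone-light₄ {u} {v} {P} {Q} {Y} {D} {c} {k} {K} {L} {F} h₀ h₁ h₂ h₃ h₄ h₅ h₆ h₇ refl =
    farkas 0 (h₀ ⊞ h₁ ⊞ h₂ ⊞ h₃ ⊞ h₄ ⊞ h₅ ⊞ h₆ ⊞ h₇)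
      (solve (u ∷ v ∷ P ∷ Q ∷ Y ∷ D ∷ c ∷ k ∷ K ∷ L ∷ F ∷ []))

  lone-light₃ : ∀ {c k x K L D F U} → c ≤ 3 → k ≤ suc K → x ≤ D → 1 ≤ L → K + L + 4 ≤ F → U ≡ suc D + F → c + (k + (x + 0)) < U
  lone-light₃ {c} {k} {x} {K} {L} {D} {F} h₀ h₁ h₂ h₃ h₄ refl =
    farkas 1 (h₀ ⊞ h₁ ⊞ h₂ ⊞ h₃ ⊞ h₄) (solve (c ∷ k ∷ x ∷ K ∷ L ∷ D ∷ F ∷ []))

  rich-3 : ∀ {x F} → x ≤ 3 → 5 ≤ F → x + x ≤ suc F
  rich-3 {x} {F} h₀ h₁ = farkas 0 (h₀ ⊞ h₀ ⊞ h₁) (solve (x ∷ F ∷ []))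

  rich-4 : ∀ {x F} → x ≤ 4 → 11 ≤ F → x + x ≤ suc F
  rich-4 {x} {F} h₀ h₁ = farkas 4 (h₀ ⊞ h₀ ⊞ h₁) (solve (x ∷ F ∷ []))

  absorb-tight : ∀ {j A u f} → j + A ≤ u → u ≤ f → f ≤ j → 1 ≤ A → 1 ≤ 0
  absorb-tight {j} {A} {u} {f} h₀ h₁ h₂ h₃ = farkas 0 (h₀ ⊞ h₁ ⊞ h₂ ⊞ h₃) (solve (j ∷ A ∷ u ∷ f ∷ []))

  rich-large : ∀ {x D} → 2 ≤ x → x + x ≤ suc D → 3 ≤ D
  rich-large {x} {D} h₀ h₁ = farkas 0 (h₀ ⊞ h₀ ⊞ h₁) (solve (x ∷ D ∷ []))

  two-outside : ∀ {p q x D} → 2 + p ≤ x → x ≤ D → D ≤ p + q → 2 ≤ q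
  two-outside {p} {q} {x} {D} h₀ h₁ h₂ = farkas 0 (h₀ ⊞ h₁ ⊞ h₂) (solve (p ∷ q ∷ x ∷ D ∷ []))

  full-degree : ∀ {p q x D} → 2 + p ≤ x → D ≤ p + q → q ≤ 2 → D ≤ x
  full-degree {p} {q} {x} {D} h₀ h₁ h₂ = farkas 0 (h₀ ⊞ h₁ ⊞ h₂) (solve (p ∷ q ∷ x ∷ D ∷ []))

  low-degree-no-A : ∀ {A x} → 2 + A ≤ x → x ≤ 2 → A ≤ 0
  low-degree-no-A {A} {x} h₀ h₁ = farkas 0 (h₀ ⊞ h₁) (solve (A ∷ x ∷ []))

  edge-no-A : ∀ {A x U} → 1 + A ≤ x → x < U → U < 3 → A ≤ 0
  edge-no-A {A} {x} {U} h₀ h₁ h₂ = farkas 0 (h₀ ⊞ h₁ ⊞ h₂) (solve (A ∷ x ∷ U ∷ []))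

  front-order : ∀ k l → k + l + 4 ≡ suc k + suc l + 2
  front-order k l = solve (k ∷ l ∷ [])

open import Defs hiding (here; step; w)
import Defs
open import Data.Bool using (Bool; true; false; not; _∧_; _∨_; if_then_else_; T) renaming (_≟_ to _≟ᵇ_)
open import Data.Bool.ListAction using (any; all)
open import Data.Bool.Properties using (∨-identityʳ)
open import Data.Empty using (⊥; ⊥-elim)
open import Data.Fin using (Fin; zero; suc; toℕ; cast)
open import Data.Fin.Patterns
open import Data.Fin.Properties using (toℕ-cast; toℕ-injective; toℕ<n; suc-injective)
open import Data.List using (List; []; _∷_; _++_; length; take; map; foldr; allFin; tabulate; filter; lookup)
open import Data.List.Membership.Propositional using () renaming (_∈_ to _∈ˡ_)
open import Data.List.Membership.Propositional.Properties using (∈-map⁺; ∈-++⁺ˡ; ∈-++⁺ʳ; ∈-++⁻; ∈-filter⁺; ∈-filter⁻; ∈-allFin; ∈-lookup)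
open import Data.List.Properties using (length-take; length-++)
open import Data.List.Relation.Unary.All as All using (All; []; _∷_)
import Data.List.Relation.Unary.All.Properties as Allₚ
open import Data.List.Relation.Unary.AllPairs as AllPairs using (AllPairs; []; _∷_)
import Data.List.Relation.Unary.AllPairs.Properties as AllPairsₚ
open import Data.List.Relation.Unary.Any as Any using (Any; here; there)
import Data.List.Relation.Unary.Any.Properties as Anyₚ
import Data.List.Relation.Unary.Unique.Propositional.Properties as Uniqueₚ
open import Data.Nat using (ℕ; zero; suc; _+_; _∸_; _≤_; _<_; z≤n; s≤s; _≤ᵇ_; _≡ᵇ_; _⊓_; _⊔_)
open import Data.Nat.ListAction using (sum)
open import Data.Nat.Properties hiding (suc-injective)
open import Data.Product using (Σ; ∃; _×_; _,_; proj₁; proj₂)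
open import Data.Sum using (_⊎_; inj₁; inj₂; [_,_]′)
open import Data.Unit using (tt)
open import Function using (_∘_; id)
open import Function.Bundles using (mk↔ₛ′)
open import Relation.Binary.PropositionalEquality using (_≡_; _≢_; refl; sym; trans; cong; cong₂; subst)

open Arithmetic

-- Sets of vertices and counting

infix 4 _∈_ _∉_
infixl 7 _∩_
infixl 6 _∪_ _∖_ _⊕_ _─_

record _∈_ {n} (i : Fin n) (S : VSet n) : Set where
  constructor mem
  field isTrue : S i ≡ true

record _∉_ {n} (i : Fin n) (S : VSet n) : Set where
  constructor nmem
  field isFalse : S i ≡ false

open _∈_ public
open _∉_ public

opaque
  _∩_ _∪_ _∖_ : ∀ {n} → VSet n → VSet n → VSet n
  (S ∩ T) i = S i ∧ T i
  (S ∪ T) i = S i ∨ T i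
  (S ∖ T) i = S i ∧ not (T i)

  ⁅_⁆ : ∀ {n} → Fin n → VSet n
  ⁅ a ⁆ i = i == a

_⊕_ _─_ : ∀ {n} → VSet n → Fin n → VSet n
S ⊕ a = S ∪ ⁅ a ⁆
S ─ a = S ∖ ⁅ a ⁆

∅ full : ∀ {n} → VSet n
∅ _ = false
full _ = true

absurdᵇ : ∀ {b : Bool} → b ≡ true → b ≡ false → ⊥
absurdᵇ refl ()

∧⁻ : ∀ {a b : Bool} → a ∧ b ≡ true → a ≡ true × b ≡ true
∧⁻ {true} {true} _ = refl , refl

∨⁻ : ∀ {a b : Bool} → a ∨ b ≡ true → a ≡ true ⊎ b ≡ true
∨⁻ {true} _ = inj₁ refl
∨⁻ {false} p = inj₂ p

∨⁺ʳ : ∀ {a b : Bool} → b ≡ true → a ∨ b ≡ true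
∨⁺ʳ {true} _ = refl
∨⁺ʳ {false} p = p

not⁻ : ∀ {a : Bool} → not a ≡ true → a ≡ false
not⁻ {false} _ = refl

≡ᵇ-refl : ∀ k → (k ≡ᵇ k) ≡ true
≡ᵇ-refl zero = refl
≡ᵇ-refl (suc k) = ≡ᵇ-refl k

≡ᵇ-sound : ∀ k l → (k ≡ᵇ l) ≡ true → k ≡ l
≡ᵇ-sound zero zero _ = refl
≡ᵇ-sound (suc k) (suc l) h = cong suc (≡ᵇ-sound k l h)

≡⇒T : ∀ {b} → b ≡ true → T b
≡⇒T refl = tt

T⇒≡ : ∀ {b} → T b → b ≡ true
T⇒≡ {true} _ = refl

module _ {n : ℕ} {S : VSet n} {i : Fin n} where
  clash : i ∈ S → i ∉ S → ⊥
  clash (mem p) (nmem q) = absurdᵇ p q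

  ∉-intro : (i ∈ S → ⊥) → i ∉ S
  ∉-intro h with S i in eq
  ... | true = ⊥-elim (h (mem eq))
  ... | false = nmem eq

opaque
  unfolding _∩_

  ∩⁺ : ∀ {n} {S T : VSet n} {i : Fin n} → i ∈ S → i ∈ T → i ∈ S ∩ T
  ∩⁺ (mem p) (mem q) = mem (trans (cong₂ _∧_ p q) refl)

  ∩⁻ : ∀ {n} {S T : VSet n} {i : Fin n} → i ∈ S ∩ T → i ∈ S × i ∈ T
  ∩⁻ (mem p) with ∧⁻ p
  ... | q , r = mem q , mem r

  ∪⁺ˡ : ∀ {n} {S T : VSet n} {i : Fin n} → i ∈ S → i ∈ S ∪ T
  ∪⁺ˡ {T = T} {i} (mem p) = mem (cong (_∨ T i) p)

  ∪⁺ʳ : ∀ {n} {S T : VSet n} {i : Fin n} → i ∈ T → i ∈ S ∪ T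
  ∪⁺ʳ {S = S} {i = i} (mem p) = mem (∨⁺ʳ {S i} p)

  ∪⁻ : ∀ {n} {S T : VSet n} {i : Fin n} → i ∈ S ∪ T → i ∈ S ⊎ i ∈ T
  ∪⁻ {S = S} {i = i} (mem p) with ∨⁻ {a = S i} p
  ... | inj₁ q = inj₁ (mem q)
  ... | inj₂ q = inj₂ (mem q)

  ∖⁺ : ∀ {n} {S T : VSet n} {i : Fin n} → i ∈ S → i ∉ T → i ∈ S ∖ T
  ∖⁺ (mem p) (nmem q) = mem (cong₂ (λ a b → a ∧ not b) p q)

  ∖⁻ : ∀ {n} {S T : VSet n} {i : Fin n} → i ∈ S ∖ T → i ∈ S × i ∉ T
  ∖⁻ (mem p) with ∧⁻ p
  ... | q , r = mem q , nmem (not⁻ r)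

opaque
  unfolding ⁅_⁆

  single⁻ : ∀ {n} {i a : Fin n} → i ∈ ⁅ a ⁆ → i ≡ a
  single⁻ {i = i} {a} (mem h) = toℕ-injective (≡ᵇ-sound (toℕ i) (toℕ a) h)

  single⁺ : ∀ {n} (a : Fin n) → a ∈ ⁅ a ⁆
  single⁺ a = mem (≡ᵇ-refl (toℕ a))

split : ∀ {n} (S : VSet n) i → i ∈ S ⊎ i ∉ S
split S i with S i in eq
... | true = inj₁ (mem eq)
... | false = inj₂ (nmem eq)

module _ {n : ℕ} {S T : VSet n} {i : Fin n} where
  ∪∉ : i ∉ S → i ∉ T → i ∉ S ∪ T
  ∪∉ p q = ∉-intro λ r → [ (λ t → clash t p) , (λ t → clash t q) ]′ (∪⁻ r)

  ∪∉⁻ : i ∉ S ∪ T → i ∉ S × i ∉ T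
  ∪∉⁻ p = ∉-intro (λ q → clash (∪⁺ˡ q) p) , ∉-intro (λ q → clash (∪⁺ʳ {S = S} q) p)

  ∖∉ʳ : i ∈ T → i ∉ S ∖ T
  ∖∉ʳ p = ∉-intro λ q → clash p (proj₂ (∖⁻ q))

  ∖∉ˡ : i ∉ S → i ∉ S ∖ T
  ∖∉ˡ p = ∉-intro λ q → clash (proj₁ (∖⁻ q)) p

  ∖∉⁻ : i ∉ S ∖ T → i ∈ S → i ∈ T
  ∖∉⁻ p q with split T i
  ... | inj₁ r = r
  ... | inj₂ r = ⊥-elim (clash (∖⁺ q r) p)

single∉ : ∀ {n} {i a : Fin n} → i ≢ a → i ∉ ⁅ a ⁆
single∉ h = ∉-intro (h ∘ single⁻)

≟⊎ : ∀ {n} (i a : Fin n) → i ≡ a ⊎ i ≢ a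
≟⊎ i a with split ⁅ a ⁆ i
... | inj₁ p = inj₁ (single⁻ p)
... | inj₂ p = inj₂ λ { refl → clash (single⁺ i) p }

module _ {n : ℕ} {S : VSet n} {i a : Fin n} where
  ⊕⁻ : i ∈ S ⊕ a → i ∈ S ⊎ i ≡ a
  ⊕⁻ p with ∪⁻ p
  ... | inj₁ q = inj₁ q
  ... | inj₂ q = inj₂ (single⁻ q)

  ⊕∉ : i ∉ S → i ≢ a → i ∉ S ⊕ a
  ⊕∉ p q = ∪∉ p (single∉ q)

  ⊕∉⁻ : i ∉ S ⊕ a → i ∉ S × i ≢ a
  ⊕∉⁻ p with ∪∉⁻ {S = S} p
  ... | q , r = q , λ { refl → clash (single⁺ a) r }

  ─⁺ : i ∈ S → i ≢ a → i ∈ S ─ a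
  ─⁺ p q = ∖⁺ p (single∉ q)

  ─⁻ : i ∈ S ─ a → i ∈ S × i ≢ a
  ─⁻ p with ∖⁻ p
  ... | q , r = q , λ { refl → clash (single⁺ a) r }

a∈⊕ : ∀ {n} {S : VSet n} {a} → a ∈ S ⊕ a
a∈⊕ {S = S} {a} = ∪⁺ʳ {S = S} (single⁺ a)

∀⊎∃ : ∀ {n} {P Q : Fin n → Set} → (∀ i → P i ⊎ Q i) → (∀ i → P i) ⊎ (∃ λ i → Q i)
∀⊎∃ {zero} h = inj₁ λ ()
∀⊎∃ {suc n} {P} {Q} h with h zero | ∀⊎∃ {n} {P ∘ suc} {Q ∘ suc} (h ∘ suc)
... | inj₂ q | _ = inj₂ (zero , q)
... | inj₁ p | inj₂ (i , q) = inj₂ (suc i , q)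
... | inj₁ p | inj₁ ps = inj₁ λ { zero → p ; (suc i) → ps i }

search : ∀ {n} (S : VSet n) → (∃ λ i → i ∈ S) ⊎ (∀ i → i ∉ S)
search S with ∀⊎∃ {P = _∉ S} {Q = _∈ S} (λ i → [ inj₂ , inj₁ ]′ (split S i))
... | inj₁ p = inj₂ p
... | inj₂ q = inj₁ q

∑ : ∀ {n} → (Fin n → ℕ) → ℕ
∑ {zero} f = 0
∑ {suc n} f = f zero + ∑ (f ∘ suc)

𝟙 : Bool → ℕ
𝟙 b = if b then 1 else 0

opaque
  # : ∀ {n} → VSet n → ℕ
  # S = ∑ (𝟙 ∘ S)

∑-mono : ∀ {n} {f g : Fin n → ℕ} → (∀ i → f i ≤ g i) → ∑ f ≤ ∑ g
∑-mono {zero} h = z≤n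
∑-mono {suc n} h = h zero ⊞ ∑-mono (h ∘ suc)

∑-+ : ∀ {n} (f g : Fin n → ℕ) → ∑ (λ i → f i + g i) ≡ ∑ f + ∑ g
∑-+ {zero} f g = refl
∑-+ {suc n} f g rewrite ∑-+ (f ∘ suc) (g ∘ suc) = interchange (f zero) (g zero) _ _

∑-zero : ∀ n → ∑ {n} (λ _ → 0) ≡ 0
∑-zero zero = refl
∑-zero (suc n) = ∑-zero n

opaque
  unfolding #

  -- Inclusion-exclusion as an inequality: U bounds the union and V the intersection. With
  -- neighbourhoods for S and T it bounds two degrees by the available places and the common
  -- neighbours.
  #-∩∪ : ∀ {n} {S T U V : VSet n} → (∀ i → i ∈ S → i ∈ U) → (∀ i → i ∈ T → i ∈ U) →
         (∀ i → i ∈ S → i ∈ T → i ∈ V) → # S + # T ≤ # U + # V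
  #-∩∪ {S = S} {T} {U} {V} su tu stv =
    subst (_≤ # U + # V) (∑-+ (𝟙 ∘ S) (𝟙 ∘ T)) (subst (∑ (λ i → 𝟙 (S i) + 𝟙 (T i)) ≤_) (∑-+ (𝟙 ∘ U) (𝟙 ∘ V)) (∑-mono pt))
    where
    pt : ∀ i → 𝟙 (S i) + 𝟙 (T i) ≤ 𝟙 (U i) + 𝟙 (V i)
    pt i with S i in p | T i in q
    ... | false | false = z≤n
    ... | true | false rewrite isTrue (su i (mem p)) = s≤s z≤n
    ... | false | true rewrite isTrue (tu i (mem q)) = s≤s z≤n
    ... | true | true rewrite isTrue (su i (mem p)) | isTrue (stv i (mem p) (mem q)) = ≤-refl

  #-cover : ∀ {n} {S T R : VSet n} → (∀ i → i ∈ S → i ∈ T ⊎ i ∈ R) → # S ≤ # T + # R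
  #-cover {S = S} {T} {R} h = subst (# S ≤_) (∑-+ (𝟙 ∘ T) (𝟙 ∘ R)) (∑-mono pt)
    where
    pt : ∀ i → 𝟙 (S i) ≤ 𝟙 (T i) + 𝟙 (R i)
    pt i with S i in p
    ... | false = z≤n
    ... | true with h i (mem p)
    ...   | inj₁ (mem q) rewrite q = s≤s z≤n
    ...   | inj₂ (mem q) rewrite q = m≤n+m 1 (𝟙 (T i))

  #-⊆ : ∀ {n} {S T : VSet n} → (∀ i → i ∈ S → i ∈ T) → # S ≤ # T
  #-⊆ {S = S} {T} h = ∑-mono pt
    where
    pt : ∀ i → 𝟙 (S i) ≤ 𝟙 (T i)
    pt i with S i in p
    ... | false = z≤n
    ... | true rewrite isTrue (h i (mem p)) = ≤-refl

  #-∅ : ∀ {n} → # {n} ∅ ≡ 0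
  #-∅ {n} = ∑-zero n

module _ {n : ℕ} where
  #-disj : ∀ {S T U : VSet n} → (∀ i → i ∈ S → i ∈ U) → (∀ i → i ∈ T → i ∈ U) →
           (∀ i → i ∈ S → i ∈ T → ⊥) → # S + # T ≤ # U
  #-disj {S} {T} {U} su tu d =
    subst (# S + # T ≤_) (trans (cong (# U +_) #-∅) (+-identityʳ _))
      (#-∩∪ {S = S} {T} {U} {∅} su tu (λ i p q → ⊥-elim (d i p q)))

  #-none : ∀ {S : VSet n} → (∀ i → i ∉ S) → # S ≡ 0
  #-none {S} h = n≤0⇒n≡0 (subst (# S ≤_) #-∅ (#-⊆ {S = S} {∅} (λ i p → ⊥-elim (clash p (h i)))))

opaque
  unfolding ⁅_⁆ #

  #-single : ∀ {n} (a : Fin n) → # ⁅ a ⁆ ≡ 1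
  #-single {suc n} zero = cong suc (∑-zero n)
  #-single {suc n} (suc a) = #-single a

module _ {n : ℕ} where
  #-⊕ : ∀ {S : VSet n} {a} → a ∉ S → # (S ⊕ a) ≡ suc (# S)
  #-⊕ {S = S} {a} h = ≤-antisym
    (≤-trans (#-cover {S = S ⊕ a} {S} {⁅ a ⁆} (λ i → ∪⁻ {S = S}))
      (≤-reflexive (trans (cong (# S +_) (#-single a)) (+-comm (# S) 1))))
    (≤-trans (≤-reflexive (trans (+-comm 1 (# S)) (sym (cong (# S +_) (#-single a)))))
      (#-disj {S = S} {⁅ a ⁆} {S ⊕ a} (λ i → ∪⁺ˡ {S = S}) (λ i → ∪⁺ʳ {S = S})
        (λ i p q → clash (subst (_∈ S) (single⁻ q) p) h)))

  #-∖ : ∀ {S T : VSet n} → (∀ i → i ∈ T → i ∈ S) → # S ≡ # T + # (S ∖ T)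
  #-∖ {S = S} {T} h = ≤-antisym
    (#-cover {S = S} {T} {S ∖ T} (λ i p → [ inj₁ , inj₂ ∘ ∖⁺ {S = S} {T} p ]′ (split T i)))
    (#-disj {S = T} {S ∖ T} {S} h (λ i → proj₁ ∘ ∖⁻ {S = S} {T}) (λ i p q → clash p (proj₂ (∖⁻ {S = S} {T} q))))

  #-─ : ∀ {S : VSet n} {a} → a ∈ S → # S ≡ suc (# (S ─ a))
  #-─ {S = S} {a} h = trans (#-∖ {S = S} {⁅ a ⁆} (λ i p → subst (_∈ S) (sym (single⁻ p)) h)) (cong (_+ # (S ─ a)) (#-single a))

  #-strict : ∀ {S T : VSet n} {p} → (∀ i → i ∈ S → i ∈ T) → p ∈ T → p ∉ S → suc (# S) ≤ # T
  #-strict {S = S} {T} {p} h a b = subst (_≤ # T) (#-⊕ {S = S} b)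
    (#-⊆ {S = S ⊕ p} {T} (λ i q → [ h i , (λ { refl → a }) ]′ (⊕⁻ {S = S} q)))

  #-pos : ∀ {S : VSet n} {p} → p ∈ S → 1 ≤ # S
  #-pos {S = S} {p} h = subst (1 ≤_) (sym (#-─ {S = S} {p} h)) (s≤s z≤n)

  #-pos⁻ : ∀ {S : VSet n} → 1 ≤ # S → ∃ λ i → i ∈ S
  #-pos⁻ {S = S} h with search S
  ... | inj₁ p = p
  ... | inj₂ q = ⊥-elim (<⇒≢ h (sym (#-none {S = S} q)))

  #-zero⁻ : ∀ {S : VSet n} → # S ≡ 0 → ∀ i → i ∉ S
  #-zero⁻ {S = S} h i = ∉-intro {S = S} (λ p → <⇒≢ (#-pos {S = S} p) (sym h))

  #-eq : ∀ {S T : VSet n} → (∀ i → i ∈ S → i ∈ T) → (∀ i → i ∈ T → i ∈ S) → # S ≡ # T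
  #-eq {S = S} {T} h g = ≤-antisym (#-⊆ {S = S} {T} h) (#-⊆ {S = T} {S} g)

  #-list≤ : ∀ {S : VSet n} (l : List (Fin n)) → (∀ i → i ∈ S → i ∈ˡ l) → # S ≤ length l
  #-list≤ {S = S} [] h = ≤-reflexive (#-none {S = S} (λ i → ∉-intro {S = S} (λ p → ¬[] (h i p))))
    where
    ¬[] : ∀ {i : Fin n} → i ∈ˡ [] → ⊥
    ¬[] ()
  #-list≤ {S = S} (x ∷ l) h = ≤-trans
    (#-cover {S = S} {⁅ x ⁆} {S ─ x} (λ i p → [ (λ { refl → inj₁ (single⁺ i) }) , inj₂ ∘ ─⁺ {S = S} p ]′ (≟⊎ i x)))
    (subst (λ k → k + # (S ─ x) ≤ suc (length l)) (sym (#-single x)) (s≤s (#-list≤ {S = S ─ x} l g)))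
    where
    g : ∀ i → i ∈ S ─ x → i ∈ˡ l
    g i p with ─⁻ {S = S} p
    ... | q , r with h i q
    ...   | here e = ⊥-elim (r e)
    ...   | there t = t

  #-list≥ : ∀ {S : VSet n} {l : List (Fin n)} → AllPairs _≢_ l → All (_∈ S) l → length l ≤ # S
  #-list≥ [] [] = z≤n
  #-list≥ {S = S} {x ∷ l} (d ∷ ds) (p ∷ ps) = subst (suc (length l) ≤_) (sym (#-─ {S = S} {x} p))
    (s≤s (#-list≥ {S = S ─ x} ds (All.zipWith (λ { (q , r) → ─⁺ {S = S} q (r ∘ sym) }) (ps , d))))

opaque
  unfolding #

  #-img≤ : ∀ {m n} (e : Fin m → Fin n) {S : VSet n} {R : VSet m} →
           (∀ u → u ∈ S → ∃ λ j → j ∈ R × e j ≡ u) → # S ≤ # R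
  #-img≤ {zero} e {S} {R} h = ≤-reflexive (#-none (λ i → ∉-intro (λ p → noFin (proj₁ (h i p)))))
    where
    noFin : Fin zero → ⊥
    noFin ()
  #-img≤ {suc m} {n} e {S} {R} h with R zero in eq
  ... | true = ≤-trans
      (#-cover {S = S} {⁅ x ⁆} {S ─ x} (λ i p → [ (λ { refl → inj₁ (single⁺ i) }) , inj₂ ∘ ─⁺ {S = S} p ]′ (≟⊎ i x)))
      (subst (λ k → k + # (S ─ x) ≤ suc (# (R ∘ suc))) (sym (#-single x)) (s≤s (#-img≤ (e ∘ suc) {S ─ x} {R ∘ suc} g)))
    where
    x : Fin n
    x = e zero
    g : ∀ u → u ∈ S ─ x → ∃ λ j → j ∈ R ∘ suc × e (suc j) ≡ u
    g u p with ─⁻ {S = S} p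
    ... | q , r with h u q
    ...   | zero , _ , t = ⊥-elim (r (sym t))
    ...   | suc j , mem s , t = j , mem s , t
  ... | false = #-img≤ (e ∘ suc) {S} {R ∘ suc} g
    where
    g : ∀ u → u ∈ S → ∃ λ j → j ∈ R ∘ suc × e (suc j) ≡ u
    g u q with h u q
    ...   | zero , s , t = ⊥-elim (absurdᵇ (isTrue s) eq)
    ...   | suc j , mem s , t = j , mem s , t

  #-img≥ : ∀ {m n} (e : Fin m → Fin n) {S : VSet n} {R : VSet m} → (∀ i j → e i ≡ e j → i ≡ j) →
           (∀ j → j ∈ R → e j ∈ S) → # R ≤ # S
  #-img≥ {zero} e inj h = z≤n
  #-img≥ {suc m} {n} e {S} {R} inj h with R zero in eq
  ... | true = subst (suc (# (R ∘ suc)) ≤_) (sym (#-─ {S = S} (h zero (mem eq))))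
      (s≤s (#-img≥ (e ∘ suc) {S ─ e zero} {R ∘ suc} (λ i j p → suc-injective (inj _ _ p))
        (λ { j (mem p) → ─⁺ {S = S} (h (suc j) (mem p)) (λ q → 0≢s (inj _ _ q)) })))
    where
    0≢s : ∀ {m} {i : Fin m} → Fin.suc i ≡ zero → ⊥
    0≢s ()
  ... | false = #-img≥ (e ∘ suc) {S} {R ∘ suc} (λ i j p → suc-injective (inj _ _ p)) (λ { j (mem p) → h (suc j) (mem p) })

infix 4 _⊆_ _≐_
_⊆_ _≐_ : ∀ {n} → VSet n → VSet n → Set
S ⊆ T = ∀ {i} → i ∈ S → i ∈ T
S ≐ T = S ⊆ T × T ⊆ S

∁ : ∀ {n} → VSet n → VSet n
∁ K i = not (K i)

∁⁺ : ∀ {n} {K : VSet n} {i} → i ∉ K → i ∈ ∁ K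
∁⁺ (nmem p) = mem (cong not p)

∁∉ : ∀ {n} {K : VSet n} {i} → i ∈ K → i ∉ ∁ K
∁∉ (mem p) = nmem (cong not p)

∁⁻ : ∀ {n} {K : VSet n} {i} → i ∈ ∁ K → i ∉ K
∁⁻ (mem p) = nmem (not⁻ p)

∁∉⁻ : ∀ {n} {K : VSet n} {i} → i ∉ ∁ K → i ∈ K
∁∉⁻ {K = K} {i} p with split K i
... | inj₁ q = q
... | inj₂ q = ⊥-elim (clash (∁⁺ q) p)

==-≢ : ∀ {n} {u v : Fin n} → u ≢ v → (u == v) ≡ false
==-≢ {u = u} {v} h with u == v in eq
... | false = refl
... | true = ⊥-elim (h (toℕ-injective (≡ᵇ-sound _ _ eq)))

E : Bool → Cls → Cls → Bool
E ab p q = clsE ab p q ∨ clsE ab q p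

opaque
  unfolding #
  #-full : ∀ m → # {m} full ≡ m
  #-full zero = refl
  #-full (suc m) = cong suc (#-full m)

  #-F5 : ∀ (i : Fin 4) → # (F5 (suc i)) ≤ 2
  #-F5 0F = ≤-refl
  #-F5 1F = ≤-refl
  #-F5 2F = ≤-refl
  #-F5 3F = ≤-refl

  #-K2 : ∀ (i : Fin 2) → # (K2 i) ≤ 1
  #-K2 0F = ≤-refl
  #-K2 1F = ≤-refl

#-⊕≤ : ∀ {n} {S : VSet n} {a} → # (S ⊕ a) ≤ suc (# S)
#-⊕≤ {S = S} {a} = ≤-trans (#-cover {S = S ⊕ a} {S} {⁅ a ⁆} (λ i p → ∪⁻ p))
  (≤-reflexive (trans (cong (# S +_) (#-single a)) (+-comm (# S) 1)))

allF : ∀ {n} → (Fin n → Bool) → Bool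
allF {zero} f = true
allF {suc n} f = f zero ∧ allF (f ∘ suc)

allF-sound : ∀ {n} (f : Fin n → Bool) → allF f ≡ true → ∀ i → f i ≡ true
allF-sound f h zero = proj₁ (∧⁻ h)
allF-sound f h (suc i) = allF-sound (f ∘ suc) (proj₂ (∧⁻ {f zero} h)) i

eqᵇ : Bool → Bool → Bool
eqᵇ true b = b
eqᵇ false b = not b

eqᵇ-sound : ∀ a b → eqᵇ a b ≡ true → a ≡ b
eqᵇ-sound true true _ = refl
eqᵇ-sound false false _ = refl

agree : ∀ {n} (H H' : Adj n) → allF (λ i → allF (λ j → eqᵇ (H i j) (H' i j))) ≡ true → ∀ i j → H i j ≡ H' i j
agree H H' h i j = eqᵇ-sound _ _ (allF-sound (λ j → eqᵇ (H i j) (H' i j)) (allF-sound _ h i) j)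

is1 : Cls → Bool
is1 cS1 = true
is1 _ = false

is1⁻ : ∀ {p} → is1 p ≡ true → p ≡ cS1
is1⁻ {cS1} _ = refl

sw : Cls → Cls
sw cS1 = cS2
sw cS2 = cS1
sw p = p

E-sw : ∀ ab p q → E ab (sw p) (sw q) ≡ E ab p q
E-sw ab cS1 cS1 = refl
E-sw ab cS1 cS2 = refl
E-sw ab cS1 cA = refl
E-sw ab cS1 cB = refl
E-sw ab cS1 cC1 = refl
E-sw ab cS1 cC2 = refl
E-sw ab cS2 cS1 = refl
E-sw ab cS2 cS2 = refl
E-sw ab cS2 cA = refl
E-sw ab cS2 cB = refl
E-sw ab cS2 cC1 = refl
E-sw ab cS2 cC2 = refl
E-sw ab cA cS1 = refl
E-sw ab cA cS2 = refl
E-sw ab cA cA = refl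
E-sw ab cA cB = refl
E-sw ab cA cC1 = refl
E-sw ab cA cC2 = refl
E-sw ab cB cS1 = refl
E-sw ab cB cS2 = refl
E-sw ab cB cA = refl
E-sw ab cB cB = refl
E-sw ab cB cC1 = refl
E-sw ab cB cC2 = refl
E-sw ab cC1 cS1 = refl
E-sw ab cC1 cS2 = refl
E-sw ab cC1 cA = refl
E-sw ab cC1 cB = refl
E-sw ab cC1 cC1 = refl
E-sw ab cC1 cC2 = refl
E-sw ab cC2 cS1 = refl
E-sw ab cC2 cS2 = refl
E-sw ab cC2 cA = refl
E-sw ab cC2 cB = refl
E-sw ab cC2 cC1 = refl
E-sw ab cC2 cC2 = refl

-- The members of 𝓕₁₁ and 𝓕₁₂ as two graphs joined at a vertex

κ₆ : Fin 6 → Cls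
κ₆ 0F = cA
κ₆ 1F = cC1
κ₆ 2F = cC2
κ₆ 3F = cS1
κ₆ 4F = cS2
κ₆ 5F = cB

-- H_{2,2}, with the vertices in the order a, c₁, c₂, S₁, S₂, b.
H₆ : Bool → Adj 6
H₆ ab i j = not (i == j) ∧ E ab (κ₆ i) (κ₆ j)

-- pa is the vertex a; pP and pQ number the two sides, F₅ on b₁, c₁, …, c₄ and the side of b₂.
data Pos (m : ℕ) : Set where
  pa : Pos m
  pP : Fin 5 → Pos m
  pQ : Fin m → Pos m

hub : Bool → Fin 5 → Bool
hub l 0F = l
hub l (suc i) = true

hub₆ : Bool → Bool → Fin 6 → Bool
hub₆ l l' 0F = l
hub₆ l l' 5F = l'
hub₆ l l' _ = true

join : ∀ {m} → (Fin 5 → Bool) → (Fin m → Bool) → Adj m → Pos m → Pos m → Bool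
join rP rQ HQ pa pa = false
join rP rQ HQ pa (pP i) = rP i
join rP rQ HQ pa (pQ i) = rQ i
join rP rQ HQ (pP i) pa = rP i
join rP rQ HQ (pP i) (pP j) = F5 i j
join rP rQ HQ (pP i) (pQ j) = false
join rP rQ HQ (pQ i) pa = rQ i
join rP rQ HQ (pQ i) (pP j) = false
join rP rQ HQ (pQ i) (pQ j) = HQ i j

pos₁₁ : Fin 11 → Pos 5
pos₁₁ 0F = pa
pos₁₁ 1F = pP 0F
pos₁₁ 2F = pQ 0F
pos₁₁ 3F = pP 1F
pos₁₁ 4F = pP 2F
pos₁₁ 5F = pP 3F
pos₁₁ 6F = pP 4F
pos₁₁ 7F = pQ 1F
pos₁₁ 8F = pQ 2F
pos₁₁ 9F = pQ 3F
pos₁₁ (suc 9F) = pQ 4F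

idx₁₁ : Pos 5 → Fin 11
idx₁₁ pa = 0F
idx₁₁ (pP 0F) = 1F
idx₁₁ (pP 1F) = 3F
idx₁₁ (pP 2F) = 4F
idx₁₁ (pP 3F) = 5F
idx₁₁ (pP 4F) = 6F
idx₁₁ (pQ 0F) = 2F
idx₁₁ (pQ 1F) = 7F
idx₁₁ (pQ 2F) = 8F
idx₁₁ (pQ 3F) = 9F
idx₁₁ (pQ 4F) = suc 9F

idx-pos₁₁ : ∀ i → idx₁₁ (pos₁₁ i) ≡ i
idx-pos₁₁ 0F = refl
idx-pos₁₁ 1F = refl
idx-pos₁₁ 2F = refl
idx-pos₁₁ 3F = refl
idx-pos₁₁ 4F = refl
idx-pos₁₁ 5F = refl
idx-pos₁₁ 6F = refl
idx-pos₁₁ 7F = refl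
idx-pos₁₁ 8F = refl
idx-pos₁₁ 9F = refl
idx-pos₁₁ (suc 9F) = refl

pos-idx₁₁ : ∀ p → pos₁₁ (idx₁₁ p) ≡ p
pos-idx₁₁ pa = refl
pos-idx₁₁ (pP 0F) = refl
pos-idx₁₁ (pP 1F) = refl
pos-idx₁₁ (pP 2F) = refl
pos-idx₁₁ (pP 3F) = refl
pos-idx₁₁ (pP 4F) = refl
pos-idx₁₁ (pQ 0F) = refl
pos-idx₁₁ (pQ 1F) = refl
pos-idx₁₁ (pQ 2F) = refl
pos-idx₁₁ (pQ 3F) = refl
pos-idx₁₁ (pQ 4F) = refl

pos₁₂ : Fin 12 → Pos 6
pos₁₂ 0F = pa
pos₁₂ 1F = pP 0F
pos₁₂ 2F = pQ 0F
pos₁₂ 3F = pP 1F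
pos₁₂ 4F = pP 2F
pos₁₂ 5F = pP 3F
pos₁₂ 6F = pP 4F
pos₁₂ 7F = pQ 1F
pos₁₂ 8F = pQ 2F
pos₁₂ 9F = pQ 3F
pos₁₂ (suc 9F) = pQ 4F
pos₁₂ (suc (suc 9F)) = pQ 5F

idx₁₂ : Pos 6 → Fin 12
idx₁₂ pa = 0F
idx₁₂ (pP 0F) = 1F
idx₁₂ (pP 1F) = 3F
idx₁₂ (pP 2F) = 4F
idx₁₂ (pP 3F) = 5F
idx₁₂ (pP 4F) = 6F
idx₁₂ (pQ 0F) = 2F
idx₁₂ (pQ 1F) = 7F
idx₁₂ (pQ 2F) = 8F
idx₁₂ (pQ 3F) = 9F
idx₁₂ (pQ 4F) = suc 9F
idx₁₂ (pQ 5F) = suc (suc 9F)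

idx-pos₁₂ : ∀ i → idx₁₂ (pos₁₂ i) ≡ i
idx-pos₁₂ 0F = refl
idx-pos₁₂ 1F = refl
idx-pos₁₂ 2F = refl
idx-pos₁₂ 3F = refl
idx-pos₁₂ 4F = refl
idx-pos₁₂ 5F = refl
idx-pos₁₂ 6F = refl
idx-pos₁₂ 7F = refl
idx-pos₁₂ 8F = refl
idx-pos₁₂ 9F = refl
idx-pos₁₂ (suc 9F) = refl
idx-pos₁₂ (suc (suc 9F)) = refl

pos-idx₁₂ : ∀ p → pos₁₂ (idx₁₂ p) ≡ p
pos-idx₁₂ pa = refl
pos-idx₁₂ (pP 0F) = refl
pos-idx₁₂ (pP 1F) = refl
pos-idx₁₂ (pP 2F) = refl
pos-idx₁₂ (pP 3F) = refl
pos-idx₁₂ (pP 4F) = refl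
pos-idx₁₂ (pQ 0F) = refl
pos-idx₁₂ (pQ 1F) = refl
pos-idx₁₂ (pQ 2F) = refl
pos-idx₁₂ (pQ 3F) = refl
pos-idx₁₂ (pQ 4F) = refl
pos-idx₁₂ (pQ 5F) = refl

-- A finite check by evaluation. Each side is F₅ with centre b₁ or b₂; `a` is adjacent to every
-- other vertex of the side, and to the centre according to the flag.
F11-join : ∀ l₁ l₂ i j → F11 l₁ l₂ i j ≡ join (hub l₁) (hub l₂) F5 (pos₁₁ i) (pos₁₁ j)
F11-join l₁ l₂ = agree (F11 l₁ l₂) (λ i j → join (hub l₁) (hub l₂) F5 (pos₁₁ i) (pos₁₁ j)) (check l₁ l₂)
  where
  check : ∀ l₁ l₂ → allF (λ i → allF (λ j → eqᵇ (F11 l₁ l₂ i j) (join (hub l₁) (hub l₂) F5 (pos₁₁ i) (pos₁₁ j)))) ≡ true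
  check true true = refl
  check true false = refl
  check false true = refl
  check false false = refl

-- On the second side b₂, c₅, c₆, c₇, c₈, c₉ play the roles of a, c₁, c₂, S₁, S₂, b in H_{2,2}. So
-- the flag of b₂c₉ decides between H_{2,2} and H⁻_{2,2}, and the flag of ac₉ belongs to the hub.
F12-join : ∀ l₁ l₂ l₃ l₄ i j → F12 l₁ l₂ l₃ l₄ i j ≡ join (hub l₁) (hub₆ l₂ l₃) (H₆ l₄) (pos₁₂ i) (pos₁₂ j)
F12-join l₁ l₂ l₃ l₄ = agree (F12 l₁ l₂ l₃ l₄) (λ i j → join (hub l₁) (hub₆ l₂ l₃) (H₆ l₄) (pos₁₂ i) (pos₁₂ j)) (check l₁ l₂ l₃ l₄)
  where
  check : ∀ l₁ l₂ l₃ l₄ → allF (λ i → allF (λ j → eqᵇ (F12 l₁ l₂ l₃ l₄ i j) (join (hub l₁) (hub₆ l₂ l₃) (H₆ l₄) (pos₁₂ i) (pos₁₂ j)))) ≡ true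
  check true true true true = refl
  check true true true false = refl
  check true true false true = refl
  check true true false false = refl
  check true false true true = refl
  check true false true false = refl
  check true false false true = refl
  check true false false false = refl
  check false true true true = refl
  check false true true false = refl
  check false true false true = refl
  check false true false false = refl
  check false false true true = refl
  check false false true false = refl
  check false false false true = refl
  check false false false false = refl

-- The sums, minima and numberings of the statement

sum-tabulate : ∀ {n} {A : Set} (f : A → ℕ) (g : Fin n → A) → sum (map f (tabulate g)) ≡ ∑ (f ∘ g)
sum-tabulate {zero} f g = refl
sum-tabulate {suc n} f g = cong (f (g zero) +_) (sum-tabulate f (g ∘ suc))

opaque
  unfolding #
  size-# : ∀ {n} (S : VSet n) → size S ≡ # S
  size-# S = sum-tabulate (λ v → if S v then 1 else 0) id

opaque
  unfolding _∖_ ⁅_⁆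
  ─-unfold : ∀ {n} (S : VSet n) x → (S ─ x) ≐ (λ y → S y ∧ not (y == x))
  ─-unfold S x = id , id

∑-cong : ∀ {n} {f g : Fin n → ℕ} → (∀ i → f i ≡ g i) → ∑ f ≡ ∑ g
∑-cong {zero} h = refl
∑-cong {suc n} h = cong₂ _+_ (h zero) (∑-cong (h ∘ suc))

opaque
  unfolding _∪_ ⁅_⁆

  ∑-single : ∀ {n} (f : Fin n → ℕ) x → ∑ (λ u → if ⁅ x ⁆ u then f u else 0) ≡ f x
  ∑-single {suc n} f zero = trans (cong (f zero +_) (∑-zero n)) (+-identityʳ _)
  ∑-single {suc n} f (suc x) = ∑-single (f ∘ suc) x

  ∑-⊕ : ∀ {n} {S : VSet n} {x} (f : Fin n → ℕ) → x ∉ S →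
        ∑ (λ u → if (S ⊕ x) u then f u else 0) ≡ f x + ∑ (λ u → if S u then f u else 0)
  ∑-⊕ {n} {S} {x} f xS = trans (∑-cong pt) (trans (∑-+ (λ u → if ⁅ x ⁆ u then f u else 0) _) (cong (_+ _) (∑-single f x)))
    where
    pt : ∀ u → (if (S u ∨ ⁅ x ⁆ u) then f u else 0) ≡ (if ⁅ x ⁆ u then f u else 0) + (if S u then f u else 0)
    pt u with S u in p | ⁅ x ⁆ u in q
    ... | false | false = refl
    ... | false | true = sym (+-identityʳ _)
    ... | true | false = refl
    ... | true | true = ⊥-elim (clash (mem p) (subst (_∉ S) (sym (single⁻ (mem q))) xS))

setOf : ∀ {n} → List (Fin n) → VSet n
setOf [] = ∅
setOf (x ∷ J) = setOf J ⊕ x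

setOf⁺ : ∀ {n} {J : List (Fin n)} {i} → i ∈ˡ J → i ∈ setOf J
setOf⁺ {J = x ∷ J} (here refl) = a∈⊕ {S = setOf J}
setOf⁺ (there p) = ∪⁺ˡ (setOf⁺ p)

setOf⁻ : ∀ {n} {J : List (Fin n)} {i} → i ∈ setOf J → i ∈ˡ J
setOf⁻ {J = []} (mem ())
setOf⁻ {J = x ∷ J} p with ⊕⁻ p
... | inj₁ q = there (setOf⁻ q)
... | inj₂ q = here q

∉setOf : ∀ {n} {J : List (Fin n)} {x} → All (x ≢_) J → x ∉ setOf J
∉setOf h = ∉-intro λ p → All.lookup h (setOf⁻ p) refl

#-setOf : ∀ {n} {J : List (Fin n)} → AllPairs _≢_ J → # (setOf J) ≡ length J
#-setOf [] = #-∅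
#-setOf (h ∷ hs) = trans (#-⊕ (∉setOf h)) (cong suc (#-setOf hs))

all⁺ : ∀ {A : Set} (p : A → Bool) xs → (∀ x → p x ≡ true) → all p xs ≡ true
all⁺ p [] h = refl
all⁺ p (x ∷ xs) h = cong₂ _∧_ (h x) (all⁺ p xs h)

any⁺ : ∀ {A : Set} (p : A → Bool) {x xs} → x ∈ˡ xs → p x ≡ true → any p xs ≡ true
any⁺ p {xs = y ∷ xs} (here refl) h = cong (_∨ any p xs) h
any⁺ p {xs = y ∷ xs} (there m) h = trans (cong (p y ∨_) (any⁺ p m h)) (∨⁺ʳ {p y} refl)

δ≤deg : ∀ {n} (G : Adj n) (I : VSet n) {v} → v ∈ I → δ G I ≤ deg G v
δ≤deg {n} G I {v} (mem vI) = go (allFin n) (∈-allFin v)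
  where
  go : ∀ l → v ∈ˡ l → foldr (λ u m → if I u then deg G u ⊓ m else m) n l ≤ deg G v
  go (u ∷ l) (here refl) rewrite vI = m⊓n≤m _ _
  go (u ∷ l) (there p) with I u
  ... | true = ≤-trans (m⊓n≤n (deg G u) _) (go l p)
  ... | false = go l p

allSubsets-complete : ∀ n (S : VSet n) → ∃ λ S' → S' ∈ˡ allSubsets n × (∀ i → S' i ≡ S i)
allSubsets-complete zero S = _ , here refl , λ ()
allSubsets-complete (suc n) S with allSubsets-complete n (S ∘ suc) | S zero in eq
... | S' , m , h | true = _ , ∈-++⁺ˡ (∈-map⁺ _ m) , λ { zero → sym eq ; (suc i) → h i }
... | S' , m , h | false = _ , ∈-++⁺ʳ _ (∈-map⁺ _ m) , λ { zero → sym eq ; (suc i) → h i }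

foldr-⊔ : ∀ {x l} → x ∈ˡ l → x ≤ foldr _⊔_ 0 l
foldr-⊔ (here refl) = m≤m⊔n _ _
foldr-⊔ {l = y ∷ l} (there p) = ≤-trans (foldr-⊔ p) (m≤n⊔m y _)

lookup-inj : ∀ {A : Set} {l : List A} → AllPairs _≢_ l → ∀ i j → lookup l i ≡ lookup l j → i ≡ j
lookup-inj (h ∷ hs) zero zero p = refl
lookup-inj {l = _ ∷ l} (h ∷ hs) zero (suc j) p = ⊥-elim (All.lookup h (∈-lookup {xs = l} j) p)
lookup-inj {l = _ ∷ l} (h ∷ hs) (suc i) zero p = ⊥-elim (All.lookup h (∈-lookup {xs = l} i) (sym p))
lookup-inj (h ∷ hs) (suc i) (suc j) p = cong suc (lookup-inj hs i j p)

lookup-++ : ∀ {A : Set} (P : ℕ → A → Set) (xs ys : List A) → (∀ i → P (toℕ i) (lookup xs i)) →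
            (∀ j → P (length xs + toℕ j) (lookup ys j)) → ∀ i → P (toℕ i) (lookup (xs ++ ys) i)
lookup-++ P [] ys f g i = g i
lookup-++ P (x ∷ xs) ys f g zero = f zero
lookup-++ P (x ∷ xs) ys f g (suc i) = lookup-++ (P ∘ suc) xs ys (f ∘ suc) g i

elems : ∀ {n} → VSet n → List (Fin n)
elems {n} S = filter (λ i → S i ≟ᵇ true) (allFin n)

elems⁺ : ∀ {n} {S : VSet n} {i} → i ∈ S → i ∈ˡ elems S
elems⁺ {S = S} (mem p) = ∈-filter⁺ (λ i → S i ≟ᵇ true) (∈-allFin _) p

elems⁻ : ∀ {n} {S : VSet n} {i} → i ∈ˡ elems S → i ∈ S
elems⁻ {n} {S} p = mem (proj₂ (∈-filter⁻ (λ i → S i ≟ᵇ true) {xs = allFin n} p))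

elems-unique : ∀ {n} (S : VSet n) → AllPairs _≢_ (elems S)
elems-unique {n} S = Uniqueₚ.filter⁺ (λ i → S i ≟ᵇ true) (Uniqueₚ.allFin⁺ n)

length-elems : ∀ {n} (S : VSet n) → length (elems S) ≡ # S
length-elems S = ≤-antisym (#-list≥ (elems-unique S) (All.tabulate elems⁻)) (#-list≤ (elems S) (λ i → elems⁺))

-- With s = k + 1 and t = l + 1 the truncated differences in `cls` become k, k + l and k + l + 1.
module ClsPositions (k l : ℕ) where
  private
    s t : ℕ
    s = suc k
    t = suc l
    e₂ : s + t ∸ 2 ≡ k + l
    e₂ = cong (_∸ 1) (+-suc k l)
    e₁ : s + t ∸ 1 ≡ suc (k + l)
    e₁ = +-suc k l
  ≤ᵇ-true : ∀ {m p} → m ≤ p → (m ≤ᵇ p) ≡ true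
  ≤ᵇ-true {m} {p} h with m ≤ᵇ p in eq
  ... | true = refl
  ... | false = ⊥-elim (subst T eq (≤⇒≤ᵇ h))

  ≤ᵇ-false : ∀ {m p} → p < m → (m ≤ᵇ p) ≡ false
  ≤ᵇ-false {m} {p} h with m ≤ᵇ p in eq
  ... | false = refl
  ... | true = ⊥-elim (<⇒≱ h (≤ᵇ⇒≤ m p (≡⇒T eq)))

  ≡ᵇ-false : ∀ {m p} → m ≢ p → (m ≡ᵇ p) ≡ false
  ≡ᵇ-false {m} {p} h with m ≡ᵇ p in eq
  ... | false = refl
  ... | true = ⊥-elim (h (≡ᵇ-sound m p eq))

  cls-S1 : ∀ {i} → i < k → cls s t i ≡ cS1
  cls-S1 {i} h rewrite ≤ᵇ-true {i + 1} {k} (subst (_≤ k) (+-comm 1 i) h) = refl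

  cls-S2 : ∀ {i} → k ≤ i → i < k + l → cls s t i ≡ cS2
  cls-S2 {i} h h' rewrite ≤ᵇ-false {i + 1} {k} (subst (k <_) (+-comm 1 i) (s≤s h)) | e₂
    | ≤ᵇ-true {i + 1} {k + l} (subst (_≤ k + l) (+-comm 1 i) h') = refl

  cls-A : cls s t (k + l) ≡ cA
  cls-A rewrite ≤ᵇ-false {k + l + 1} {k} (subst (k <_) (+-comm 1 (k + l)) (s≤s (m≤m+n k l))) | e₂
    | ≤ᵇ-false {k + l + 1} {k + l} (subst (k + l <_) (+-comm 1 (k + l)) ≤-refl) | ≡ᵇ-refl (k + l) = refl

  private
    far : ∀ {i} → k + l < i → (i + 1 ≤ᵇ k) ≡ false × (i + 1 ≤ᵇ k + l) ≡ false × (i ≡ᵇ k + l) ≡ false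
    far {i} h = ≤ᵇ-false {i + 1} {k} (≤-trans (s≤s (m≤m+n k l)) (≤-trans h (m≤m+n i 1)))
      , ≤ᵇ-false {i + 1} {k + l} (≤-trans h (m≤m+n i 1)) , ≡ᵇ-false (λ e → <⇒≢ h (sym e))

  cls-B : cls s t (suc (k + l)) ≡ cB
  cls-B with far {suc (k + l)} ≤-refl
  ... | p , q , r rewrite p | e₂ | q | r | e₁ | ≡ᵇ-refl (k + l) = refl

  cls-C1 : cls s t (suc (suc (k + l))) ≡ cC1
  cls-C1 with far {suc (suc (k + l))} (m≤n⇒m≤1+n ≤-refl)
  ... | p , q , r rewrite p | e₂ | q | r | e₁ | ≡ᵇ-false {suc (k + l)} {k + l} (λ e → <⇒≢ (n<1+n (k + l)) (sym e)) | ≡ᵇ-refl (k + l) = refl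

  cls-C2 : cls s t (suc (suc (suc (k + l)))) ≡ cC2
  cls-C2 with far {suc (suc (suc (k + l)))} (m≤n⇒m≤1+n (m≤n⇒m≤1+n ≤-refl))
  ... | p , q , r rewrite p | e₂ | q | r | e₁
    | ≡ᵇ-false {suc (suc (k + l))} {k + l} (λ e → <⇒≢ {k + l} (m≤n⇒m≤1+n ≤-refl) (sym e))
    | ≡ᵇ-false {suc (k + l)} {k + l} (λ e → <⇒≢ (n<1+n (k + l)) (sym e)) = refl

-- Connectivity

module Graph {n : ℕ} (G : Adj n) (gsym : ∀ u v → G u v ≡ G v u) (girr : ∀ u → G u u ≡ false) where

  ~sym : ∀ {x y} → y ∈ G x → x ∈ G y
  ~sym {x} {y} (mem p) = mem (trans (gsym y x) p)

  ≁sym : ∀ {x y} → y ∉ G x → x ∉ G y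
  ≁sym {x} {y} (nmem p) = nmem (trans (gsym y x) p)

  ≁irr : ∀ {x} → x ∉ G x
  ≁irr {x} = nmem (girr x)

  ~⇒≢ : ∀ {x y} → y ∈ G x → x ≢ y
  ~⇒≢ p refl = clash p ≁irr

  -- K may stick out of T; only its trace on T matters. Working with the absence of separations
  -- instead of paths makes connectivity a matter of propagating membership in K, and makes the
  -- empty set connected.
  record Split (T K : VSet n) : Set where
    field
      {u v} : Fin n
      uT : u ∈ T
      uK : u ∈ K
      vT : v ∈ T
      vK : v ∉ K
      cross : ∀ {p q} → p ∈ T → p ∈ K → q ∈ T → q ∉ K → q ∉ G p

  open Split

  Conn : VSet n → Set
  Conn T = ∀ {K} → Split T K → ⊥

  -- No cut vertex, but an edge or a single vertex is allowed; the bound of three vertices is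
  -- imposed separately on the parts.
  record NS (S : VSet n) : Set where
    field
      conn : Conn S
      conn─ : ∀ {y} → y ∈ S → Conn (S ─ y)

  open NS public

  split-resp : ∀ {S T K} → S ≐ T → Split S K → Split T K
  split-resp (f , g) s = record { uT = f (uT s) ; uK = uK s ; vT = f (vT s) ; vK = vK s
    ; cross = λ a b c d → cross s (g a) b (g c) d }

  conn-resp : ∀ {S T} → S ≐ T → Conn S → Conn T
  conn-resp (f , g) c s = c (split-resp (g , f) s)

  ─-resp : ∀ {S T : VSet n} {y} → S ≐ T → S ─ y ≐ T ─ y
  ─-resp (f , g) = (λ p → ─⁺ (f (proj₁ (─⁻ p))) (proj₂ (─⁻ p))) , (λ p → ─⁺ (g (proj₁ (─⁻ p))) (proj₂ (─⁻ p)))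

  ns-resp : ∀ {S T} → S ≐ T → NS S → NS T
  ns-resp {S} e@(f , g) s = record { conn = conn-resp e (conn s)
    ; conn─ = λ p → conn-resp (─-resp {S} e) (conn─ s (g p)) }

  split-∁ : ∀ {T K} → Split T K → Split T (∁ K)
  split-∁ s = record { uT = vT s ; uK = ∁⁺ (vK s) ; vT = uT s ; vK = ∁∉ (uK s)
    ; cross = λ a b c d → ≁sym (cross s c (∁∉⁻ d) a (∁⁻ b)) }

  -- Passing to the complement of K if necessary puts a chosen vertex outside K, which removes a
  -- symmetric case from later arguments.
  split-avoid : ∀ {T K} t → Split T K → ∃ λ K' → Split T K' × t ∉ K'
  split-avoid {K = K} t s with split K t
  ... | inj₁ p = _ , split-∁ s , ∁∉ p
  ... | inj₂ p = _ , s , p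

  spread : ∀ {S K} → Conn S → (∀ {p q} → p ∈ S → p ∈ K → q ∈ S → q ∉ K → q ∉ G p) →
           ∀ {p q} → p ∈ S → p ∈ K → q ∈ S → q ∈ K
  spread {S} {K} c h {p} {q} pS pK qS with split K q
  ... | inj₁ r = r
  ... | inj₂ r = ⊥-elim (c record { uT = pS ; uK = pK ; vT = qS ; vK = r ; cross = h })

  conn-∪ : ∀ {S T s t} → Conn S → Conn T → s ∈ S → t ∈ T → t ∈ G s → Conn (S ∪ T)
  conn-∪ {S} {T} {s} {t} cS cT sS tT st sp₀ with split-avoid s sp₀
  ... | K , sp , sK = c∈
    where
    sub : ∀ {R} → R ⊆ S ∪ T → ∀ {p q} → p ∈ R → p ∈ ∁ K → q ∈ R → q ∉ ∁ K → q ∉ G p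
    sub h a b c d = cross (split-∁ sp) (h a) b (h c) d
    allS : ∀ {q} → q ∈ S → q ∈ ∁ K
    allS = spread cS (sub ∪⁺ˡ) sS (∁⁺ sK)
    tK : t ∈ ∁ K
    tK with split (∁ K) t
    ... | inj₁ r = r
    ... | inj₂ r = ⊥-elim (clash st (cross (split-∁ sp) (∪⁺ˡ sS) (∁⁺ sK) (∪⁺ʳ {S = S} tT) r))
    allT : ∀ {q} → q ∈ T → q ∈ ∁ K
    allT = spread cT (sub (∪⁺ʳ {S = S})) tT tK
    c∈ : ⊥
    c∈ with ∪⁻ (uT sp)
    ... | inj₁ a = clash (uK sp) (∁⁻ (allS a))
    ... | inj₂ a = clash (uK sp) (∁⁻ (allT a))

  -- Two disjoint edges between nonseparable sets: deleting one vertex leaves one of the edges.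
  glue : ∀ {S T s₁ s₂ t₁ t₂} → NS S → NS T → s₁ ∈ S → s₂ ∈ S → t₁ ∈ T → t₂ ∈ T →
         t₁ ∈ G s₁ → t₂ ∈ G s₂ → s₁ ≢ s₂ → t₁ ≢ t₂ → s₁ ≢ t₂ → s₂ ≢ t₁ → NS (S ∪ T)
  glue {S} {T} {s₁} {s₂} {t₁} {t₂} nS nT s₁S s₂S t₁T t₂T e₁ e₂ ds dt d₁₂ d₂₁ = record
    { conn = conn-∪ (conn nS) (conn nT) s₁S t₁T e₁
    ; conn─ = λ {y} _ → conn-resp (dist y) (main y) }
    where
    dist : ∀ y → (S ─ y) ∪ (T ─ y) ≐ (S ∪ T) ─ y
    dist y = (λ p → [ (λ q → ─⁺ (∪⁺ˡ (proj₁ (─⁻ q))) (proj₂ (─⁻ q))) , (λ q → ─⁺ (∪⁺ʳ {S = S} (proj₁ (─⁻ q))) (proj₂ (─⁻ q))) ]′ (∪⁻ p))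
           , (λ p → [ (λ q → ∪⁺ˡ (─⁺ q (proj₂ (─⁻ p)))) , (λ q → ∪⁺ʳ {S = S ─ y} (─⁺ q (proj₂ (─⁻ p)))) ]′ (∪⁻ (proj₁ (─⁻ p))))
    part : ∀ {R} → NS R → ∀ y → Conn (R ─ y)
    part {R} nR y with split R y
    ... | inj₁ q = conn─ nR q
    ... | inj₂ q = conn-resp ((λ {i} r → ─⁺ r (λ { refl → clash r q })) , (λ r → proj₁ (─⁻ r))) (conn nR)
    main : ∀ y → Conn ((S ─ y) ∪ (T ─ y))
    main y with ≟⊎ s₁ y | ≟⊎ t₁ y
    ... | inj₁ refl | _ = conn-∪ (part nS y) (part nT y) (─⁺ s₂S (ds ∘ sym)) (─⁺ t₂T (d₁₂ ∘ sym)) e₂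
    ... | inj₂ _ | inj₁ refl = conn-∪ (part nS y) (part nT y) (─⁺ s₂S d₂₁) (─⁺ t₂T (dt ∘ sym)) e₂
    ... | inj₂ p | inj₂ q = conn-∪ (part nS y) (part nT y) (─⁺ s₁S p) (─⁺ t₁T q) e₁

  clique : ∀ {S} → (∀ {p q} → p ∈ S → q ∈ S → p ≢ q → q ∈ G p) → NS S
  clique {S} h = record { conn = c ; conn─ = λ _ sp → c' sp }
    where
    c : Conn S
    c sp = clash (h (uT sp) (vT sp) (λ e → clash (subst (_∈ _) e (uK sp)) (vK sp))) (cross sp (uT sp) (uK sp) (vT sp) (vK sp))
    c' : ∀ {y} → Conn (S ─ y)
    c' sp = clash (h (proj₁ (─⁻ (uT sp))) (proj₁ (─⁻ (vT sp))) (λ e → clash (subst (_∈ _) e (uK sp)) (vK sp)))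
      (cross sp (uT sp) (uK sp) (vT sp) (vK sp))

  Tri : (a b c : Fin n) → VSet n
  Tri a b c = ⁅ a ⁆ ⊕ b ⊕ c

  tri⁻ : ∀ {a b c i} → i ∈ Tri a b c → i ≡ a ⊎ i ≡ b ⊎ i ≡ c
  tri⁻ p with ⊕⁻ p
  ... | inj₂ q = inj₂ (inj₂ q)
  ... | inj₁ q with ⊕⁻ q
  ...   | inj₂ r = inj₂ (inj₁ r)
  ...   | inj₁ r = inj₁ (single⁻ r)

  tri₁ : ∀ {a b c} → a ∈ Tri a b c
  tri₁ {a} = ∪⁺ˡ (∪⁺ˡ (single⁺ a))
  tri₂ : ∀ {a b c} → b ∈ Tri a b c
  tri₂ {a} = ∪⁺ˡ (a∈⊕ {S = ⁅ a ⁆})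
  tri₃ : ∀ {a b c} → c ∈ Tri a b c
  tri₃ {a} {b} = a∈⊕ {S = ⁅ a ⁆ ⊕ b}

  triangle : ∀ {a b c} → b ∈ G a → c ∈ G a → c ∈ G b → NS (Tri a b c)
  triangle {a} {b} {c} ab ac bc = clique h
    where
    h : ∀ {p q} → p ∈ Tri a b c → q ∈ Tri a b c → p ≢ q → q ∈ G p
    h pT qT ne with tri⁻ pT | tri⁻ qT
    ... | inj₁ refl | inj₁ refl = ⊥-elim (ne refl)
    ... | inj₁ refl | inj₂ (inj₁ refl) = ab
    ... | inj₁ refl | inj₂ (inj₂ refl) = ac
    ... | inj₂ (inj₁ refl) | inj₁ refl = ~sym ab
    ... | inj₂ (inj₁ refl) | inj₂ (inj₁ refl) = ⊥-elim (ne refl)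
    ... | inj₂ (inj₁ refl) | inj₂ (inj₂ refl) = bc
    ... | inj₂ (inj₂ refl) | inj₁ refl = ~sym ac
    ... | inj₂ (inj₂ refl) | inj₂ (inj₁ refl) = ~sym bc
    ... | inj₂ (inj₂ refl) | inj₂ (inj₂ refl) = ⊥-elim (ne refl)

  tri-size : ∀ {a b c} → a ≢ b → a ≢ c → b ≢ c → # (Tri a b c) ≡ 3
  tri-size {a} {b} {c} ab ac bc = trans (#-⊕ {S = ⁅ a ⁆ ⊕ b} (⊕∉ (single∉ (ac ∘ sym)) (bc ∘ sym)))
    (cong suc (trans (#-⊕ {S = ⁅ a ⁆} (single∉ (ab ∘ sym))) (cong suc (#-single a))))

  record Closure (T : VSet n) (u : Fin n) : Set where
    field
      K : VSet n
      base : u ∈ K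
      sub : K ⊆ T
      reach : ∀ {v} → v ∈ K → Reach G T u v
      closed : ∀ {p q} → p ∈ K → q ∈ T → q ∉ K → q ∉ G p

  -- The set grows by one adjacent vertex of T at a time; `m` bounds the number of vertices still
  -- missing from T, so the growth must stop.
  closure : ∀ {T u} → u ∈ T → Closure T u
  closure {T} {u} uT₀ = grow (# T) ⁅ u ⁆ (m≤n+m _ _) (single⁺ u) (λ p → subst (_∈ T) (sym (single⁻ p)) uT₀)
      (λ p → subst (Reach G T u) (sym (single⁻ p)) Defs.here)
    where
    grow : ∀ m K → # T ≤ # K + m → u ∈ K → K ⊆ T → (∀ {v} → v ∈ K → Reach G T u v) → Closure T u
    grow m K bound uK KT r with ∀⊎∃ {P = λ q → ∀ p → p ∈ K → q ∈ T → q ∉ K → q ∉ G p}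
        {Q = λ q → ∃ λ p → p ∈ K × q ∈ T × q ∉ K × q ∈ G p} test
      where
      test : ∀ q → (∀ p → p ∈ K → q ∈ T → q ∉ K → q ∉ G p) ⊎ (∃ λ p → p ∈ K × q ∈ T × q ∉ K × q ∈ G p)
      test q with split T q | split K q
      ... | inj₂ a | _ = inj₁ λ p _ b → ⊥-elim (clash b a)
      ... | inj₁ a | inj₁ b = inj₁ λ p _ _ c → ⊥-elim (clash b c)
      ... | inj₁ a | inj₂ b with search (K ∩ G q)
      ...   | inj₁ (p , c) = inj₂ (p , proj₁ (∩⁻ c) , a , b , ~sym (proj₂ (∩⁻ c)))
      ...   | inj₂ c = inj₁ λ p pK _ _ → ∉-intro λ e → clash (∩⁺ pK (~sym e)) (c p)
    ... | inj₁ none = record { K = K ; base = uK ; sub = KT ; reach = r ; closed = λ a b c → none _ _ a b c }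
    grow zero K bound uK KT r | inj₂ (q , p , pK , qT , qK , e) =
      ⊥-elim (<-irrefl refl (≤-trans (#-strict (λ _ → KT) qT qK) (subst (# T ≤_) (+-identityʳ (# K)) bound)))
    grow (suc m) K bound uK KT r | inj₂ (q , p , pK , qT , qK , e) =
      grow m (K ⊕ q) (subst (# T ≤_) (trans (+-suc (# K) m) (cong (_+ m) (sym (#-⊕ {S = K} qK)))) bound) (∪⁺ˡ uK)
        (λ i → [ KT , (λ { refl → qT }) ]′ (⊕⁻ i))
        (λ i → [ r , (λ { refl → Defs.step (r pK) (isTrue e) (isTrue qT) }) ]′ (⊕⁻ i))

  open Closure

  reach-inside : ∀ {T K u v} → (∀ {p q} → p ∈ T → p ∈ K → q ∈ T → q ∉ K → q ∉ G p) →
                 u ∈ T → u ∈ K → Reach G T u v → v ∈ T × v ∈ K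
  reach-inside h a b Defs.here = a , b
  reach-inside {K = K} h a b (Defs.step {x = x} r e t) with reach-inside h a b r | split K x
  ... | c , d | inj₁ p = mem t , p
  ... | c , d | inj₂ p = ⊥-elim (clash (mem e) (h c d (mem t) p))

  -- The component of an arbitrary vertex decides: it is either all of T or one side of a
  -- separation.
  decConn : ∀ T → Conn T ⊎ ∃ λ K → Split T K
  decConn T with search T
  ... | inj₂ none = inj₁ λ s → clash (uT s) (none _)
  ... | inj₁ (u₀ , uT₀) with closure uT₀
  ...   | c with search (T ∖ K c)
  ...     | inj₁ (w , wT) = inj₂ (K c , record { uT = uT₀ ; uK = base c ; vT = proj₁ (∖⁻ wT) ; vK = proj₂ (∖⁻ wT)
              ; cross = λ _ b d e → closed c b d e })
  ...     | inj₂ none = inj₁ conn′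
    where
    T⊆K : T ⊆ K c
    T⊆K p = ∖∉⁻ (none _) p
    conn′ : Conn T
    conn′ sp₀ with split-avoid u₀ sp₀
    ... | K' , sp , u∉ = clash (proj₂ (reach-inside (cross (split-∁ sp)) uT₀ (∁⁺ u∉) (reach c (T⊆K (uT sp))))) (∁∉ (uK sp))

  decNS : ∀ {S} → Conn S → NS S ⊎ ∃ λ y → y ∈ S × ∃ λ K → Split (S ─ y) K
  decNS {S} c with ∀⊎∃ {P = λ y → y ∈ S → Conn (S ─ y)} {Q = λ y → y ∈ S × ∃ λ K → Split (S ─ y) K} test
    where
    test : ∀ y → (y ∈ S → Conn (S ─ y)) ⊎ (y ∈ S × ∃ λ K → Split (S ─ y) K)
    test y with split S y | decConn (S ─ y)
    ... | inj₂ p | _ = inj₁ λ q → ⊥-elim (clash q p)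
    ... | inj₁ p | inj₁ q = inj₁ λ _ → q
    ... | inj₁ p | inj₂ q = inj₂ (p , q)
  ... | inj₁ h = inj₁ record { conn = c ; conn─ = h _ }
  ... | inj₂ h = inj₂ h

  conn⇒connected : ∀ {T} → Conn T → Connected G T
  conn⇒connected {T} c u v uT₀ vT₀ with closure (mem {S = T} uT₀)
  ... | d with split (K d) v
  ...   | inj₁ p = reach d p
  ...   | inj₂ p = ⊥-elim (c record { uT = mem uT₀ ; uK = base d ; vT = mem vT₀ ; vK = p
            ; cross = λ _ b e f → closed d b e f })

-- Light sets and lobes

module Partitions {n : ℕ} (G : Adj n) (gsym : ∀ u v → G u v ≡ G v u) (girr : ∀ u → G u u ≡ false) where
  open Graph G gsym girr

  d : VSet n → Fin n → ℕ
  d U x = # (U ∩ G x)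

  w : VSet n → List (Fin n) → ℕ
  w U [] = 0
  w U (x ∷ J) = d U x + w U J

  Apart : Fin n → Fin n → Set
  Apart u v = u ≢ v × v ∉ G u

  Indep : List (Fin n) → Set
  Indep = AllPairs Apart

  -- A collects the vertices p of U to which a set with a representative of its own has been attached:
  -- such a p may be moved to that set, is never a representative, and its degree in U says nothing.
  Hyp : VSet n → VSet n → Set
  Hyp U A = ∀ {J} → Indep J → All (_∈ U ∖ A) J → w U J < # U → ∀ {v} → v ∈ˡ J → length J + # A ≤ d U v

  -- X holds the vertices moved to sets removed earlier. J is linked to the parts by `len`: it
  -- witnesses that their number is at most α*. The alternative `J ≡ []` covers an empty U, where
  -- the weight 0 is not below the order.
  record Good (U A : VSet n) : Set where
    field
      X : VSet n
      X⊆A : X ⊆ A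
      Ps : List (VSet n)
      okP : All (λ P → NS P × 3 ≤ # P) Ps
      subP : All (λ P → P ⊆ U ∖ X) Ps
      disj : AllPairs (λ P Q → ∀ {i} → i ∈ P → i ∉ Q) Ps
      cover : ∀ {i} → i ∈ U → i ∉ X → Any (i ∈_) Ps
      J : List (Fin n)
      indep : Indep J
      inJ : All (_∈ U ∖ A) J
      len : length J ≡ length Ps
      light : w U J < # U ⊎ J ≡ []

  -- D is a nonempty union of components of U - a, and `o` witnesses that another component is left.
  record Lobe (U : VSet n) (a : Fin n) (D : VSet n) : Set where
    field
      D⊆U : D ⊆ U
      a∈U : a ∈ U
      a∉D : a ∉ D
      {x₀} : Fin n
      x₀∈D : x₀ ∈ D
      {o} : Fin n
      o∈U : o ∈ U
      o∉D : o ∉ D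
      o≢a : o ≢ a
      sep : ∀ {p q} → p ∈ D → q ∈ U → q ∉ D → q ≢ a → q ∉ G p

  d< : ∀ {U v} → v ∈ U → d U v < # U
  d< {U} {v} p = #-strict {S = U ∩ G v} (λ _ q → proj₁ (∩⁻ q)) p (∉-intro (λ q → clash (proj₂ (∩⁻ q)) ≁irr))

  w-take : ∀ {U} k J → w U (take k J) ≤ w U J
  w-take zero J = z≤n
  w-take (suc k) [] = z≤n
  w-take {U} (suc k) (x ∷ J) = +-monoʳ-≤ (d U x) (w-take k J)

  module LobeFacts {U : VSet n} {a : Fin n} {D : VSet n} (L : Lobe U a D) where
    open Lobe L public

    B F F' : VSet n
    B = D ⊕ a
    F = U ∖ D
    F' = U ∖ B

    B⊆U : B ⊆ U
    B⊆U p = [ D⊆U , (λ { refl → a∈U }) ]′ (⊕⁻ p)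

    #B : # B ≡ suc (# D)
    #B = #-⊕ a∉D

    #U-B : # U ≡ suc (# D) + # F'
    #U-B = trans (#-∖ {S = U} {B} (λ _ → B⊆U)) (cong (_+ # F') #B)

    #U-D : # U ≡ # D + # F
    #U-D = #-∖ {S = U} {D} (λ _ → D⊆U)

    F'⁻ : ∀ {i} → i ∈ F' → i ∈ U × i ∉ D × i ≢ a
    F'⁻ p = proj₁ (∖⁻ p) , ⊕∉⁻ (proj₂ (∖⁻ p))

    F'⁺ : ∀ {i} → i ∈ U → i ∉ D → i ≢ a → i ∈ F'
    F'⁺ p q r = ∖⁺ p (⊕∉ q r)

    nbrsD : ∀ {x} → x ∈ D → ∀ i → i ∈ U ∩ G x → i ∈ (D ─ x) ⊕ a
    nbrsD {x} xD i p with ≟⊎ i a | split D i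
    ... | inj₁ refl | _ = a∈⊕ {S = D ─ x}
    ... | inj₂ _ | inj₁ q = ∪⁺ˡ (─⁺ q (λ { refl → clash (proj₂ (∩⁻ p)) ≁irr }))
    ... | inj₂ r | inj₂ q = ⊥-elim (clash (proj₂ (∩⁻ p)) (sep xD (proj₁ (∩⁻ p)) q r))

    #D─x⊕a : ∀ {x} → x ∈ D → # ((D ─ x) ⊕ a) ≡ # D
    #D─x⊕a xD = trans (#-⊕ (∖∉ˡ a∉D)) (sym (#-─ xD))

    dD : ∀ {x} → x ∈ D → d U x ≤ # D
    dD xD = ≤-trans (#-⊆ (nbrsD xD)) (≤-reflexive (#D─x⊕a xD))

    -- Only the |D| vertices of (D ─ x) ⊕ a can be neighbours of x, so degree |D| leaves none of
    -- them out.
    dD-full : ∀ {x q} → x ∈ D → # D ≤ d U x → q ∈ (D ─ x) ⊕ a → q ∈ G x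
    dD-full {x} {q} xD full qW with split (G x) q
    ... | inj₁ r = r
    ... | inj₂ r = ⊥-elim (<-irrefl refl (≤-trans (≤-trans (#-strict (nbrsD xD) qW (∉-intro λ p → clash (proj₂ (∩⁻ p)) r))
            (≤-reflexive (#D─x⊕a xD))) full))

    dF : ∀ {v} → v ∈ F → v ≢ a → d U v ≤ d F v
    dF {v} vF va = #-⊆ λ i p → ∩⁺ (∖⁺ (proj₁ (∩⁻ p)) (∉-intro λ q →
      clash (~sym (proj₂ (∩⁻ p))) (sep q (proj₁ (∖⁻ vF)) (proj₂ (∖⁻ vF)) va))) (proj₂ (∩⁻ p))

    dF+ : ∀ {v} → d U v ≤ d F v + # D
    dF+ {v} = #-cover λ i p → [ inj₂ , (λ q → inj₁ (∩⁺ (∖⁺ (proj₁ (∩⁻ p)) q) (proj₂ (∩⁻ p)))) ]′ (split D i)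

    dF' : ∀ {v} → v ∈ F' → d U v ≤ suc (d F' v)
    dF' {v} vF = ≤-trans (#-cover {S = U ∩ G v} {F' ∩ G v} {⁅ a ⁆} sub)
        (≤-reflexive (trans (cong (d F' v +_) (#-single a)) (+-comm (d F' v) 1)))
      where
      sub : ∀ i → i ∈ U ∩ G v → i ∈ F' ∩ G v ⊎ i ∈ ⁅ a ⁆
      sub i p with ≟⊎ i a | split D i | F'⁻ vF
      ... | inj₁ refl | _ | _ = inj₂ (single⁺ a)
      ... | inj₂ q | inj₂ r | _ = inj₁ (∩⁺ (F'⁺ (proj₁ (∩⁻ p)) r q) (proj₂ (∩⁻ p)))
      ... | inj₂ _ | inj₁ r | (vU , vD , va) = ⊥-elim (clash (~sym (proj₂ (∩⁻ p))) (sep r vU vD va))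

    dF'# : ∀ {v} → v ∈ F' → d U v ≤ # F'
    dF'# p = ≤-trans (dF' p) (d< p)

    apart : ∀ {x v} → x ∈ D → v ∈ U → v ∉ D → v ≢ a → Apart x v
    apart xD vU vD va = (λ { refl → clash xD vD }) , sep xD vU vD va

    apart' : ∀ {x v} → x ∈ D → v ∈ F' → Apart x v
    apart' xD p with F'⁻ p
    ... | b , c , e = apart xD b c e

    -- Of the vertices outside D only `a` has neighbours in D, and it occurs at most once in J; so D
    -- adds at most |D| to the whole weight.
    wF : ∀ {J} → Indep J → All (_∈ F) J → w U J ≤ w F J + # D
    wF≢ : ∀ {J} → All (λ v → v ∈ F × v ≢ a) J → w U J ≤ w F J

    wF≢ [] = z≤n
    wF≢ ((p , q) ∷ ps) = dF p q ⊞ wF≢ ps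

    wF [] [] = z≤n
    wF {v ∷ J} (i ∷ is) (p ∷ ps) with ≟⊎ v a
    ... | inj₁ refl = add-at-hub {b = d F v} (dF+ {v}) (wF≢ (All.zipWith (λ { (r , s) → s , (proj₁ r ∘ sym) }) (i , ps)))
    ... | inj₂ q = add-off-hub {b = d F v} (dF p q) (wF is ps)

    wF' : ∀ {J} → All (_∈ F') J → w U J ≤ w F' J + length J
    wF' [] = z≤n
    wF' {v ∷ J} (p ∷ ps) = add-one-each {d U v} {d F' v} (dF' p) (wF' ps)

    dD+ : ∀ {v} → v ∈ D → d U v ≤ suc (d D v)
    dD+ {v} vD = ≤-trans (#-cover {S = U ∩ G v} {D ∩ G v} {⁅ a ⁆} sub)
        (≤-reflexive (trans (cong (d D v +_) (#-single a)) (+-comm (d D v) 1)))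
      where
      sub : ∀ i → i ∈ U ∩ G v → i ∈ D ∩ G v ⊎ i ∈ ⁅ a ⁆
      sub i p with ≟⊎ i a | split D i
      ... | inj₁ refl | _ = inj₂ (single⁺ a)
      ... | inj₂ q | inj₁ r = inj₁ (∩⁺ r (proj₂ (∩⁻ p)))
      ... | inj₂ q | inj₂ r = ⊥-elim (clash (proj₂ (∩⁻ p)) (sep vD (proj₁ (∩⁻ p)) r q))

    dD≁ : ∀ {v} → v ∈ D → v ∉ G a → d U v ≤ d D v
    dD≁ {v} vD va = #-⊆ sub
      where
      sub : ∀ i → i ∈ U ∩ G v → i ∈ D ∩ G v
      sub i p with ≟⊎ i a | split D i
      ... | inj₁ refl | _ = ⊥-elim (clash (~sym (proj₂ (∩⁻ p))) va)
      ... | inj₂ q | inj₁ r = ∩⁺ r (proj₂ (∩⁻ p))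
      ... | inj₂ q | inj₂ r = ⊥-elim (clash (proj₂ (∩⁻ p)) (sep vD (proj₁ (∩⁻ p)) r q))

    dF'≁ : ∀ {v} → v ∈ F' → v ∉ G a → d U v ≤ d F' v
    dF'≁ {v} vF va = #-⊆ sub
      where
      sub : ∀ i → i ∈ U ∩ G v → i ∈ F' ∩ G v
      sub i p with ≟⊎ i a | split D i | F'⁻ vF
      ... | inj₁ refl | _ | _ = ⊥-elim (clash (~sym (proj₂ (∩⁻ p))) va)
      ... | inj₂ q | inj₂ r | _ = ∩⁺ (F'⁺ (proj₁ (∩⁻ p)) r q) (proj₂ (∩⁻ p))
      ... | inj₂ _ | inj₁ r | (vU , vD , vA) = ⊥-elim (clash (~sym (proj₂ (∩⁻ p))) (sep r vU vD vA))

    -- Both sides of `a` are lobes; this allows F' ⊕ a to be removed as a part instead of D ⊕ a.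
    mirror : Lobe U a F'
    mirror = record { D⊆U = λ p → proj₁ (F'⁻ p) ; a∈U = a∈U ; a∉D = ∉-intro λ p → proj₂ (proj₂ (F'⁻ p)) refl
      ; x₀∈D = F'⁺ o∈U o∉D o≢a ; o∈U = D⊆U x₀∈D ; o∉D = ∉-intro λ p → clash x₀∈D (proj₁ (proj₂ (F'⁻ p)))
      ; o≢a = λ { refl → clash x₀∈D a∉D } ; sep = sep' }
      where
      sep' : ∀ {p q} → p ∈ F' → q ∈ U → q ∉ F' → q ≢ a → q ∉ G p
      sep' {p} {q} pF qU qF qa with split D q
      ... | inj₁ r = ≁sym (sep r (proj₁ (F'⁻ pF)) (proj₁ (proj₂ (F'⁻ pF))) (proj₂ (proj₂ (F'⁻ pF))))
      ... | inj₂ r = ⊥-elim (clash (F'⁺ qU r qa) qF)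

    shrink-A : ∀ {R A i} → i ∈ (U ∖ R) ∖ (A ∖ R) → i ∈ U ∖ A
    shrink-A p = ∖⁺ (proj₁ (∖⁻ (proj₁ (∖⁻ p)))) (∉-intro λ q → clash (∖⁺ q (proj₂ (∖⁻ (proj₁ (∖⁻ p))))) (proj₂ (∖⁻ p)))

    -- With some v of F' outside A the pair x, v is light. Otherwise `o` lies in A but not in D, and
    -- this extra element of A makes up for the missing second vertex.
    low : ∀ {A x} → Hyp U A → x ∈ D → x ∉ A → 2 + # (A ∩ D) ≤ d U x
    low {A} {x} hyp xD xA with search (F' ∖ A)
    ... | inj₁ (v , p) = ≤-trans (s≤s (s≤s (#-⊆ {S = A ∩ D} λ i q → proj₁ (∩⁻ q))))
          (hyp {x ∷ v ∷ []} ((apart' xD vF ∷ []) ∷ [] ∷ [])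
            (∖⁺ (D⊆U xD) xA ∷ ∖⁺ (proj₁ (∖⁻ vF)) (proj₂ (∖⁻ p)) ∷ [])
            (pair-light {d U x} (dD xD) (dF'# vF) #U-B) (here refl))
      where vF = proj₁ (∖⁻ p)
    ... | inj₂ none = ≤-trans (s≤s (#-strict {S = A ∩ D} (λ i q → proj₁ (∩⁻ q)) (∖∉⁻ (none o) (F'⁺ o∈U o∉D o≢a))
            (∉-intro λ q → clash (proj₂ (∩⁻ q)) o∉D)))
          (hyp {x ∷ []} ([] ∷ []) (∖⁺ (D⊆U xD) xA ∷ []) (subst (_< # U) (sym (+-identityʳ _)) (d< (D⊆U xD))) (here refl))

    -- As 2 d(x) ≤ |D ⊕ a|, the part D ⊕ a pays for d(x) and for one edge from a to each of at most d(x) vertices of J.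
    module Rich {A x} (hyp : Hyp U A) (xD : x ∈ D) (xA : x ∉ A) (rich : d U x + d U x ≤ suc (# D)) where
      A' = A ∖ B

      indep⁺ : ∀ {J} → Indep J → All (_∈ F') J → Indep (x ∷ J)
      indep⁺ i ps = All.map (apart' xD) ps ∷ i

      in⁺ : ∀ {J} → All (_∈ F' ∖ A') J → All (_∈ U ∖ A) (x ∷ J)
      in⁺ ps = ∖⁺ (D⊆U xD) xA ∷ All.map shrink-A ps

      inF' : ∀ {J} → All (_∈ F' ∖ A') J → All (_∈ F') J
      inF' = All.map (proj₁ ∘ ∖⁻)

      -- A longer J could be cut down to exactly d(x) vertices, which together with x form a light
      -- set of d(x) + 1 vertices, too many for x.
      short : ∀ {J} → Indep J → All (_∈ F' ∖ A') J → w F' J < # F' → length J ≤ d U x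
      short {J} i ps l with ≤-total (length J) (d U x)
      ... | inj₁ q = q
      ... | inj₂ q = ⊥-elim (<-irrefl refl (≤-trans (s≤s (m≤m+n _ (# A)))
              (subst (λ k → suc k + # A ≤ d U x) eqlen
                (hyp {x ∷ J'} (indep⁺ (AllPairsₚ.take⁺ _ i) (inF' ps')) (in⁺ ps')
                  (rich-light {d U x} (≤-trans (wF' (inF' ps')) (≤-reflexive (cong (w F' J' +_) eqlen))) (≤-trans (s≤s (w-take {F'} (d U x) J)) l) rich #U-B) (here refl)))))
        where
        J' = take (d U x) J
        ps' : All (_∈ F' ∖ A') J'
        ps' = Allₚ.take⁺ (d U x) ps
        eqlen : length J' ≡ d U x
        eqlen = trans (length-take (d U x) J) (m≤n⇒m⊓n≡m q)

      light' : ∀ {J} → Indep J → All (_∈ F' ∖ A') J → w F' J < # F' → w U (x ∷ J) < # U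
      light' {J} i ps l = rich-light {d U x} (≤-trans (wF' (inF' ps)) (+-monoʳ-≤ (w F' J) (short i ps l))) l rich #U-B

      long : ∀ {J} → Indep J → All (_∈ F' ∖ A') J → w F' J < # F' → ∀ {v} → v ∈ˡ J → suc (length J) + # A ≤ d U v
      long i ps l v = hyp (indep⁺ i (inF' ps)) (in⁺ ps) (light' i ps l) (there v)

      richHyp : Hyp F' A'
      richHyp {J} i ps l v = ≤-pred (≤-trans (≤-trans (s≤s (+-monoʳ-≤ (length J) (#-⊆ {S = A'} λ i q → proj₁ (∖⁻ q)))) (long i ps l v))
        (dF' (All.lookup (inF' ps) v)))

      richGood : NS B → 3 ≤ # B → Good F' A' → Good U A
      richGood nB sB g = record
        { X = X ; X⊆A = λ p → proj₁ (∖⁻ (X⊆A p)) ; Ps = B ∷ Ps ; okP = (nB , sB) ∷ okP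
        ; subP = (λ p → ∖⁺ (B⊆U p) (∉-intro λ q → clash p (proj₂ (∖⁻ (X⊆A q))))) ∷ All.map (λ h {i} p → ∖⁺ (proj₁ (∖⁻ (proj₁ (∖⁻ (h p))))) (proj₂ (∖⁻ (h p)))) subP
        ; disj = All.map (λ h {i} p → ∉-intro λ q → clash p (proj₂ (∖⁻ (proj₁ (∖⁻ (h q)))))) subP ∷ disj
        ; cover = λ {i} p q → [ here , (λ r → there (cover (∖⁺ p r) q)) ]′ (split B i)
        ; J = x ∷ J ; indep = indep⁺ indep (inF' inJ) ; inJ = in⁺ inJ ; len = cong suc len
        ; light = inj₁ (lt light) }
        where
        open Good g
        lt : w F' J < # F' ⊎ J ≡ [] → w U (x ∷ J) < # U
        lt (inj₁ l) = light' indep inJ l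
        lt (inj₂ e) rewrite e = subst (_< # U) (sym (+-identityʳ _)) (d< (D⊆U xD))

    module Absorb {A} (hyp : Hyp U A) (D⊆A : D ⊆ A) where
      A' = A ∖ D

      #A : # A ≡ # D + # A'
      #A = #-∖ λ _ → D⊆A

      light-U : ∀ {J} → Indep J → All (_∈ F) J → w F J < # F → w U J < # U
      light-U {J} i ps l = absorb-light {w U J} {w F J} (wF i ps) l #U-D

      -- A vertex loses at most |D| in degree, and A loses exactly the |D| vertices of D.
      absorbHyp : Hyp F A'
      absorbHyp {J} i ps l {v} vJ = absorb-degree {length J} (hyp i (All.map shrink-A ps) (light-U i (All.map (proj₁ ∘ ∖⁻) ps) l) vJ) (dF+ {v}) #A

      absorbGood : Good F A' → Good U A
      absorbGood g = record
        { X = X ∪ D ; X⊆A = λ p → [ (λ q → proj₁ (∖⁻ (X⊆A q))) , D⊆A ]′ (∪⁻ p) ; Ps = Ps ; okP = okP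
        ; subP = All.map (λ h {i} p → ∖⁺ (proj₁ (∖⁻ (proj₁ (∖⁻ (h p))))) (∪∉ (proj₂ (∖⁻ (h p))) (proj₂ (∖⁻ (proj₁ (∖⁻ (h p))))))) subP
        ; disj = disj
        ; cover = λ p q → cover (∖⁺ p (proj₂ (∪∉⁻ q))) (proj₁ (∪∉⁻ q))
        ; J = J ; indep = indep ; inJ = All.map shrink-A inJ ; len = len
        ; light = [ (λ l → inj₁ (light-U indep (All.map (proj₁ ∘ ∖⁻) inJ) l)) , inj₂ ]′ light }
        where open Good g

    -- E is D with pieces contained in A stripped off, each of which hangs at a single vertex of E (and at a).
    record Core (A E : VSet n) : Set where
      field
        E⊆D : E ⊆ D
        rest⊆A : ∀ {i} → i ∈ D → i ∉ E → i ∈ A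
        nsE : NS E
        one : ∀ {p u v} → p ∈ D → p ∉ E → u ∈ E → v ∈ E → u ∈ G p → v ∈ G p → u ≡ v

    module Detach {A E x} (hyp : Hyp U A) (core : Core A E) (nB : NS B) (sE : 3 ≤ # E) (xD : x ∈ D) (xA : x ∉ A) where
      open Core core
      A' = (A ∖ D) ⊕ a

      #A' : # A' ≤ suc (# A)
      #A' = ≤-trans (#-cover {S = A'} {A} {⁅ a ⁆} (λ i p → [ (λ q → inj₁ (proj₁ (∖⁻ q))) , (λ { refl → inj₂ (single⁺ i) }) ]′ (⊕⁻ p)))
        (≤-reflexive (trans (cong (# A +_) (#-single a)) (+-comm (# A) 1)))

      shrink : ∀ {i} → i ∈ F ∖ A' → i ∈ U ∖ A × i ∈ F × i ≢ a
      shrink p with ∖⁻ p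
      ... | q , r with ⊕∉⁻ r
      ...   | s , t = shrink-A (∖⁺ q s) , q , t

      indep⁺ : ∀ {J} → Indep J → All (_∈ F ∖ A') J → Indep (x ∷ J)
      indep⁺ i ps = All.map (λ p → let _ , q , r = shrink p in apart xD (proj₁ (∖⁻ q)) (proj₂ (∖⁻ q)) r) ps ∷ i

      in⁺ : ∀ {J} → All (_∈ F ∖ A') J → All (_∈ U ∖ A) (x ∷ J)
      in⁺ ps = ∖⁺ (D⊆U xD) xA ∷ All.map (proj₁ ∘ shrink) ps

      light' : ∀ {J} → All (_∈ F ∖ A') J → w F J < # F → w U (x ∷ J) < # U
      light' {J} ps l = detach-light {d U x} {w U J} {w F J} (wF≢ (All.map (proj₂ ∘ shrink) ps)) l (dD xD) #U-D

      -- Since `a` is barred from J, no degree in J drops, and J stays light when x is added at cost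
      -- at most |D|. The additional vertex x pays for the entry of `a` into A.
      detachHyp : Hyp F A'
      detachHyp {J} i ps l {v} vJ = ≤-trans (+-monoʳ-≤ (length J) #A')
        (≤-trans (≤-reflexive (+-suc (length J) (# A)))
          (≤-trans (hyp (indep⁺ i ps) (in⁺ ps) (light' ps l) (there vJ))
            (let _ , q , r = shrink (All.lookup ps vJ) in dF q r)))

      -- If a was moved away, the part is D ⊕ a and nothing of D needs to be moved; otherwise it is E.
      detachGood : Good F A' → Good U A
      detachGood g = with-a (split X a)
        where
        open Good g
        lt : w F J < # F ⊎ J ≡ [] → w U (x ∷ J) < # U
        lt (inj₁ l) = light' inJ l
        lt (inj₂ e) rewrite e = subst (_< # U) (sym (+-identityʳ _)) (d< (D⊆U xD))
        X∉D : ∀ {i} → i ∈ X → i ∈ D → ⊥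
        X∉D p q with ⊕⁻ (X⊆A p)
        ... | inj₁ r = clash q (proj₂ (∖⁻ r))
        ... | inj₂ refl = clash q a∉D
        X-a : ∀ {i} → i ∈ X → i ≢ a → i ∈ A
        X-a p q with ⊕⁻ (X⊆A p)
        ... | inj₁ r = proj₁ (∖⁻ r)
        ... | inj₂ r = ⊥-elim (q r)
        with-a : a ∈ X ⊎ a ∉ X → Good U A
        with-a (inj₁ aX) = record
          { X = X ─ a ; X⊆A = λ p → X-a (proj₁ (─⁻ p)) (proj₂ (─⁻ p))
          ; Ps = B ∷ Ps ; okP = (nB , ≤-trans sE (≤-trans (#-⊆ {S = E} {B} (λ _ p → ∪⁺ˡ (E⊆D p))) ≤-refl)) ∷ okP
          ; subP = (λ p → ∖⁺ (B⊆U p) (∉-intro λ q → [ X∉D (proj₁ (─⁻ q)) , proj₂ (─⁻ q) ]′ (⊕⁻ p)))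
                 ∷ All.map (λ h {i} p → ∖⁺ (proj₁ (∖⁻ (proj₁ (∖⁻ (h p))))) (∖∉ˡ (proj₂ (∖⁻ (h p))))) subP
          ; disj = All.map (λ h {i} p → ∉-intro λ q → [ (λ r → clash r (proj₂ (∖⁻ (proj₁ (∖⁻ (h q)))))) , (λ { refl → clash aX (proj₂ (∖⁻ (h q))) }) ]′ (⊕⁻ p)) subP ∷ disj
          ; cover = λ {i} p q → [ here , (λ r → there (cover (∖⁺ p (proj₁ (⊕∉⁻ r))) (∉-intro λ t → clash (─⁺ t (proj₂ (⊕∉⁻ r))) q))) ]′ (split B i)
          ; J = x ∷ J ; indep = indep⁺ indep inJ ; inJ = in⁺ inJ ; len = cong suc len ; light = inj₁ (lt light) }
        with-a (inj₂ aX) = record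
          { X = X ∪ (D ∖ E)
          ; X⊆A = λ p → [ (λ q → X-a q (λ { refl → clash q aX })) , (λ q → rest⊆A (proj₁ (∖⁻ q)) (proj₂ (∖⁻ q))) ]′ (∪⁻ p)
          ; Ps = E ∷ Ps ; okP = (nsE , sE) ∷ okP
          ; subP = (λ p → ∖⁺ (D⊆U (E⊆D p)) (∪∉ (∉-intro λ q → X∉D q (E⊆D p)) (∖∉ʳ p)))
                 ∷ All.map (λ h {i} p → ∖⁺ (proj₁ (∖⁻ (proj₁ (∖⁻ (h p))))) (∪∉ (proj₂ (∖⁻ (h p))) (∖∉ˡ (proj₂ (∖⁻ (proj₁ (∖⁻ (h p)))))))) subP
          ; disj = All.map (λ h {i} p → ∉-intro λ q → clash (E⊆D p) (proj₂ (∖⁻ (proj₁ (∖⁻ (h q)))))) subP ∷ disj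
          ; cover = λ {i} p q → [ (λ r → here (∖∉⁻ (proj₂ (∪∉⁻ q)) r)) , (λ r → there (cover (∖⁺ p r) (proj₁ (∪∉⁻ q)))) ]′ (split D i)
          ; J = x ∷ J ; indep = indep⁺ indep inJ ; inJ = in⁺ inJ ; len = cong suc len ; light = inj₁ (lt light) }

    module MakeCore {A} (dense : ∀ {x} → x ∈ D → x ∉ A → 2 + # D ≤ d U x + d U x) where
      -- The invariant of the stripping process; a `Pre` set that is nonseparable is a core.
      record Pre (E : VSet n) : Set where
        field
          E⊆D : E ⊆ D
          rest⊆A : ∀ {i} → i ∈ D → i ∉ E → i ∈ A
          one : ∀ {p u v} → p ∈ D → p ∉ E → u ∈ E → v ∈ E → u ∈ G p → v ∈ G p → u ≡ v

      -- Two nonadjacent vertices of D ∖ A have at least three common neighbours, so neither a, nor y,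
      -- nor the vertices already stripped off can separate them.
      not-both : ∀ {E T K y x x'} → Pre E → T ⊆ E → (∀ {q} → q ∈ E → q ∈ T ⊎ q ≡ y) → Split T K →
                 x ∈ T → x ∈ K → x ∉ A → x' ∈ T → x' ∉ K → x' ∉ A → ⊥
      not-both {E} {T} {K} {y} {x} {x'} pre TE ET s xT xK xA x'T x'K x'A =
        <-irrefl refl (dense-common {d U x} {d U x'} (dense xD xA) (dense x'D x'A) common sizeD two)
        where
        open Pre pre
        open Split s
        xD = E⊆D (TE xT)
        x'D = E⊆D (TE x'T)
        x≢x' : x ≢ x'
        x≢x' refl = clash xK x'K
        W V : VSet n
        W = (D ─ x ─ x') ⊕ a
        V = ⁅ a ⁆ ⊕ y
        two : # V ≤ 2
        two = #-list≤ {S = V} (a ∷ y ∷ []) λ i p → [ (λ q → here (single⁻ q)) , (λ q → there (here q)) ]′ (⊕⁻ p)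
        sizeD : suc (# W) ≡ # D
        sizeD = trans (cong suc (#-⊕ {S = D ─ x ─ x'} (∖∉ˡ (∖∉ˡ a∉D))))
          (trans (cong suc (sym (#-─ {S = D ─ x} {x'} (─⁺ x'D (x≢x' ∘ sym))))) (sym (#-─ xD)))
        toW : ∀ {z z'} → z ∈ D → z ∉ G z' → ∀ i → i ∈ U ∩ G z → i ≢ z × i ≢ z' × (i ∈ D ⊎ i ≡ a)
        toW {z} {z'} zD ne i p with ∩⁻ p
        ... | iU , e = (λ { refl → clash e ≁irr }) , (λ { refl → clash (~sym e) ne }) , which
          where
          which : i ∈ D ⊎ i ≡ a
          which with split D i | ≟⊎ i a
          ... | inj₁ q | _ = inj₁ q
          ... | inj₂ _ | inj₁ q = inj₂ q
          ... | inj₂ q | inj₂ r = ⊥-elim (clash e (sep zD iU q r))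
        xx' : x' ∉ G x
        xx' = cross xT xK x'T x'K
        inW : ∀ {i} → i ≢ x × i ≢ x' × (i ∈ D ⊎ i ≡ a) → i ∈ W
        inW (p , q , inj₁ r) = ∪⁺ˡ (─⁺ (─⁺ r p) q)
        inW (p , q , inj₂ refl) = a∈⊕ {S = D ─ x ─ x'}
        inV : ∀ i → i ∈ U ∩ G x → i ∈ U ∩ G x' → i ∈ V
        inV i p q with toW xD (≁sym xx') i p
        ... | _ , _ , inj₂ refl = ∪⁺ˡ (single⁺ a)
        ... | _ , _ , inj₁ iD with ≟⊎ i y
        ...   | inj₁ refl = a∈⊕ {S = ⁅ a ⁆}
        ...   | inj₂ iy with split E i
        ...     | inj₂ iE = ⊥-elim (x≢x' (one iD iE (TE xT) (TE x'T) (~sym (proj₂ (∩⁻ p))) (~sym (proj₂ (∩⁻ q)))))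
        ...     | inj₁ iE with ET iE
        ...       | inj₂ e = ⊥-elim (iy e)
        ...       | inj₁ iT with split K i
        ...         | inj₁ iK = ⊥-elim (clash (~sym (proj₂ (∩⁻ q))) (cross iT iK x'T x'K))
        ...         | inj₂ iK = ⊥-elim (clash (proj₂ (∩⁻ p)) (cross xT xK iT iK))
        common : d U x + d U x' ≤ # W + # V
        common = #-∩∪ (λ i p → inW (toW xD (≁sym xx') i p))
          (λ i p → inW (let a₁ , b₁ , c₁ = toW x'D xx' i p in b₁ , a₁ , c₁)) inV

      -- The removed side has no neighbour across the split, so in what remains it can see only the
      -- deleted vertex y. This gives `one` for the newly stripped vertices.
      strip : ∀ {E T K y} → Pre E → T ⊆ E → (∀ {q} → q ∈ E → q ∈ T ⊎ q ≡ y) → Split T K →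
              (∀ i → i ∉ (T ∩ K) ∖ A) → Pre (E ∖ (T ∩ K)) × # (E ∖ (T ∩ K)) < # E
      strip {E} {T} {K} {y} pre TE ET s none = record { E⊆D = λ p → E⊆D (proj₁ (∖⁻ p)) ; rest⊆A = r ; one = o' }
          , #-strict (λ _ p → proj₁ (∖⁻ p)) (TE uT) (∖∉ʳ (∩⁺ uT uK))
        where
        open Pre pre
        open Split s
        r : ∀ {i} → i ∈ D → i ∉ E ∖ (T ∩ K) → i ∈ A
        r {i} p q with split E i
        ... | inj₂ e = rest⊆A p e
        ... | inj₁ e = ∖∉⁻ (none i) (∖∉⁻ q e)
        toy : ∀ {p u} → p ∈ T ∩ K → u ∈ E ∖ (T ∩ K) → u ∈ G p → u ≡ y
        toy {p} {u} pt ut e with ET (proj₁ (∖⁻ ut))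
        ... | inj₂ q = q
        ... | inj₁ q with split K u
        ...   | inj₁ t = ⊥-elim (clash (∩⁺ q t) (proj₂ (∖⁻ ut)))
        ...   | inj₂ t = ⊥-elim (clash e (cross (proj₁ (∩⁻ pt)) (proj₂ (∩⁻ pt)) q t))
        o' : ∀ {p u v} → p ∈ D → p ∉ E ∖ (T ∩ K) → u ∈ E ∖ (T ∩ K) → v ∈ E ∖ (T ∩ K) → u ∈ G p → v ∈ G p → u ≡ v
        o' {p} pD pE uE vE eu ev with split E p
        ... | inj₂ q = one pD q (proj₁ (∖⁻ uE)) (proj₁ (∖⁻ vE)) eu ev
        ... | inj₁ q = trans (toy (∖∉⁻ pE q) uE eu) (sym (toy (∖∉⁻ pE q) vE ev))

      -- By `not-both`, one of the two sides lies entirely in A and may be stripped off.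
      strip-side : ∀ {E T K y} → Pre E → T ⊆ E → (∀ {q} → q ∈ E → q ∈ T ⊎ q ≡ y) → Split T K →
                   ∃ λ E' → Pre E' × # E' < # E
      strip-side {E} {T} {K} {y} pre TE ET s with search ((T ∩ K) ∖ A) | search ((T ∩ ∁ K) ∖ A)
      ... | inj₂ none | _ = _ , strip pre TE ET s none
      ... | inj₁ _ | inj₂ none = _ , strip pre TE ET (split-∁ s) none
      ... | inj₁ (x , p) | inj₁ (x' , q) with ∖⁻ p | ∖⁻ q
      ...   | pT , xA | qT , x'A = ⊥-elim (not-both pre TE ET s (proj₁ (∩⁻ pT)) (proj₂ (∩⁻ pT)) xA
                (proj₁ (∩⁻ qT)) (∁⁻ (proj₂ (∩⁻ qT))) x'A)

      shrink-to-core : ∀ m E → # E ≤ m → Pre E → ∃ (Core A)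
      shrink-to-core m E b pre with decConn E
      shrink-to-core zero E b pre | inj₂ (K , s) = ⊥-elim (<-irrefl refl (≤-trans (#-pos (Split.uT s)) b))
      -- Here E itself is disconnected and nothing has been deleted; `a`, which lies outside D,
      -- merely fills the place of y.
      shrink-to-core (suc m) E b pre | inj₂ (K , s) with strip-side {y = a} pre id inj₁ s
      ... | E' , pre' , lt = shrink-to-core m E' (≤-pred (≤-trans lt b)) pre'
      shrink-to-core m E b pre | inj₁ c with decNS c
      ... | inj₁ ns = E , record { E⊆D = E⊆D ; rest⊆A = rest⊆A ; nsE = ns ; one = one }
        where open Pre pre
      shrink-to-core zero E b pre | inj₁ c | inj₂ (y , yE , K , s) = ⊥-elim (<-irrefl refl (≤-trans (#-pos yE) b))
      shrink-to-core (suc m) E b pre | inj₁ c | inj₂ (y , yE , K , s)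
        with strip-side {y = y} pre (λ p → proj₁ (─⁻ p)) (λ {q} p → [ inj₂ , (λ r → inj₁ (─⁺ p r)) ]′ (≟⊎ q y)) s
      ... | E' , pre' , lt = shrink-to-core m E' (≤-pred (≤-trans lt b)) pre'

      theCore : ∃ (Core A)
      theCore = shrink-to-core (# D) D ≤-refl record { E⊆D = id ; rest⊆A = λ p q → ⊥-elim (clash p q)
        ; one = λ p q → ⊥-elim (clash p q) }

  -- Disconnected vertex sets

  record Component (U U₁ : VSet n) : Set where
    field
      sub : U₁ ⊆ U
      closed : ∀ {p q} → p ∈ U₁ → q ∈ U → q ∉ U₁ → q ∉ G p

    dC : ∀ {v} → v ∈ U₁ → d U v ≤ d U₁ v
    dC {v} p = #-⊆ λ i q → [ (λ r → ∩⁺ r (proj₂ (∩⁻ q))) , (λ r → ⊥-elim (clash (proj₂ (∩⁻ q)) (closed p (proj₁ (∩⁻ q)) r))) ]′ (split U₁ i)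

    wC : ∀ {J} → All (_∈ U₁) J → w U J ≤ w U₁ J
    wC [] = z≤n
    wC (p ∷ ps) = dC p ⊞ wC ps

    inC : ∀ {A i} → i ∈ U₁ ∖ (A ∩ U₁) → i ∈ U ∖ A
    inC p = ∖⁺ (sub (proj₁ (∖⁻ p))) (∉-intro λ q → clash (∩⁺ q (proj₁ (∖⁻ p))) (proj₂ (∖⁻ p)))

    hypC : ∀ {A} → Hyp U A → Hyp U₁ (A ∩ U₁)
    hypC hyp {J} i ps l {v} vJ = ≤-trans (+-monoʳ-≤ (length J) (#-⊆ λ i p → proj₁ (∩⁻ p)))
      (≤-trans (hyp i (All.map inC ps) (≤-trans (s≤s (wC (All.map (proj₁ ∘ ∖⁻) ps))) (≤-trans l (#-⊆ λ _ → sub))) vJ)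
        (dC (proj₁ (∖⁻ (All.lookup ps vJ)))))

  component : ∀ {U K} → Split U K → Component U (U ∩ K)
  component s = record { sub = λ p → proj₁ (∩⁻ p)
    ; closed = λ p qU q → Split.cross s (proj₁ (∩⁻ p)) (proj₂ (∩⁻ p)) qU (∉-intro λ r → clash (∩⁺ qU r) q) }

  w-++ : ∀ {U} J J' → w U (J ++ J') ≡ w U J + w U J'
  w-++ [] J' = refl
  w-++ {U} (x ∷ J) J' = trans (cong (d U x +_) (w-++ J J')) (sym (+-assoc (d U x) _ _))

  module Disconnected {U A K : VSet n} (s : Split U K) where
    U₁ = U ∩ K
    U₂ = U ∩ ∁ K
    module C₁ = Component (component s)
    module C₂ = Component (component (split-∁ s))

    disjoint : ∀ {i} → i ∈ U₁ → i ∉ U₂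
    disjoint p = ∉-intro λ q → clash (proj₂ (∩⁻ p)) (∁⁻ (proj₂ (∩⁻ q)))

    sizes : # U₁ + # U₂ ≤ # U
    sizes = #-disj (λ _ p → proj₁ (∩⁻ p)) (λ _ p → proj₁ (∩⁻ p)) (λ i p q → clash q (disjoint p))

    apart₁₂ : ∀ {u v} → u ∈ U₁ → v ∈ U₂ → Apart u v
    apart₁₂ p q = (λ { refl → clash q (disjoint p) }) , C₁.closed p (proj₁ (∩⁻ q)) (∉-intro λ r → clash q (disjoint r))

    goodUnion : Good U₁ (A ∩ U₁) → Good U₂ (A ∩ U₂) → Good U A
    goodUnion g h = record
      { X = g.X ∪ h.X
      ; X⊆A = λ p → [ (λ q → proj₁ (∩⁻ (g.X⊆A q))) , (λ q → proj₁ (∩⁻ (h.X⊆A q))) ]′ (∪⁻ p)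
      ; Ps = g.Ps ++ h.Ps ; okP = Allₚ.++⁺ g.okP h.okP
      ; subP = Allₚ.++⁺
          (All.map (λ f {i} p → ∖⁺ (C₁.sub (proj₁ (∖⁻ (f p)))) (∪∉ (proj₂ (∖⁻ (f p)))
            (∉-intro λ q → clash (proj₂ (∩⁻ (h.X⊆A q))) (disjoint (proj₁ (∖⁻ (f p))))))) g.subP)
          (All.map (λ f {i} p → ∖⁺ (C₂.sub (proj₁ (∖⁻ (f p)))) (∪∉
            (∉-intro λ q → clash (proj₁ (∖⁻ (f p))) (disjoint (proj₂ (∩⁻ (g.X⊆A q))))) (proj₂ (∖⁻ (f p))))) h.subP)
      ; disj = AllPairsₚ.++⁺ g.disj h.disj (All.map (λ f → All.map (λ f' {i} p → ∉-intro λ q →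
            clash (proj₁ (∖⁻ (f' q))) (disjoint (proj₁ (∖⁻ (f p))))) h.subP) g.subP)
      ; cover = λ {i} p q → [ (λ r → Anyₚ.++⁺ˡ (g.cover (∩⁺ p r) (proj₁ (∪∉⁻ q))))
                            , (λ r → Anyₚ.++⁺ʳ g.Ps (h.cover (∩⁺ p (∁⁺ r)) (proj₂ (∪∉⁻ q)))) ]′ (split K i)
      ; J = g.J ++ h.J
      ; indep = AllPairsₚ.++⁺ g.indep h.indep (All.map (λ p → All.map (λ q → apart₁₂ (proj₁ (∖⁻ p)) (proj₁ (∖⁻ q))) h.inJ) g.inJ)
      ; inJ = Allₚ.++⁺ (All.map C₁.inC g.inJ) (All.map C₂.inC h.inJ)
      ; len = trans (length-++ g.J) (trans (cong₂ _+_ g.len h.len) (sym (length-++ g.Ps)))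
      ; light = lt g.light h.light }
      where
      module g = Good g
      module h = Good h
      w₁ : w U g.J ≤ w U₁ g.J
      w₁ = C₁.wC (All.map (proj₁ ∘ ∖⁻) g.inJ)
      w₂ : w U h.J ≤ w U₂ h.J
      w₂ = C₂.wC (All.map (proj₁ ∘ ∖⁻) h.inJ)
      lt : w U₁ g.J < # U₁ ⊎ g.J ≡ [] → w U₂ h.J < # U₂ ⊎ h.J ≡ [] → w U (g.J ++ h.J) < # U ⊎ g.J ++ h.J ≡ []
      lt (inj₁ p) (inj₁ q) = inj₁ (subst (_< # U) (sym (w-++ g.J h.J)) (≤-trans (sum-< {w U g.J} w₁ p w₂ q) sizes))
      lt (inj₂ p) (inj₂ q) = inj₂ (cong₂ _++_ p q)
      lt (inj₁ p) (inj₂ q) = inj₁ (subst (_< # U) (sym (trans (w-++ g.J h.J) (trans (cong (λ l → w U g.J + w U l) q) (+-identityʳ _))))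
        (≤-trans (≤-trans (s≤s w₁) p) (≤-trans (m≤m+n _ _) sizes)))
      lt (inj₂ p) (inj₁ q) = inj₁ (subst (_< # U) (sym (trans (w-++ g.J h.J) (cong (λ l → w U l + w U h.J) p)))
        (≤-trans (≤-trans (s≤s w₂) q) (≤-trans (m≤n+m _ _) sizes)))

  goodAbsorbed : ∀ {U A} → (∀ i → i ∉ U ∖ A) → Good U A
  goodAbsorbed {U} {A} h = record { X = A ; X⊆A = id ; Ps = [] ; okP = [] ; subP = [] ; disj = []
    ; cover = λ {i} p q → ⊥-elim (clash (∖⁺ p q) (h i)) ; J = [] ; indep = [] ; inJ = [] ; len = refl ; light = inj₂ refl }

  ∉∅ : ∀ {i : Fin n} → i ∉ ∅
  ∉∅ = nmem refl

  goodOne : ∀ {U A P X x} → X ⊆ A → NS P → 3 ≤ # P → P ⊆ U ∖ X → (∀ {i} → i ∈ U → i ∉ X → i ∈ P) →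
            x ∈ U ∖ A → Good U A
  goodOne {U} {X = X} {x} XA ns s P c xU = record { X = X ; X⊆A = XA ; Ps = _ ∷ [] ; okP = (ns , s) ∷ []
    ; subP = P ∷ [] ; disj = [] ∷ [] ; cover = λ p q → here (c p q) ; J = x ∷ [] ; indep = [] ∷ [] ; inJ = xU ∷ []
    ; len = refl ; light = inj₁ (subst (_< # U) (sym (+-identityʳ _)) (d< (proj₁ (∖⁻ xU)))) }

  -- Lobes that form a nonseparable set with their cut vertex

  module MinimalLobe {U} (cU : Conn U) where
    module _ {a D} (L : Lobe U a D) where
      open LobeFacts L

      -- A side of B that misses `a` would be closed under adjacency in the connected set U, yet
      -- would not contain `o`.
      connB : Conn B
      connB sp₀ with split-avoid a sp₀
      ... | K , sp , aK = clash (proj₁ (∩⁻ o∈)) (⊕∉ o∉D o≢a)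
        where
        u∈ : Split.u sp ∈ B ∩ K
        u∈ = ∩⁺ (Split.uT sp) (Split.uK sp)
        h : ∀ {p q} → p ∈ U → p ∈ B ∩ K → q ∈ U → q ∉ B ∩ K → q ∉ G p
        h {p} {q} pU pB qU qB with split B q
        ... | inj₁ r = Split.cross sp (proj₁ (∩⁻ pB)) (proj₂ (∩⁻ pB)) r (∉-intro λ t → clash (∩⁺ r t) qB)
        ... | inj₂ r with ⊕⁻ (proj₁ (∩⁻ pB))
        ...   | inj₁ pD = sep pD qU (proj₁ (⊕∉⁻ r)) (proj₂ (⊕∉⁻ r))
        ...   | inj₂ refl = ⊥-elim (clash (proj₂ (∩⁻ pB)) aK)
        o∈ : o ∈ B ∩ K
        o∈ = spread cU h (B⊆U (proj₁ (∩⁻ u∈))) u∈ o∈U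

      smaller : ∀ {y K} → y ∈ B → Split (B ─ y) K → ∃ λ a' → ∃ λ D' → Lobe U a' D' × # D' < # D
      smaller {y} {K₀} yB s₀ with ⊕⁻ yB
      ... | inj₂ refl = a , D ∩ K₀ , record
            { D⊆U = λ p → D⊆U (proj₁ (∩⁻ p)) ; a∈U = a∈U ; a∉D = ∉-intro λ p → clash (proj₁ (∩⁻ p)) a∉D
            ; x₀∈D = ∩⁺ (inD uT) uK ; o∈U = o∈U ; o∉D = ∉-intro λ p → clash (proj₁ (∩⁻ p)) o∉D ; o≢a = o≢a ; sep = sep' }
          , #-strict (λ _ p → proj₁ (∩⁻ p)) (inD vT) (∉-intro λ p → clash (proj₂ (∩⁻ p)) vK)
        where
        open Split s₀
        inD : ∀ {i} → i ∈ B ─ a → i ∈ D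
        inD p = [ id , (λ r → ⊥-elim (proj₂ (─⁻ p) r)) ]′ (⊕⁻ (proj₁ (─⁻ p)))
        sep' : ∀ {p q} → p ∈ D ∩ K₀ → q ∈ U → q ∉ D ∩ K₀ → q ≢ a → q ∉ G p
        sep' {p} {q} pD qU qD qa with split D q
        ... | inj₂ r = sep (proj₁ (∩⁻ pD)) qU r qa
        ... | inj₁ r = cross (─⁺ (∪⁺ˡ (proj₁ (∩⁻ pD))) (λ { refl → clash (proj₁ (∩⁻ pD)) a∉D })) (proj₂ (∩⁻ pD))
              (─⁺ (∪⁺ˡ r) qa) (∉-intro λ t → clash (∩⁺ r t) qD)
      ... | inj₁ yD with split-avoid a s₀
      ...   | K , s , aK = y , (B ─ y) ∩ K , record
            { D⊆U = λ p → D⊆U (inD p) ; a∈U = D⊆U yD ; a∉D = y∉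
            ; x₀∈D = ∩⁺ (Split.uT s) (Split.uK s) ; o∈U = a∈U ; o∉D = ∉-intro λ p → clash (proj₂ (∩⁻ p)) aK
            ; o≢a = (λ { refl → clash yD a∉D }) ; sep = sep' }
          , #-strict (λ _ → inD) yD y∉
        where
        inD : ∀ {i} → i ∈ (B ─ y) ∩ K → i ∈ D
        inD p = [ id , (λ { refl → ⊥-elim (clash (proj₂ (∩⁻ p)) aK) }) ]′ (⊕⁻ (proj₁ (─⁻ (proj₁ (∩⁻ p)))))
        y∉ : y ∉ (B ─ y) ∩ K
        y∉ = ∉-intro λ p → proj₂ (─⁻ (proj₁ (∩⁻ p))) refl
        sep' : ∀ {p q} → p ∈ (B ─ y) ∩ K → q ∈ U → q ∉ (B ─ y) ∩ K → q ≢ y → q ∉ G p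
        sep' {p} {q} pD qU qD qy with split B q
        ... | inj₂ r = sep (inD pD) qU (proj₁ (⊕∉⁻ r)) (proj₂ (⊕∉⁻ r))
        ... | inj₁ r = Split.cross s (proj₁ (∩⁻ pD)) (proj₂ (∩⁻ pD)) (─⁺ r qy) (∉-intro λ t → clash (∩⁺ (─⁺ r qy) t) qD)

    refine : ∀ m {a D} → # D ≤ m → Lobe U a D → ∃ λ a' → ∃ λ D' → Lobe U a' D' × NS (D' ⊕ a')
    refine m b L with decNS (connB L)
    ... | inj₁ ns = _ , _ , L , ns
    refine zero b L | inj₂ _ = ⊥-elim (<-irrefl refl (≤-trans (#-pos (Lobe.x₀∈D L)) b))
    refine (suc m) b L | inj₂ (y , yB , K , s) with smaller L yB s
    ... | a' , D' , L' , lt = refine m (≤-pred (≤-trans lt b)) L'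

    minimalLobe : ∀ {y K} → y ∈ U → Split (U ─ y) K → ∃ λ a → ∃ λ D → Lobe U a D × NS (D ⊕ a)
    minimalLobe {y} {K} yU s = refine _ ≤-refl record
      { D⊆U = λ p → proj₁ (─⁻ (proj₁ (∩⁻ p))) ; a∈U = yU ; a∉D = ∉-intro λ p → proj₂ (─⁻ (proj₁ (∩⁻ p))) refl
      ; x₀∈D = ∩⁺ uT uK ; o∈U = proj₁ (─⁻ vT) ; o∉D = ∉-intro λ p → clash (proj₂ (∩⁻ p)) vK ; o≢a = proj₂ (─⁻ vT)
      ; sep = λ p qU q qy → cross (proj₁ (∩⁻ p)) (proj₂ (∩⁻ p)) (─⁺ qU qy) (∉-intro λ r → clash (∩⁺ (─⁺ qU qy) r) q) }
      where open Split s

  -- The exceptional graphs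

  -- By `onto` and `adj` this is an isomorphism between H and the whole of G[U].
  record Emb (U : VSet n) {m} (H : Adj m) : Set where
    field
      e : Fin m → Fin n
      inj : ∀ i j → e i ≡ e j → i ≡ j
      inU : ∀ i → e i ∈ U
      onto : ∀ {u} → u ∈ U → ∃ λ i → e i ≡ u
      adj : ∀ i j → G (e i) (e j) ≡ H i j

    emb-d : ∀ i → d U (e i) ≤ # (H i)
    emb-d i = #-img≤ e h
      where
      h : ∀ u → u ∈ U ∩ G (e i) → ∃ λ j → j ∈ H i × e j ≡ u
      h u p with onto (proj₁ (∩⁻ p))
      ... | j , refl = j , mem (trans (sym (adj i j)) (isTrue (proj₂ (∩⁻ p)))) , refl

    emb-# : m ≤ # U
    emb-# = subst (_≤ # U) (#-full m) (#-img≥ e {U} {full} inj (λ j _ → inU j))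

    emb~ : ∀ i j → H i j ≡ true → e j ∈ G (e i)
    emb~ i j h = mem (trans (adj i j) h)

    emb-apart : ∀ i j → H i j ≡ false → i ≢ j → Apart (e i) (e j)
    emb-apart i j h ne = (λ q → ne (inj i j q)) , nmem (trans (adj i j) h)

  -- U induces some H_{s,t} or H⁻_{s,t}; the classes cS1 and cS2, of unspecified sizes s - 1 and t - 1, contain k and l.
  record HS (U : VSet n) : Set where
    field
      κ : Fin n → Cls
      ab : Bool
      a b c₁ c₂ k l : Fin n
      aU : a ∈ U
      bU : b ∈ U
      c₁U : c₁ ∈ U
      c₂U : c₂ ∈ U
      kU : k ∈ U
      lU : l ∈ U
      κa : κ a ≡ cA
      κb : κ b ≡ cB
      κc₁ : κ c₁ ≡ cC1
      κc₂ : κ c₂ ≡ cC2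
      κk : κ k ≡ cS1
      κl : κ l ≡ cS2
      only : ∀ {i} → i ∈ U → κ i ≡ cS1 ⊎ κ i ≡ cS2 ⊎ i ≡ a ⊎ i ≡ b ⊎ i ≡ c₁ ⊎ i ≡ c₂
      adj : ∀ {i j} → i ∈ U → j ∈ U → i ≢ j → G i j ≡ E ab (κ i) (κ j)

  -- A light set containing a tight vertex of F stays light when it is enlarged suitably in a bigger graph,
  -- so the degree of a tight vertex must go up there.
  Tight : VSet n → Fin n → Set
  Tight F v = ∃ λ J → Indep J × All (_∈ F) J × w F J < # F × v ∈ˡ J × d F v ≤ length J

  -- What the induction uses of 𝓕₁₁ and 𝓕₁₂.
  record Big (U : VSet n) : Set where
    field
      v₁ v₂ v₃ : Fin n
      indep : Indep (v₁ ∷ v₂ ∷ v₃ ∷ [])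
      inU : All (_∈ U) (v₁ ∷ v₂ ∷ v₃ ∷ [])
      low₁ : d U v₁ ≤ 3
      low₂ : d U v₂ ≤ 3
      low₃ : d U v₃ ≤ 3
      large : 11 ≤ # U
      ext : ∀ {b} → b ∉ U → (∀ {v} → Tight U v → v ∈ G b) → NS (U ⊕ b)
      final : (∃ λ l₁ → ∃ λ l₂ → Emb U (F11 l₁ l₂))
            ⊎ (∃ λ l₁ → ∃ λ l₂ → ∃ λ l₃ → ∃ λ l₄ → T (l₃ ∨ l₄) × Emb U (F12 l₁ l₂ l₃ l₄))

  data Exc (U : VSet n) : Set where
    isK2 : Emb U K2 → Exc U
    isF5 : Emb U F5 → Exc U
    isHS : HS U → Exc U
    isBig : Big U → Exc U

  HypE : VSet n → Set
  HypE U = ∀ {J} → Indep J → All (_∈ U) J → w U J < # U → ∀ {v} → v ∈ˡ J → length J ≤ d U v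

  hypE : ∀ {U A} → (∀ i → i ∉ A) → Hyp U A → HypE U
  hypE {A = A} e hyp {J} i ps l v = ≤-trans (m≤m+n (length J) (# A)) (hyp i (All.map (λ p → ∖⁺ p (e _)) ps) l v)

  -- A triangle hanging at the cut vertex

  module Triangle {U A : VSet n} {a : Fin n} {D : VSet n} {x x' : Fin n} (L : Lobe U a D) (hyp : HypE U) (A∅ : ∀ i → i ∉ A)
      (xD : x ∈ D) (x'D : x' ∈ D) (D⁻ : ∀ {i} → i ∈ D → i ≡ x ⊎ i ≡ x')
      (xx' : x' ∈ G x) (xa : x ∈ G a) (x'a : x' ∈ G a) where
    open LobeFacts L

    #D≤2 : # D ≤ 2
    #D≤2 = #-list≤ (x ∷ x' ∷ []) λ i p → [ here , (λ q → there (here q)) ]′ (D⁻ p)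

    #D≥2 : 2 ≤ # D
    #D≥2 = #-list≥ {l = x ∷ x' ∷ []} ((~⇒≢ xx' ∷ []) ∷ [] ∷ []) (xD ∷ x'D ∷ [])

    cliqueB : ∀ {p q} → p ∈ B → q ∈ B → p ≢ q → q ∈ G p
    cliqueB pB qB ne with ⊕⁻ pB | ⊕⁻ qB
    ... | inj₂ refl | inj₂ refl = ⊥-elim (ne refl)
    cliqueB pB qB ne | inj₁ p | inj₂ refl with D⁻ p
    ... | inj₁ refl = ~sym xa
    ... | inj₂ refl = ~sym x'a
    cliqueB pB qB ne | inj₂ refl | inj₁ q with D⁻ q
    ... | inj₁ refl = xa
    ... | inj₂ refl = x'a
    cliqueB pB qB ne | inj₁ p | inj₁ q with D⁻ p | D⁻ q
    ... | inj₁ refl | inj₁ refl = ⊥-elim (ne refl)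
    ... | inj₁ refl | inj₂ refl = xx'
    ... | inj₂ refl | inj₁ refl = ~sym xx'
    ... | inj₂ refl | inj₂ refl = ⊥-elim (ne refl)

    atLeast2 : ∀ {v} → v ∈ F' → 2 ≤ d U v
    atLeast2 {v} vF = hyp {x ∷ v ∷ []} ((apart' xD vF ∷ []) ∷ [] ∷ []) (D⊆U xD ∷ proj₁ (∖⁻ vF) ∷ [])
      (pair-light (dD xD) (dF'# vF) #U-B) (there (here refl))

    -- As d(x) ≤ 2, the three vertices x, u, v cannot form a light set. Subtracting d(x) ≤ |D| from
    -- |U| leaves an Ore condition on F'.
    ore : ∀ {u v} → u ∈ F' → v ∈ F' → Apart u v → suc (# F') ≤ d U u + d U v
    ore {u} {v} uF vF uv with ≤-<-connex (suc (# F')) (d U u + d U v)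
    ... | inj₁ p = p
    ... | inj₂ lt = ⊥-elim (<-irrefl refl (≤-trans (hyp {x ∷ u ∷ v ∷ []}
              ((apart' xD uF ∷ apart' xD vF ∷ []) ∷ (uv ∷ []) ∷ [] ∷ [])
              (D⊆U xD ∷ proj₁ (∖⁻ uF) ∷ proj₁ (∖⁻ vF) ∷ [])
              (triple-light {d U x} {d U u} (dD xD) lt #U-B) (here refl)) (≤-trans (dD xD) #D≤2)))

    -- A vertex sees at most `a` and the rest of its own side, so vertices on different sides of a
    -- separation would have degree sum at most |F'|.
    connF' : Conn F'
    connF' {K} s = <-irrefl refl (ore-components {d U u} {d U v} (ore (proj₁ (∩⁻ uC)) (proj₁ (∩⁻ vC)) (apart₁₂ uC vC))
        (side C₁.dC uC) (side C₂.dC vC) sizes)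
      where
      open Split s
      open Disconnected {A = A} s
      uC : u ∈ U₁
      uC = ∩⁺ uT uK
      vC : v ∈ U₂
      vC = ∩⁺ vT (∁⁺ vK)
      side : ∀ {R z} → (∀ {v} → v ∈ F' ∩ R → d F' v ≤ d (F' ∩ R) v) → z ∈ F' ∩ R → d U z ≤ # (F' ∩ R)
      side h z = ≤-trans (dF' (proj₁ (∩⁻ z))) (≤-trans (s≤s (h z)) (d< z))

    o∈F' : o ∈ F'
    o∈F' = F'⁺ o∈U o∉D o≢a

    good : NS F' → 3 ≤ # F' → Good U A
    good ns s = record { X = ∅ ; X⊆A = λ { (mem ()) } ; Ps = B ∷ F' ∷ []
      ; okP = (clique cliqueB , subst (3 ≤_) (sym #B) (s≤s #D≥2)) ∷ (ns , s) ∷ []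
      ; subP = (λ p → ∖⁺ (B⊆U p) ∉∅) ∷ (λ p → ∖⁺ (proj₁ (∖⁻ p)) ∉∅) ∷ []
      ; disj = ((λ p → ∉-intro λ q → clash p (proj₂ (∖⁻ q))) ∷ []) ∷ [] ∷ []
      ; cover = λ {i} p _ → [ here , (λ q → there (here (∖⁺ p q))) ]′ (split B i)
      ; J = x ∷ o ∷ [] ; indep = (apart' xD o∈F' ∷ []) ∷ [] ∷ []
      ; inJ = ∖⁺ (D⊆U xD) (A∅ _) ∷ ∖⁺ o∈U (A∅ _) ∷ [] ; len = refl
      ; light = inj₁ (pair-light (dD xD) (dF'# o∈F') #U-B) }

    module FiveVertices (le : # F' ≤ 2) where
      -- The degree of f is at least 2, and F' provides at most one neighbour.
      adjA : ∀ {f} → f ∈ F' → f ∈ G a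
      adjA {f} fF with split (G a) f
      ... | inj₁ p = p
      ... | inj₂ p = ⊥-elim (<-irrefl refl (≤-trans (s≤s (≤-trans (atLeast2 fF) (dF'≁ fF p))) (≤-trans (d< fF) le)))

      nbr : ∃ λ g → g ∈ F' ∩ G o
      nbr = #-pos⁻ (≤-pred (≤-trans (atLeast2 o∈F') (dF' o∈F')))

      f g : Fin n
      f = o
      g = proj₁ nbr
      gF : g ∈ F'
      gF = proj₁ (∩⁻ (proj₂ nbr))
      fg : g ∈ G f
      fg = proj₂ (∩⁻ (proj₂ nbr))

      F'⁻' : ∀ {i} → i ∈ F' → i ≡ f ⊎ i ≡ g
      F'⁻' {i} iF with ≟⊎ i f | ≟⊎ i g
      ... | inj₁ p | _ = inj₁ p
      ... | inj₂ _ | inj₁ q = inj₂ q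
      ... | inj₂ p | inj₂ q = ⊥-elim (<-irrefl refl (≤-trans (#-list≥ {l = i ∷ f ∷ g ∷ []}
              ((p ∷ q ∷ []) ∷ (~⇒≢ fg ∷ []) ∷ [] ∷ []) (iF ∷ o∈F' ∷ gF ∷ [])) le))

      e : Fin 5 → Fin n
      e 0F = a
      e 1F = x
      e 2F = x'
      e 3F = f
      e 4F = g

      x≁ : ∀ {y z} → y ∈ D → z ∈ F' → G y z ≡ false
      x≁ yD zF = isFalse (proj₂ (apart' yD zF))

      adj : ∀ i j → G (e i) (e j) ≡ F5 i j
      adj 0F 0F = girr _
      adj 0F 1F = isTrue xa
      adj 0F 2F = isTrue x'a
      adj 0F 3F = isTrue (adjA o∈F')
      adj 0F 4F = isTrue (adjA gF)
      adj 1F 0F = isTrue (~sym xa)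
      adj 1F 1F = girr _
      adj 1F 2F = isTrue xx'
      adj 1F 3F = x≁ xD o∈F'
      adj 1F 4F = x≁ xD gF
      adj 2F 0F = isTrue (~sym x'a)
      adj 2F 1F = isTrue (~sym xx')
      adj 2F 2F = girr _
      adj 2F 3F = x≁ x'D o∈F'
      adj 2F 4F = x≁ x'D gF
      adj 3F 0F = isTrue (~sym (adjA o∈F'))
      adj 3F 1F = trans (gsym _ _) (x≁ xD o∈F')
      adj 3F 2F = trans (gsym _ _) (x≁ x'D o∈F')
      adj 3F 3F = girr _
      adj 3F 4F = isTrue fg
      adj 4F 0F = isTrue (~sym (adjA gF))
      adj 4F 1F = trans (gsym _ _) (x≁ xD gF)
      adj 4F 2F = trans (gsym _ _) (x≁ x'D gF)
      adj 4F 3F = isTrue (~sym fg)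
      adj 4F 4F = girr _

      DF : ∀ {y z} → y ∈ D → z ∈ F' → y ≢ z
      DF yD zF = proj₁ (apart' yD zF)

      inj : ∀ i j → e i ≡ e j → i ≡ j
      inj 0F 0F _ = refl
      inj 0F 1F p = ⊥-elim (~⇒≢ xa p)
      inj 0F 2F p = ⊥-elim (~⇒≢ x'a p)
      inj 0F 3F p = ⊥-elim (~⇒≢ (adjA o∈F') p)
      inj 0F 4F p = ⊥-elim (~⇒≢ (adjA gF) p)
      inj 1F 0F p = ⊥-elim (~⇒≢ xa (sym p))
      inj 1F 1F _ = refl
      inj 1F 2F p = ⊥-elim (~⇒≢ xx' p)
      inj 1F 3F p = ⊥-elim (DF xD o∈F' p)
      inj 1F 4F p = ⊥-elim (DF xD gF p)
      inj 2F 0F p = ⊥-elim (~⇒≢ x'a (sym p))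
      inj 2F 1F p = ⊥-elim (~⇒≢ xx' (sym p))
      inj 2F 2F _ = refl
      inj 2F 3F p = ⊥-elim (DF x'D o∈F' p)
      inj 2F 4F p = ⊥-elim (DF x'D gF p)
      inj 3F 0F p = ⊥-elim (~⇒≢ (adjA o∈F') (sym p))
      inj 3F 1F p = ⊥-elim (DF xD o∈F' (sym p))
      inj 3F 2F p = ⊥-elim (DF x'D o∈F' (sym p))
      inj 3F 3F _ = refl
      inj 3F 4F p = ⊥-elim (~⇒≢ fg p)
      inj 4F 0F p = ⊥-elim (~⇒≢ (adjA gF) (sym p))
      inj 4F 1F p = ⊥-elim (DF xD gF (sym p))
      inj 4F 2F p = ⊥-elim (DF x'D gF (sym p))
      inj 4F 3F p = ⊥-elim (~⇒≢ fg (sym p))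
      inj 4F 4F _ = refl

      inU : ∀ i → e i ∈ U
      inU 0F = a∈U
      inU 1F = D⊆U xD
      inU 2F = D⊆U x'D
      inU 3F = o∈U
      inU 4F = proj₁ (∖⁻ gF)

      onto : ∀ {u} → u ∈ U → ∃ λ i → e i ≡ u
      onto {u} uU with ≟⊎ u a | split D u
      ... | inj₁ p | _ = 0F , sym p
      onto {u} uU | inj₂ p | inj₁ q with D⁻ q
      ... | inj₁ r = 1F , sym r
      ... | inj₂ r = 2F , sym r
      onto {u} uU | inj₂ p | inj₂ q with F'⁻' (F'⁺ uU q p)
      ... | inj₁ r = 3F , sym r
      ... | inj₂ r = 4F , sym r

      result : Emb U F5
      result = record { e = e ; inj = inj ; inU = inU ; onto = onto ; adj = adj }

    module TwoCliques {y} (yF : y ∈ F') where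
      module Side {K} (s : Split (F' ─ y) K) where
        open Split s
        open Disconnected {A = A} s public
        vC : v ∈ U₂
        vC = ∩⁺ vT (∁⁺ vK)

        inF : ∀ {K i} → i ∈ (F' ─ y) ∩ K → i ∈ F'
        inF p = proj₁ (─⁻ (proj₁ (∩⁻ p)))

        W : ∀ K → Fin n → VSet n
        W K z = ((F' ─ y) ∩ K) ─ z ⊕ y ⊕ a

        #W : ∀ {K z} → z ∈ (F' ─ y) ∩ K → # (W K z) ≤ suc (# ((F' ─ y) ∩ K))
        #W zC = ≤-trans #-⊕≤ (s≤s (≤-trans #-⊕≤ (≤-reflexive (sym (#-─ zC)))))

        subW : ∀ {K z} → (∀ {p q} → p ∈ (F' ─ y) ∩ K → q ∈ F' ─ y → q ∉ (F' ─ y) ∩ K → q ∉ G p) →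
               z ∈ (F' ─ y) ∩ K → ∀ i → i ∈ U ∩ G z → i ∈ W K z
        subW {K} {z} cl zC i p with ≟⊎ i a | ≟⊎ i y | split D i | split K i
        ... | inj₁ refl | _ | _ | _ = a∈⊕ {S = ((F' ─ y) ∩ K) ─ z ⊕ y}
        ... | inj₂ _ | inj₁ refl | _ | _ = ∪⁺ˡ (a∈⊕ {S = ((F' ─ y) ∩ K) ─ z})
        ... | inj₂ r | inj₂ t | inj₁ q | _ = ⊥-elim (clash (~sym (proj₂ (∩⁻ p))) (proj₂ (apart' q (inF zC))))
        ... | inj₂ r | inj₂ t | inj₂ q | inj₁ iK = ∪⁺ˡ (∪⁺ˡ (─⁺ (∩⁺ (─⁺ (F'⁺ (proj₁ (∩⁻ p)) q r) t) iK) (λ { refl → clash (proj₂ (∩⁻ p)) ≁irr })))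
        ... | inj₂ r | inj₂ t | inj₂ q | inj₂ iK = ⊥-elim (clash (proj₂ (∩⁻ p))
              (cl zC (─⁺ (F'⁺ (proj₁ (∩⁻ p)) q r) t) (∉-intro λ c → clash (proj₂ (∩⁻ c)) iK)))

        total : # U₁ + # U₂ < # F'
        total = ≤-trans (s≤s sizes) (≤-reflexive (sym (#-─ yF)))

        -- For z and v on different sides of y the Ore bound is attained: they have at most |U₁| + 1
        -- and |U₂| + 1 possible neighbours, and |U₁| + |U₂| < |F'|. Hence z is adjacent to all of
        -- its possible neighbours, namely its own side, y and a.
        complete : ∀ {z q} → z ∈ U₁ → q ∈ W K z → q ∈ G z
        complete {z} {q} zC qW with split (G z) q
        ... | inj₁ r = r
        ... | inj₂ r = ⊥-elim (<-irrefl refl (ore-cut {d U z} {d U v}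
                (ore (inF zC) (inF vC) (apart₁₂ zC vC))
                (≤-trans (#-strict (subW C₁.closed zC) qW (∉-intro λ t → clash (proj₂ (∩⁻ t)) r)) (#W zC))
                (≤-trans (#-⊆ (subW C₂.closed vC)) (#W vC)) total))

        inside : ∀ {z q} → z ∈ U₁ → q ∈ U₁ → z ≢ q → q ∈ G z
        inside zC qC ne = complete zC (∪⁺ˡ (∪⁺ˡ (─⁺ qC (ne ∘ sym))))

        toY : ∀ {z} → z ∈ U₁ → y ∈ G z
        toY {z} zC = complete zC (∪⁺ˡ (a∈⊕ {S = U₁ ─ z}))

        toA : ∀ {z} → z ∈ U₁ → a ∈ G z
        toA {z} zC = complete zC (a∈⊕ {S = U₁ ─ z ⊕ y})

      module _ {K} (s : Split (F' ─ y) K) where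
        module S₁ = Side s
        module S₂ = Side (split-∁ s)
        open Split s

        κ : Fin n → Cls
        κ i = if i == a then cA else if i == x then cC1 else if i == x' then cC2
              else if i == y then cB else if K i then cS1 else cS2

        -- The meaning of each value of `κ`; adjacency and disjointness of the classes then follow
        -- by matching on pairs of views.
        data View (i : Fin n) : Cls → Set where
          vA : i ≡ a → View i cA
          vC1 : i ≡ x → View i cC1
          vC2 : i ≡ x' → View i cC2
          vB : i ≡ y → View i cB
          vS1 : i ∈ S₁.U₁ → View i cS1
          vS2 : i ∈ S₂.U₁ → View i cS2

        eqF : ∀ {i j : Fin n} → (i == j) ≡ true → i ≡ j
        eqF {i} {j} h with ≟⊎ i j
        ... | inj₁ p = p
        ... | inj₂ p = ⊥-elim (absurdᵇ h (==-≢ p))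

        neF : ∀ {i j : Fin n} → (i == j) ≡ false → i ≢ j
        neF {i} h refl = absurdᵇ (≡ᵇ-refl (toℕ i)) h

        view : ∀ {i} → i ∈ U → View i (κ i)
        view {i} iU with i == a in ea
        ... | true = vA (eqF ea)
        ... | false with i == x in ex
        ...   | true = vC1 (eqF ex)
        ...   | false with i == x' in ex'
        ...     | true = vC2 (eqF ex')
        ...     | false with i == y in ey
        ...       | true = vB (eqF ey)
        ...       | false = go (K i) refl
          where
          iF : i ∈ F' ─ y
          iF = ─⁺ (F'⁺ iU (∉-intro λ p → [ neF ex , neF ex' ]′ (D⁻ p)) (neF ea)) (neF ey)
          go : ∀ b → K i ≡ b → View i (if b then cS1 else cS2)
          go true h = vS1 (∩⁺ iF (mem h))
          go false h = vS2 (∩⁺ iF (∁⁺ (nmem h)))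

        ab : Bool
        ab = G a y

        D≁ : ∀ {p q} → p ∈ D → q ∈ F' → G p q ≡ false
        D≁ pD qF = isFalse (proj₂ (apart' pD qF))

        F≁ : ∀ {p q} → p ∈ D → q ∈ F' → G q p ≡ false
        F≁ pD qF = trans (gsym _ _) (D≁ pD qF)

        adjV : ∀ {i j p q} → View i p → View j q → i ≢ j → G i j ≡ E ab p q
        adjV (vA refl) (vA refl) ne = ⊥-elim (ne refl)
        adjV (vA refl) (vC1 refl) _ = isTrue xa
        adjV (vA refl) (vC2 refl) _ = isTrue x'a
        adjV (vA refl) (vB refl) _ = sym (∨-identityʳ ab)
        adjV (vA refl) (vS1 q) _ = isTrue (~sym (S₁.toA q))
        adjV (vA refl) (vS2 q) _ = isTrue (~sym (S₂.toA q))
        adjV (vC1 refl) (vA refl) _ = isTrue (~sym xa)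
        adjV (vC1 refl) (vC1 refl) ne = ⊥-elim (ne refl)
        adjV (vC1 refl) (vC2 refl) _ = isTrue xx'
        adjV (vC1 refl) (vB refl) _ = D≁ xD yF
        adjV (vC1 refl) (vS1 q) _ = D≁ xD (S₁.inF q)
        adjV (vC1 refl) (vS2 q) _ = D≁ xD (S₁.inF q)
        adjV (vC2 refl) (vA refl) _ = isTrue (~sym x'a)
        adjV (vC2 refl) (vC1 refl) _ = isTrue (~sym xx')
        adjV (vC2 refl) (vC2 refl) ne = ⊥-elim (ne refl)
        adjV (vC2 refl) (vB refl) _ = D≁ x'D yF
        adjV (vC2 refl) (vS1 q) _ = D≁ x'D (S₁.inF q)
        adjV (vC2 refl) (vS2 q) _ = D≁ x'D (S₁.inF q)
        adjV (vB refl) (vA refl) _ = gsym y a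
        adjV (vB refl) (vC1 refl) _ = F≁ xD yF
        adjV (vB refl) (vC2 refl) _ = F≁ x'D yF
        adjV (vB refl) (vB refl) ne = ⊥-elim (ne refl)
        adjV (vB refl) (vS1 q) _ = isTrue (~sym (S₁.toY q))
        adjV (vB refl) (vS2 q) _ = isTrue (~sym (S₂.toY q))
        adjV (vS1 p) (vA refl) _ = isTrue (S₁.toA p)
        adjV (vS1 p) (vC1 refl) _ = F≁ xD (S₁.inF p)
        adjV (vS1 p) (vC2 refl) _ = F≁ x'D (S₁.inF p)
        adjV (vS1 p) (vB refl) _ = isTrue (S₁.toY p)
        adjV (vS1 p) (vS1 q) ne = isTrue (S₁.inside p q ne)
        adjV (vS1 p) (vS2 q) ne = isFalse (proj₂ (S₁.apart₁₂ p q))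
        adjV (vS2 p) (vA refl) _ = isTrue (S₂.toA p)
        adjV (vS2 p) (vC1 refl) _ = F≁ xD (S₁.inF p)
        adjV (vS2 p) (vC2 refl) _ = F≁ x'D (S₁.inF p)
        adjV (vS2 p) (vB refl) _ = isTrue (S₂.toY p)
        adjV (vS2 p) (vS1 q) ne = isFalse (≁sym (proj₂ (S₁.apart₁₂ q p)))
        adjV (vS2 p) (vS2 q) ne = isTrue (S₂.inside p q ne)

        onlyV : ∀ {i p} → View i p → p ≡ cS1 ⊎ p ≡ cS2 ⊎ i ≡ a ⊎ i ≡ y ⊎ i ≡ x ⊎ i ≡ x'
        onlyV (vA e) = inj₂ (inj₂ (inj₁ e))
        onlyV (vC1 e) = inj₂ (inj₂ (inj₂ (inj₂ (inj₁ e))))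
        onlyV (vC2 e) = inj₂ (inj₂ (inj₂ (inj₂ (inj₂ e))))
        onlyV (vB e) = inj₂ (inj₂ (inj₂ (inj₁ e)))
        onlyV (vS1 _) = inj₁ refl
        onlyV (vS2 _) = inj₂ (inj₁ refl)

        viewκ : ∀ {i p q} → View i p → View i q → p ≡ q
        viewκ (vA refl) (vA _) = refl
        viewκ (vA refl) (vC1 e) = ⊥-elim (~⇒≢ xa e)
        viewκ (vA refl) (vC2 e) = ⊥-elim (~⇒≢ x'a e)
        viewκ (vA refl) (vB refl) = ⊥-elim (proj₂ (proj₂ (F'⁻ yF)) refl)
        viewκ (vA refl) (vS1 q) = ⊥-elim (proj₂ (proj₂ (F'⁻ (S₁.inF q))) refl)
        viewκ (vA refl) (vS2 q) = ⊥-elim (proj₂ (proj₂ (F'⁻ (S₁.inF q))) refl)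
        viewκ (vC1 refl) (vA e) = ⊥-elim (~⇒≢ xa (sym e))
        viewκ (vC1 refl) (vC1 _) = refl
        viewκ (vC1 refl) (vC2 e) = ⊥-elim (~⇒≢ xx' e)
        viewκ (vC1 refl) (vB e) = ⊥-elim (proj₁ (apart' xD yF) e)
        viewκ (vC1 refl) (vS1 q) = ⊥-elim (proj₁ (apart' xD (S₁.inF q)) refl)
        viewκ (vC1 refl) (vS2 q) = ⊥-elim (proj₁ (apart' xD (S₁.inF q)) refl)
        viewκ (vC2 refl) (vA e) = ⊥-elim (~⇒≢ x'a (sym e))
        viewκ (vC2 refl) (vC1 e) = ⊥-elim (~⇒≢ xx' (sym e))
        viewκ (vC2 refl) (vC2 _) = refl
        viewκ (vC2 refl) (vB e) = ⊥-elim (proj₁ (apart' x'D yF) e)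
        viewκ (vC2 refl) (vS1 q) = ⊥-elim (proj₁ (apart' x'D (S₁.inF q)) refl)
        viewκ (vC2 refl) (vS2 q) = ⊥-elim (proj₁ (apart' x'D (S₁.inF q)) refl)
        viewκ (vB refl) (vA refl) = ⊥-elim (proj₂ (proj₂ (F'⁻ yF)) refl)
        viewκ (vB refl) (vC1 e) = ⊥-elim (proj₁ (apart' xD yF) (sym e))
        viewκ (vB refl) (vC2 e) = ⊥-elim (proj₁ (apart' x'D yF) (sym e))
        viewκ (vB refl) (vB _) = refl
        viewκ (vB refl) (vS1 q) = ⊥-elim (proj₂ (─⁻ (proj₁ (∩⁻ q))) refl)
        viewκ (vB refl) (vS2 q) = ⊥-elim (proj₂ (─⁻ (proj₁ (∩⁻ q))) refl)
        viewκ (vS1 p) (vA refl) = ⊥-elim (proj₂ (proj₂ (F'⁻ (S₁.inF p))) refl)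
        viewκ (vS1 p) (vC1 refl) = ⊥-elim (proj₁ (apart' xD (S₁.inF p)) refl)
        viewκ (vS1 p) (vC2 refl) = ⊥-elim (proj₁ (apart' x'D (S₁.inF p)) refl)
        viewκ (vS1 p) (vB refl) = ⊥-elim (proj₂ (─⁻ (proj₁ (∩⁻ p))) refl)
        viewκ (vS1 p) (vS1 _) = refl
        viewκ (vS1 p) (vS2 q) = ⊥-elim (proj₁ (S₁.apart₁₂ p q) refl)
        viewκ (vS2 p) (vA refl) = ⊥-elim (proj₂ (proj₂ (F'⁻ (S₁.inF p))) refl)
        viewκ (vS2 p) (vC1 refl) = ⊥-elim (proj₁ (apart' xD (S₁.inF p)) refl)
        viewκ (vS2 p) (vC2 refl) = ⊥-elim (proj₁ (apart' x'D (S₁.inF p)) refl)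
        viewκ (vS2 p) (vB refl) = ⊥-elim (proj₂ (─⁻ (proj₁ (∩⁻ p))) refl)
        viewκ (vS2 p) (vS1 q) = ⊥-elim (proj₁ (S₁.apart₁₂ q p) refl)
        viewκ (vS2 p) (vS2 _) = refl

        inU₁ : ∀ {K i} → i ∈ (F' ─ y) ∩ K → i ∈ U
        inU₁ p = proj₁ (∖⁻ (S₁.inF p))

        -- The hanging triangle supplies a, c₁ and c₂, the cut vertex y of F' becomes b, and its two
        -- sides are the cliques S₁ and S₂.
        result : HS U
        result = record
          { κ = κ ; ab = ab ; a = a ; b = y ; c₁ = x ; c₂ = x' ; k = u ; l = v
          ; aU = a∈U ; bU = proj₁ (∖⁻ yF) ; c₁U = D⊆U xD ; c₂U = D⊆U x'D ; kU = inU₁ uC ; lU = inU₁ S₁.vC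
          ; κa = viewκ (view a∈U) (vA refl) ; κb = viewκ (view (proj₁ (∖⁻ yF))) (vB refl)
          ; κc₁ = viewκ (view (D⊆U xD)) (vC1 refl) ; κc₂ = viewκ (view (D⊆U x'D)) (vC2 refl)
          ; κk = viewκ (view (inU₁ uC)) (vS1 uC) ; κl = viewκ (view (inU₁ S₁.vC)) (vS2 S₁.vC)
          ; only = λ iU → onlyV (view iU)
          ; adj = λ iU jU → adjV (view iU) (view jU) }
          where
          uC : u ∈ S₁.U₁
          uC = ∩⁺ uT uK

    triangleCase : Good U A ⊎ Exc U
    triangleCase with decNS connF'
    ... | inj₂ (y , yF , K , s) = inj₂ (isHS (TwoCliques.result yF s))
    ... | inj₁ ns with ≤-<-connex (# F') 2
    ...   | inj₁ le = inj₂ (isF5 (FiveVertices.result le))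
    ...   | inj₂ lt = inj₁ (good ns lt)

  apart-sym : ∀ {u v} → Apart u v → Apart v u
  apart-sym (p , q) = p ∘ sym , ≁sym q

  -- Tight vertices and one-vertex extensions of the exceptional graphs

  module HSFacts {U} (h : HS U) where
    open HS h public

    κ≢ : ∀ {i j p q} → κ i ≡ p → κ j ≡ q → p ≢ q → i ≢ j
    κ≢ refl refl ne refl = ne refl

    ~κ : ∀ {i j p q} → i ∈ U → j ∈ U → κ i ≡ p → κ j ≡ q → i ≢ j → E ab p q ≡ true → j ∈ G i
    ~κ iU jU refl refl ne e = mem (trans (adj iU jU ne) e)

    apartκ : ∀ {i j p q} → i ∈ U → j ∈ U → κ i ≡ p → κ j ≡ q → i ≢ j → E ab p q ≡ false → Apart i j
    apartκ iU jU refl refl ne e = ne , nmem (trans (adj iU jU ne) e)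

    K : VSet n
    K = U ∩ (is1 ∘ κ)

    K⁻ : ∀ {i} → i ∈ K → i ∈ U × κ i ≡ cS1
    K⁻ p = proj₁ (∩⁻ p) , is1⁻ (isTrue (proj₂ (∩⁻ p)))

    K⁺ : ∀ {i} → i ∈ U → κ i ≡ cS1 → i ∈ K
    K⁺ p e = ∩⁺ p (mem (cong is1 e))

    k∈K : k ∈ K
    k∈K = K⁺ kU κk

    a≢b : a ≢ b
    a≢b = κ≢ κa κb λ ()
    c₁≢c₂ : c₁ ≢ c₂
    c₁≢c₂ = κ≢ κc₁ κc₂ λ ()

    nbrs-c : ∀ {c c' i} → c ∈ U → κ c ≡ cC1 × c ≡ c₁ × c' ≡ c₂ ⊎ κ c ≡ cC2 × c ≡ c₂ × c' ≡ c₁ →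
             i ∈ U → i ∈ G c → i ∈ˡ a ∷ c' ∷ []
    nbrs-c cU which iU e with which | only iU
    ... | _ | inj₂ (inj₂ (inj₁ r)) = here r
    ... | inj₁ (q , refl , _) | inj₁ r = ⊥-elim (clash e (proj₂ (apartκ cU iU q r (κ≢ q r λ ()) refl)))
    ... | inj₁ (q , refl , _) | inj₂ (inj₁ r) = ⊥-elim (clash e (proj₂ (apartκ cU iU q r (κ≢ q r λ ()) refl)))
    ... | inj₁ (q , refl , _) | inj₂ (inj₂ (inj₂ (inj₁ refl))) = ⊥-elim (clash e (proj₂ (apartκ cU iU q κb (κ≢ q κb λ ()) refl)))
    ... | inj₁ (q , refl , _) | inj₂ (inj₂ (inj₂ (inj₂ (inj₁ refl)))) = ⊥-elim (clash e ≁irr)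
    ... | inj₁ (q , refl , refl) | inj₂ (inj₂ (inj₂ (inj₂ (inj₂ r)))) = there (here r)
    ... | inj₂ (q , refl , _) | inj₁ r = ⊥-elim (clash e (proj₂ (apartκ cU iU q r (κ≢ q r λ ()) refl)))
    ... | inj₂ (q , refl , _) | inj₂ (inj₁ r) = ⊥-elim (clash e (proj₂ (apartκ cU iU q r (κ≢ q r λ ()) refl)))
    ... | inj₂ (q , refl , _) | inj₂ (inj₂ (inj₂ (inj₁ refl))) = ⊥-elim (clash e (proj₂ (apartκ cU iU q κb (κ≢ q κb λ ()) refl)))
    ... | inj₂ (q , refl , refl) | inj₂ (inj₂ (inj₂ (inj₂ (inj₁ r)))) = there (here r)
    ... | inj₂ (q , refl , _) | inj₂ (inj₂ (inj₂ (inj₂ (inj₂ refl)))) = ⊥-elim (clash e ≁irr)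

    dc₁ : d U c₁ ≤ 2
    dc₁ = #-list≤ (a ∷ c₂ ∷ []) λ i p → nbrs-c c₁U (inj₁ (κc₁ , refl , refl)) (proj₁ (∩⁻ p)) (proj₂ (∩⁻ p))

    dc₂ : d U c₂ ≤ 2
    dc₂ = #-list≤ (a ∷ c₁ ∷ []) λ i p → nbrs-c c₂U (inj₂ (κc₂ , refl , refl)) (proj₁ (∩⁻ p)) (proj₂ (∩⁻ p))

    dK : ∀ {i} → i ∈ K → d U i ≤ suc (# K)
    dK {i} iK = ≤-trans (#-⊆ {S = U ∩ G i} {K ─ i ⊕ a ⊕ b} sub)
      (≤-trans #-⊕≤ (s≤s (≤-trans #-⊕≤ (≤-reflexive (sym (#-─ iK))))))
      where
      sub : ∀ j → j ∈ U ∩ G i → j ∈ K ─ i ⊕ a ⊕ b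
      sub j p with ∩⁻ p | K⁻ iK
      ... | jU , e | iU , q with only jU
      ...   | inj₁ r = ∪⁺ˡ (∪⁺ˡ (─⁺ (K⁺ jU r) λ { refl → clash e ≁irr }))
      ...   | inj₂ (inj₁ r) = ⊥-elim (clash e (proj₂ (apartκ iU jU q r (κ≢ q r λ ()) refl)))
      ...   | inj₂ (inj₂ (inj₁ refl)) = ∪⁺ˡ (a∈⊕ {S = K ─ i})
      ...   | inj₂ (inj₂ (inj₂ (inj₁ refl))) = a∈⊕ {S = K ─ i ⊕ a}
      ...   | inj₂ (inj₂ (inj₂ (inj₂ (inj₁ refl)))) = ⊥-elim (clash e (proj₂ (apartκ iU jU q κc₁ (κ≢ q κc₁ λ ()) refl)))
      ...   | inj₂ (inj₂ (inj₂ (inj₂ (inj₂ refl)))) = ⊥-elim (clash e (proj₂ (apartκ iU jU q κc₂ (κ≢ q κc₂ λ ()) refl)))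

    c₁K : ∀ {i} → i ∈ K → Apart c₁ i
    c₁K iK = apartκ c₁U (proj₁ (K⁻ iK)) κc₁ (proj₂ (K⁻ iK)) (κ≢ κc₁ (proj₂ (K⁻ iK)) λ ()) refl

    c₂K : ∀ {i} → i ∈ K → Apart c₂ i
    c₂K iK = apartκ c₂U (proj₁ (K⁻ iK)) κc₂ (proj₂ (K⁻ iK)) (κ≢ κc₂ (proj₂ (K⁻ iK)) λ ()) refl

    cliqueKa : ∀ {p q} → p ∈ K ⊕ a → q ∈ K ⊕ a → p ≢ q → q ∈ G p
    cliqueKa pK qK ne with ⊕⁻ pK | ⊕⁻ qK
    ... | inj₁ p | inj₁ q = ~κ (proj₁ (K⁻ p)) (proj₁ (K⁻ q)) (proj₂ (K⁻ p)) (proj₂ (K⁻ q)) ne refl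
    ... | inj₁ p | inj₂ refl = ~κ (proj₁ (K⁻ p)) aU (proj₂ (K⁻ p)) κa ne refl
    ... | inj₂ refl | inj₁ q = ~κ aU (proj₁ (K⁻ q)) κa (proj₂ (K⁻ q)) ne refl
    ... | inj₂ refl | inj₂ refl = ⊥-elim (ne refl)

    cliqueKb : ∀ {p q} → p ∈ K ⊕ b → q ∈ K ⊕ b → p ≢ q → q ∈ G p
    cliqueKb pK qK ne with ⊕⁻ pK | ⊕⁻ qK
    ... | inj₁ p | inj₁ q = ~κ (proj₁ (K⁻ p)) (proj₁ (K⁻ q)) (proj₂ (K⁻ p)) (proj₂ (K⁻ q)) ne refl
    ... | inj₁ p | inj₂ refl = ~κ (proj₁ (K⁻ p)) bU (proj₂ (K⁻ p)) κb ne refl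
    ... | inj₂ refl | inj₁ q = ~κ bU (proj₁ (K⁻ q)) κb (proj₂ (K⁻ q)) ne refl
    ... | inj₂ refl | inj₂ refl = ⊥-elim (ne refl)

  -- `HS` does not order the cliques, so each fact about S₁ yields the one about S₂; the condition s
  -- ≤ t is restored only in the final translation.
  swapHS : ∀ {U} → HS U → HS U
  swapHS h = record
    { κ = sw ∘ κ ; ab = ab ; a = a ; b = b ; c₁ = c₁ ; c₂ = c₂ ; k = l ; l = k
    ; aU = aU ; bU = bU ; c₁U = c₁U ; c₂U = c₂U ; kU = lU ; lU = kU
    ; κa = cong sw κa ; κb = cong sw κb ; κc₁ = cong sw κc₁ ; κc₂ = cong sw κc₂ ; κk = cong sw κl ; κl = cong sw κk
    ; only = λ iU → flip (only iU)
    ; adj = λ iU jU ne → trans (adj iU jU ne) (sym (E-sw ab (κ _) (κ _))) }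
    where
    open HS h
    flip : ∀ {i} {R : Set} → κ i ≡ cS1 ⊎ κ i ≡ cS2 ⊎ R → sw (κ i) ≡ cS1 ⊎ sw (κ i) ≡ cS2 ⊎ R
    flip (inj₁ e) = inj₂ (inj₁ (cong sw e))
    flip (inj₂ (inj₁ e)) = inj₁ (cong sw e)
    flip (inj₂ (inj₂ r)) = inj₂ (inj₂ r)

  module HSBoth {U} (h : HS U) where
    open HSFacts h public
    module S = HSFacts (swapHS h)

    L : VSet n
    L = S.K

    L⁻ : ∀ {i} → i ∈ L → i ∈ U × κ i ≡ cS2
    L⁻ {i} p = proj₁ (S.K⁻ p) , back (proj₂ (S.K⁻ p))
      where
      back : ∀ {p} → sw p ≡ cS1 → p ≡ cS2
      back {cS2} _ = refl

    l∈L : l ∈ L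
    l∈L = S.k∈K

    KL : VSet n
    KL = K ∪ L

    notKL : ∀ {i p} → κ i ≡ p → p ≢ cS1 → p ≢ cS2 → i ∉ KL
    notKL refl n₁ n₂ = ∉-intro λ q → [ (λ r → n₁ (proj₂ (K⁻ r))) , (λ r → n₂ (proj₂ (L⁻ r))) ]′ (∪⁻ q)

    order≥ : # K + # L + 4 ≤ # U
    order≥ = ≤-trans (≤-reflexive (+-comm _ 4)) (≤-trans (s≤s (s≤s (s≤s (s≤s
        (#-disj {S = K} {L} {KL} (λ _ → ∪⁺ˡ) (λ i → ∪⁺ʳ {S = K}) (λ i p q → absurd (proj₂ (K⁻ p)) (proj₂ (L⁻ q))))))))
      (≤-trans (≤-reflexive (sym count)) (#-⊆ sub)))
      where
      absurd : ∀ {p} → p ≡ cS1 → p ≡ cS2 → ⊥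
      absurd refl ()
      Z : VSet n
      Z = KL ⊕ a ⊕ b ⊕ c₁ ⊕ c₂
      count : # Z ≡ 4 + # KL
      count = trans (#-⊕ (⊕∉ (⊕∉ (⊕∉ (notKL κc₂ (λ ()) (λ ())) (κ≢ κc₂ κa λ ())) (κ≢ κc₂ κb λ ())) (κ≢ κc₂ κc₁ λ ())))
        (cong suc (trans (#-⊕ (⊕∉ (⊕∉ (notKL κc₁ (λ ()) (λ ())) (κ≢ κc₁ κa λ ())) (κ≢ κc₁ κb λ ())))
        (cong suc (trans (#-⊕ (⊕∉ (notKL κb (λ ()) (λ ())) (κ≢ κb κa λ ())))
        (cong suc (#-⊕ (notKL κa (λ ()) (λ ()))))))))
      sub : ∀ i → i ∈ Z → i ∈ U
      sub i p with ⊕⁻ p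
      ... | inj₂ refl = c₂U
      ... | inj₁ p₁ with ⊕⁻ p₁
      ...   | inj₂ refl = c₁U
      ...   | inj₁ p₂ with ⊕⁻ p₂
      ...     | inj₂ refl = bU
      ...     | inj₁ p₃ with ⊕⁻ p₃
      ...       | inj₂ refl = aU
      ...       | inj₁ p₄ = [ (λ q → proj₁ (K⁻ q)) , (λ q → proj₁ (L⁻ q)) ]′ (∪⁻ p₄)

    -- All of U except c₁ and c₂, written as a union of two cliques so that `glue` applies with the
    -- disjoint edges al and kb.
    Q : VSet n
    Q = (K ⊕ a) ∪ (L ⊕ b)

    Q⁻ : ∀ {i} → i ∈ Q → i ∈ U × i ≢ c₁ × i ≢ c₂
    Q⁻ p with ∪⁻ p
    Q⁻ p | inj₁ q with ⊕⁻ q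
    ... | inj₁ r = proj₁ (K⁻ r) , κ≢ (proj₂ (K⁻ r)) κc₁ (λ ()) , κ≢ (proj₂ (K⁻ r)) κc₂ (λ ())
    ... | inj₂ refl = aU , κ≢ κa κc₁ (λ ()) , κ≢ κa κc₂ (λ ())
    Q⁻ p | inj₂ q with ⊕⁻ q
    ... | inj₁ r = proj₁ (L⁻ r) , κ≢ (proj₂ (L⁻ r)) κc₁ (λ ()) , κ≢ (proj₂ (L⁻ r)) κc₂ (λ ())
    ... | inj₂ refl = bU , κ≢ κb κc₁ (λ ()) , κ≢ κb κc₂ (λ ())

    a∈Q : a ∈ Q
    a∈Q = ∪⁺ˡ (a∈⊕ {S = K})

    Q⁺ : ∀ {i} → i ∈ U → i ≢ c₁ → i ≢ c₂ → i ∈ Q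
    Q⁺ iU n₁ n₂ with only iU
    ... | inj₁ r = ∪⁺ˡ (∪⁺ˡ (K⁺ iU r))
    ... | inj₂ (inj₁ r) = ∪⁺ʳ {S = K ⊕ a} (∪⁺ˡ (S.K⁺ iU (cong sw r)))
    ... | inj₂ (inj₂ (inj₁ refl)) = a∈Q
    ... | inj₂ (inj₂ (inj₂ (inj₁ refl))) = ∪⁺ʳ {S = K ⊕ a} (a∈⊕ {S = L})
    ... | inj₂ (inj₂ (inj₂ (inj₂ (inj₁ e)))) = ⊥-elim (n₁ e)
    ... | inj₂ (inj₂ (inj₂ (inj₂ (inj₂ e)))) = ⊥-elim (n₂ e)

    nsQ : NS Q
    nsQ = glue (clique cliqueKa) (clique S.cliqueKb) (a∈⊕ {S = K}) (∪⁺ˡ k∈K) (∪⁺ˡ l∈L) (a∈⊕ {S = L})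
      (~κ aU lU κa κl (κ≢ κa κl λ ()) refl) (~κ kU bU κk κb (κ≢ κk κb λ ()) refl)
      (κ≢ κa κk λ ()) (κ≢ κl κb λ ()) a≢b (κ≢ κk κl λ ())

    #Q : 3 ≤ # Q
    #Q = #-list≥ {l = a ∷ k ∷ l ∷ []} ((κ≢ κa κk (λ ()) ∷ κ≢ κa κl (λ ()) ∷ []) ∷ (κ≢ κk κl (λ ()) ∷ []) ∷ [] ∷ [])
      (a∈Q ∷ ∪⁺ˡ (∪⁺ˡ k∈K) ∷ ∪⁺ʳ {S = K ⊕ a} (∪⁺ˡ l∈L) ∷ [])

    a~c₁ : c₁ ∈ G a
    a~c₁ = ~κ aU c₁U κa κc₁ (κ≢ κa κc₁ λ ()) refl

    c₁~c₂ : c₂ ∈ G c₁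
    c₁~c₂ = ~κ c₁U c₂U κc₁ κc₂ c₁≢c₂ refl

    -- The triangle z, c₁, c₂ is tied to `Q` by the disjoint edges c₁a and zu. If z saw nothing of
    -- `Q` but a, then a would cut off this triangle.
    extHS : ∀ {z u} → z ∉ U → c₁ ∈ G z → c₂ ∈ G z → u ∈ Q → u ≢ a → u ∈ G z → NS (U ⊕ z)
    extHS {z} {u} zU e₁ e₂ uQ ua eu = ns-resp (f , g)
        (glue (triangle e₁ e₂ c₁~c₂) nsQ (tri₂ {z}) (tri₁ {z}) a∈Q uQ (~sym a~c₁) eu
          (~⇒≢ e₁ ∘ sym) (ua ∘ sym) (proj₁ (proj₂ (Q⁻ uQ)) ∘ sym) (λ { refl → clash aU zU }))
      where
      f : ∀ {i} → i ∈ Tri z c₁ c₂ ∪ Q → i ∈ U ⊕ z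
      f p with ∪⁻ p
      ... | inj₂ q = ∪⁺ˡ (proj₁ (Q⁻ q))
      ... | inj₁ q with tri⁻ q
      ...   | inj₁ refl = a∈⊕ {S = U}
      ...   | inj₂ (inj₁ refl) = ∪⁺ˡ c₁U
      ...   | inj₂ (inj₂ refl) = ∪⁺ˡ c₂U
      g : ∀ {i} → i ∈ U ⊕ z → i ∈ Tri z c₁ c₂ ∪ Q
      g {i} p with ⊕⁻ p | ≟⊎ i c₁ | ≟⊎ i c₂
      ... | inj₂ refl | _ | _ = ∪⁺ˡ (tri₁ {z} {c₁} {c₂})
      ... | inj₁ q | inj₁ refl | _ = ∪⁺ˡ (tri₂ {z} {c₁} {c₂})
      ... | inj₁ q | inj₂ _ | inj₁ refl = ∪⁺ˡ (tri₃ {z} {c₁} {c₂})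
      ... | inj₁ q | inj₂ r | inj₂ s = ∪⁺ʳ {S = Tri z c₁ c₂} (Q⁺ q r s)

    light-ck : ∀ {c} → d U c ≤ 2 → w U (c ∷ k ∷ []) < # U
    light-ck {c} h = ≤-trans (hs-tight-light {d U c} h (dK k∈K) (#-pos l∈L)) order≥

    -- The pair c₁, k weighs at most 2 + (|K| + 1), which is below |K| + |L| + 4, and d(c₁) ≤ 2.
    tight₁ : Tight U c₁
    tight₁ = c₁ ∷ k ∷ [] , (c₁K k∈K ∷ []) ∷ [] ∷ [] , c₁U ∷ kU ∷ [] , light-ck dc₁ , here refl , dc₁

    tight₂ : Tight U c₂
    tight₂ = c₂ ∷ k ∷ [] , (c₂K k∈K ∷ []) ∷ [] ∷ [] , c₂U ∷ kU ∷ [] , light-ck dc₂ , here refl , dc₂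

  module F5Facts {U} (f : Emb U F5) where
    open Emb f public

    e≁ : Apart (e 1F) (e 3F)
    e≁ = emb-apart 1F 3F refl λ ()

    low : ∀ i → d U (e (suc i)) ≤ 2
    low i = ≤-trans (emb-d (suc i)) (#-F5 i)

    -- Two noncentral vertices of F₅ weigh at most 4, which is less than 5.
    tight-pair : ∀ i j → F5 (suc i) (suc j) ≡ false → i ≢ j → Tight U (e (suc i))
    tight-pair i j h ne = e (suc i) ∷ e (suc j) ∷ [] , (emb-apart (suc i) (suc j) h (λ { refl → ne refl }) ∷ []) ∷ [] ∷ []
      , inU (suc i) ∷ inU (suc j) ∷ [] , ≤-trans (f5-tight-light {d U (e (suc i))} (low i) (low j)) emb-# , here refl , low i

    tight : ∀ i → Tight U (e (suc i))
    tight 0F = tight-pair 0F 2F refl λ ()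
    tight 1F = tight-pair 1F 2F refl λ ()
    tight 2F = tight-pair 2F 0F refl λ ()
    tight 3F = tight-pair 3F 0F refl λ ()

    -- Two triangles, one through z and one through the centre, tied by an edge from z into the
    -- second and an edge from the first to the centre.
    extF5 : ∀ {z} → z ∉ U → e 1F ∈ G z → e 2F ∈ G z → e 3F ∈ G z → NS (U ⊕ z)
    extF5 {z} zU z₁ z₂ z₃ = ns-resp (f' , g)
        (glue (triangle z₁ z₂ (emb~ 1F 2F refl)) (triangle (emb~ 0F 3F refl) (emb~ 0F 4F refl) (emb~ 3F 4F refl))
          (tri₁ {z}) (tri₂ {z}) (tri₂ {e 0F}) (tri₁ {e 0F}) z₃ (emb~ 1F 0F refl)
          (~⇒≢ z₁) (≢e 3F 0F λ ()) z≢ (≢e 1F 3F λ ()))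
      where
      ≢e : ∀ i j → i ≢ j → e i ≢ e j
      ≢e i j ne p = ne (inj i j p)
      z≢ : z ≢ e 0F
      z≢ refl = clash (inU 0F) zU
      f' : ∀ {i} → i ∈ Tri z (e 1F) (e 2F) ∪ Tri (e 0F) (e 3F) (e 4F) → i ∈ U ⊕ z
      f' p with ∪⁻ p
      f' p | inj₁ q with tri⁻ q
      ... | inj₁ refl = a∈⊕ {S = U}
      ... | inj₂ (inj₁ refl) = ∪⁺ˡ (inU 1F)
      ... | inj₂ (inj₂ refl) = ∪⁺ˡ (inU 2F)
      f' p | inj₂ q with tri⁻ q
      ... | inj₁ refl = ∪⁺ˡ (inU 0F)
      ... | inj₂ (inj₁ refl) = ∪⁺ˡ (inU 3F)
      ... | inj₂ (inj₂ refl) = ∪⁺ˡ (inU 4F)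
      g : ∀ {i} → i ∈ U ⊕ z → i ∈ Tri z (e 1F) (e 2F) ∪ Tri (e 0F) (e 3F) (e 4F)
      g p with ⊕⁻ p
      ... | inj₂ refl = ∪⁺ˡ (tri₁ {z} {e 1F} {e 2F})
      ... | inj₁ q with onto q
      ...   | 0F , refl = ∪⁺ʳ {S = Tri z (e 1F) (e 2F)} (tri₁ {e 0F} {e 3F} {e 4F})
      ...   | 1F , refl = ∪⁺ˡ (tri₂ {z} {e 1F} {e 2F})
      ...   | 2F , refl = ∪⁺ˡ (tri₃ {z} {e 1F} {e 2F})
      ...   | 3F , refl = ∪⁺ʳ {S = Tri z (e 1F) (e 2F)} (tri₂ {e 0F} {e 3F} {e 4F})
      ...   | 4F , refl = ∪⁺ʳ {S = Tri z (e 1F) (e 2F)} (tri₃ {e 0F} {e 3F} {e 4F})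

  tightK2 : ∀ {U} (f : Emb U K2) → ∀ i → Tight U (Emb.e f i)
  tightK2 {U} f i = e i ∷ [] , [] ∷ [] , inU i ∷ [] , ≤-trans (s≤s (≤-trans (≤-reflexive (+-identityʳ _)) l)) emb-# , here refl , l
    where
    open Emb f
    l : d U (e i) ≤ 1
    l = ≤-trans (emb-d i) (#-K2 i)

  tightBig : ∀ {U} (b : Big U) → Tight U (Big.v₁ b) × Tight U (Big.v₂ b) × Tight U (Big.v₃ b)
  tightBig {U} b = (J , indep , inU , lt , here refl , low₁) , (J , indep , inU , lt , there (here refl) , low₂)
      , (J , indep , inU , lt , there (there (here refl)) , low₃)
    where
    open Big b
    J = v₁ ∷ v₂ ∷ v₃ ∷ []
    lt : w U J < # U
    lt = ≤-trans (big-tight-light {d U v₁} low₁ low₂ low₃) large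

  -- Every exceptional graph has two tight vertices. The vertex to be avoided is usually the cut
  -- vertex, whose degree may change when D is removed while those of the others do not.
  tight≢ : ∀ {U} → Exc U → ∀ z → ∃ λ v → Tight U v × v ≢ z
  tight≢ {U} x z = two x
    where
    choose : ∀ {u v} → Tight U u → Tight U v → u ≢ v → ∃ λ v → Tight U v × v ≢ z
    choose {u} {v} tu tv ne with ≟⊎ u z
    ... | inj₁ refl = v , tv , ne ∘ sym
    ... | inj₂ p = u , tu , p
    two : Exc U → ∃ λ v → Tight U v × v ≢ z
    two (isK2 f) = choose (tightK2 f 0F) (tightK2 f 1F) (~⇒≢ (Emb.emb~ f 0F 1F refl))
    two (isF5 f) = choose (F5Facts.tight f 0F) (F5Facts.tight f 2F) (proj₁ (F5Facts.e≁ f))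
    two (isHS h) = choose (HSBoth.tight₁ h) (HSBoth.tight₂ h) (HSFacts.c₁≢c₂ h)
    two (isBig b) = choose (proj₁ (tightBig b)) (proj₁ (proj₂ (tightBig b))) (first (Big.indep b))
      where
      first : ∀ {u v J} → Indep (u ∷ v ∷ J) → u ≢ v
      first (((p , _) ∷ _) ∷ _) = p

  -- Two sides of a cut vertex

  -- The symmetric form of a lobe, in which neither side is defined as the complement of the other.
  record Two (U : VSet n) (a : Fin n) (P Q : VSet n) : Set where
    field
      P⊆U : P ⊆ U
      Q⊆U : Q ⊆ U
      a∈U : a ∈ U
      a∉P : a ∉ P
      a∉Q : a ∉ Q
      cover : ∀ {i} → i ∈ U → i ∈ P ⊎ i ∈ Q ⊎ i ≡ a
      apart : ∀ {p q} → p ∈ P → q ∈ Q → Apart p q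
      dP : ∀ {v} → v ∈ P → d U v ≤ suc (d P v)
      dQ : ∀ {v} → v ∈ Q → d U v ≤ suc (d Q v)
      dP≁ : ∀ {v} → v ∈ P → v ∉ G a → d U v ≤ d P v
      dQ≁ : ∀ {v} → v ∈ Q → v ∉ G a → d U v ≤ d Q v
      sizes : # U ≡ suc (# P) + # Q

  two : ∀ {U a D} (L : Lobe U a D) → Two U a D (LobeFacts.F' L)
  two {U} {a} {D} L = record { P⊆U = D⊆U ; Q⊆U = λ p → proj₁ (∖⁻ p) ; a∈U = a∈U ; a∉P = a∉D
    ; a∉Q = ∉-intro λ p → proj₂ (proj₂ (F'⁻ p)) refl ; cover = cov ; apart = apart'
    ; dP = dD+ ; dQ = dF' ; dP≁ = dD≁ ; dQ≁ = dF'≁ ; sizes = #U-B }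
    where
    open LobeFacts L
    cov : ∀ {i} → i ∈ U → i ∈ D ⊎ i ∈ F' ⊎ i ≡ a
    cov {i} iU with split D i | ≟⊎ i a
    ... | inj₁ p | _ = inj₁ p
    ... | inj₂ p | inj₁ q = inj₂ (inj₂ q)
    ... | inj₂ p | inj₂ q = inj₂ (inj₁ (F'⁺ iU p q))

  swapTwo : ∀ {U a P Q} → Two U a P Q → Two U a Q P
  swapTwo {P = P} {Q} t = record { P⊆U = Q⊆U ; Q⊆U = P⊆U ; a∈U = a∈U ; a∉P = a∉Q ; a∉Q = a∉P
    ; cover = λ p → [ (λ q → inj₂ (inj₁ q)) , [ inj₁ , (λ q → inj₂ (inj₂ q)) ]′ ]′ (cover p)
    ; apart = λ p q → apart-sym (apart q p) ; dP = dQ ; dQ = dP ; dP≁ = dQ≁ ; dQ≁ = dP≁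
    ; sizes = trans sizes (cong suc (+-comm (# P) (# Q))) }
    where open Two t

  -- The common features of F₅ and H_{s,t} that exclude them opposite a `Big` graph.
  record Weak (P : VSet n) : Set where
    field
      c : Fin n
      cP : c ∈ P
      dc : d P c ≤ 2
      five : 5 ≤ # P

  weakF5 : ∀ {P} → Emb P F5 → Weak P
  weakF5 f = record { c = e 1F ; cP = inU 1F ; dc = low 0F ; five = emb-# }
    where open F5Facts f

  weakHS : ∀ {P} → HS P → Weak P
  weakHS h = record { c = c₁ ; cP = c₁U ; dc = dc₁ ; five = ≤-trans (hs-order (#-pos k∈K)) order≥ }
    where open HSBoth h

  module _ {U a P Q} (t : Two U a P Q) (hyp : HypE U) where
    open Two t

    -- Four independent vertices weigh at most 3 + 3 · 4 in a graph of order at least 1 + 11 + 5,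
    -- but c has degree at most 3.
    big-weak : Big P → Weak Q → ⊥
    big-weak b k = <-irrefl refl (≤-trans (hyp {c ∷ v₁ ∷ v₂ ∷ v₃ ∷ []} (All.map (λ p → apart-sym (apart p cP)) inU ∷ indep)
        (Q⊆U cP ∷ All.map P⊆U inU) (light inU) (here refl)) (≤-trans (dQ cP) (s≤s dc)))
      where
      open Big b
      open Weak k
      light : All (_∈ P) (v₁ ∷ v₂ ∷ v₃ ∷ []) → w U (c ∷ v₁ ∷ v₂ ∷ v₃ ∷ []) < # U
      light (p₁ ∷ p₂ ∷ p₃ ∷ []) = ≤-trans (big-weak-light {d U c}
        (≤-trans (dQ cP) (s≤s dc)) (≤-trans (dP p₁) (s≤s low₁)) (≤-trans (dP p₂) (s≤s low₂)) (≤-trans (dP p₃) (s≤s low₃)) large five) (≤-reflexive (sym sizes))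

    -- Five independent vertices of degree at most 4 weigh at most 20, while the order is at least
    -- 23.
    big-big : Big P → Big Q → ⊥
    big-big b k with Big.inU b | Big.inU k | Big.indep k
    ... | p₁ ∷ p₂ ∷ p₃ ∷ [] | q₁ ∷ q₂ ∷ q₃ ∷ [] | (r ∷ _) ∷ _ =
      <-irrefl refl (≤-trans (hyp {k.v₁ ∷ k.v₂ ∷ b.v₁ ∷ b.v₂ ∷ b.v₃ ∷ []}
        ((r ∷ All.map (λ p → apart-sym (apart p q₁)) b.inU) ∷ All.map (λ p → apart-sym (apart p q₂)) b.inU ∷ b.indep)
        (Q⊆U q₁ ∷ Q⊆U q₂ ∷ All.map P⊆U b.inU)
        (≤-trans (big-big-light {d U k.v₁} (up (dQ q₁) k.low₁) (up (dQ q₂) k.low₂) (up (dP p₁) b.low₁)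
          (up (dP p₂) b.low₂) (up (dP p₃) b.low₃) b.large k.large) (≤-reflexive (sym sizes))) (here refl)) (up (dQ q₁) k.low₁))
      where
      module b = Big b
      module k = Big k
      up : ∀ {x y m} → x ≤ suc y → y ≤ m → x ≤ suc m
      up p q = ≤-trans p (s≤s q)

    -- The vertices c₁ and k of both sides weigh at most |K| + |K'| + 10, one less than the order
    -- must be, but c₁ has degree at most 3.
    hs-hs : HS P → HS Q → ⊥
    hs-hs h g = <-irrefl refl (≤-trans (hyp {h.c₁ ∷ h.k ∷ g.c₁ ∷ g.k ∷ []}
        ((h.c₁K h.k∈K ∷ apart h.c₁U g.c₁U ∷ apart h.c₁U g.kU ∷ []) ∷ (apart h.kU g.c₁U ∷ apart h.kU g.kU ∷ []) ∷ (g.c₁K g.k∈K ∷ []) ∷ [] ∷ [])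
        (P⊆U h.c₁U ∷ P⊆U h.kU ∷ Q⊆U g.c₁U ∷ Q⊆U g.kU ∷ [])
        (≤-trans (hs-hs-light {d U h.c₁} (up (dP h.c₁U) h.dc₁) (up (dP h.kU) (h.dK h.k∈K)) (up (dQ g.c₁U) g.dc₁) (up (dQ g.kU) (g.dK g.k∈K))
          (#-pos h.l∈L) (#-pos g.l∈L) h.order≥ g.order≥) (≤-reflexive (sym sizes))) (here refl)) (up (dP h.c₁U) h.dc₁))
      where
      module h = HSBoth h
      module g = HSBoth g
      up : ∀ {x y m} → x ≤ suc y → y ≤ m → x ≤ suc m
      up p q = ≤-trans p (s≤s q)

    module _ (f : Emb P F5) (tP : ∀ {v} → Tight P v → v ∈ G a) where
      open F5Facts f

      module _ {m} {HQ : Adj m} (q : Emb Q HQ) {rP : Fin 5 → Bool} {rQ : Fin m → Bool}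
          (aP : ∀ i → G a (e i) ≡ rP i) (aQ : ∀ i → G a (Emb.e q i) ≡ rQ i) where
        module q = Emb q

        place : Pos m → Fin n
        place pa = a
        place (pP i) = e i
        place (pQ i) = q.e i

        place∈U : ∀ p → place p ∈ U
        place∈U pa = a∈U
        place∈U (pP i) = P⊆U (inU i)
        place∈U (pQ i) = Q⊆U (q.inU i)

        place-adj : ∀ s t → G (place s) (place t) ≡ join rP rQ HQ s t
        place-adj pa pa = girr a
        place-adj pa (pP i) = aP i
        place-adj pa (pQ i) = aQ i
        place-adj (pP i) pa = trans (gsym _ _) (aP i)
        place-adj (pP i) (pP j) = adj i j
        place-adj (pP i) (pQ j) = isFalse (proj₂ (apart (inU i) (q.inU j)))
        place-adj (pQ i) pa = trans (gsym _ _) (aQ i)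
        place-adj (pQ i) (pP j) = trans (gsym _ _) (isFalse (proj₂ (apart (inU j) (q.inU i))))
        place-adj (pQ i) (pQ j) = q.adj i j

        place-inj : ∀ s t → place s ≡ place t → s ≡ t
        place-inj pa pa _ = refl
        place-inj pa (pP i) h = ⊥-elim (clash (subst (_∈ P) (sym h) (inU i)) a∉P)
        place-inj pa (pQ i) h = ⊥-elim (clash (subst (_∈ Q) (sym h) (q.inU i)) a∉Q)
        place-inj (pP i) pa h = ⊥-elim (clash (subst (_∈ P) h (inU i)) a∉P)
        place-inj (pP i) (pP j) h = cong pP (inj i j h)
        place-inj (pP i) (pQ j) h = ⊥-elim (proj₁ (apart (inU i) (q.inU j)) h)
        place-inj (pQ i) pa h = ⊥-elim (clash (subst (_∈ Q) h (q.inU i)) a∉Q)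
        place-inj (pQ i) (pP j) h = ⊥-elim (proj₁ (apart (inU j) (q.inU i)) (sym h))
        place-inj (pQ i) (pQ j) h = cong pQ (q.inj i j h)

        place-onto : ∀ {u} → u ∈ U → ∃ λ s → place s ≡ u
        place-onto uU with cover uU
        ... | inj₁ p = let i , h = onto p in pP i , h
        ... | inj₂ (inj₁ p) = let i , h = q.onto p in pQ i , h
        ... | inj₂ (inj₂ p) = pa , sym p

        embed : ∀ {N} (H : Adj N) (pos : Fin N → Pos m) (idx : Pos m → Fin N) → (∀ i → idx (pos i) ≡ i) →
                (∀ s → pos (idx s) ≡ s) → (∀ i j → H i j ≡ join rP rQ HQ (pos i) (pos j)) → Emb U H
        embed H pos idx ip pi h = record
          { e = place ∘ pos
          ; inj = λ i j p → trans (sym (ip i)) (trans (cong idx (place-inj (pos i) (pos j) p)) (ip j))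
          ; inU = place∈U ∘ pos
          ; onto = λ p → let s , h = place-onto p in idx s , trans (cong place (pi s)) h
          ; adj = λ i j → trans (place-adj (pos i) (pos j)) (sym (h i j)) }

      -- One vertex t of Q and one vertex from each triangle of F₅ are independent; each had degree
      -- at most 2 and gains at most the edge to `a`. The order is at least 1 + 5 + 5.
      mkBig : ∀ {t} → t ∈ Q → d Q t ≤ 2 → t ∈ G a → NS (Q ⊕ a) → 5 ≤ # Q →
              (∃ λ l₁ → ∃ λ l₂ → Emb U (F11 l₁ l₂))
                ⊎ (∃ λ l₁ → ∃ λ l₂ → ∃ λ l₃ → ∃ λ l₄ → T (l₃ ∨ l₄) × Emb U (F12 l₁ l₂ l₃ l₄)) → Big U
      mkBig {t} tQ dt ta nsQ five fin = record
        { v₁ = t ; v₂ = e 1F ; v₃ = e 3F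
        ; indep = indep 0F 2F e≁
        ; inU = inU' 0F 2F
        ; low₁ = lowt ; low₂ = lowβ 0F ; low₃ = lowβ 2F
        ; large = large ; ext = ext' ; final = fin }
        where
        inU' : ∀ i j → All (_∈ U) (t ∷ e (suc i) ∷ e (suc j) ∷ [])
        inU' i j = Q⊆U tQ ∷ P⊆U (inU (suc i)) ∷ P⊆U (inU (suc j)) ∷ []
        indep : ∀ i j → Apart (e (suc i)) (e (suc j)) → Indep (t ∷ e (suc i) ∷ e (suc j) ∷ [])
        indep i j h = (apart-sym (apart (inU _) tQ) ∷ apart-sym (apart (inU _) tQ) ∷ []) ∷ (h ∷ []) ∷ [] ∷ []
        lowt : d U t ≤ 3
        lowt = ≤-trans (dQ tQ) (s≤s dt)
        lowβ : ∀ i → d U (e (suc i)) ≤ 3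
        lowβ i = ≤-trans (dP (inU _)) (s≤s (low i))
        large : 11 ≤ # U
        large = ≤-trans (s≤s (emb-# ⊞ five)) (≤-reflexive (sym sizes))
        light : ∀ i j → w U (t ∷ e (suc i) ∷ e (suc j) ∷ []) < # U
        light i j = ≤-trans (big-tight-light {d U t} lowt (lowβ i) (lowβ j)) large
        tgt : Tight U t
        tgt = _ , indep 0F 2F e≁ , inU' 0F 2F , light 0F 2F , here refl , lowt
        tg : ∀ i j → Apart (e (suc i)) (e (suc j)) → Tight U (e (suc i))
        tg i j h = _ , indep i j h , inU' i j , light i j , there (here refl) , lowβ i
        ext' : ∀ {z} → z ∉ U → (∀ {v} → Tight U v → v ∈ G z) → NS (U ⊕ z)
        -- The vertex `a` goes with Q and z goes with P; the edges from `a` to `e 1F` and from t to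
        -- z tie the two sets together.
        ext' {z} zU tz = ns-resp (f' , g)
            (glue nsQ (extF5 (∉-intro λ p → clash (P⊆U p) zU) (tz (tg 0F 2F e≁)) (tz (tg 1F 2F (emb-apart 2F 3F refl λ ())))
                (tz (tg 2F 0F (apart-sym e≁))))
              (a∈⊕ {S = Q}) (∪⁺ˡ tQ) (∪⁺ˡ (inU 1F)) (a∈⊕ {S = P}) (tP (tight 0F)) (~sym (tz tgt))
              (λ { refl → clash tQ a∉Q }) (λ p → clash (subst (_∈ U) p (P⊆U (inU 1F))) zU)
              (λ { refl → clash a∈U zU }) (λ p → proj₁ (apart (inU 1F) tQ) (sym p)))
          where
          f' : ∀ {i} → i ∈ (Q ⊕ a) ∪ (P ⊕ z) → i ∈ U ⊕ z
          f' p with ∪⁻ p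
          f' p | inj₁ q with ⊕⁻ q
          ... | inj₁ r = ∪⁺ˡ (Q⊆U r)
          ... | inj₂ refl = ∪⁺ˡ a∈U
          f' p | inj₂ q with ⊕⁻ q
          ... | inj₁ r = ∪⁺ˡ (P⊆U r)
          ... | inj₂ refl = a∈⊕ {S = U}
          g : ∀ {i} → i ∈ U ⊕ z → i ∈ (Q ⊕ a) ∪ (P ⊕ z)
          g p with ⊕⁻ p
          ... | inj₂ refl = ∪⁺ʳ {S = Q ⊕ a} (a∈⊕ {S = P})
          ... | inj₁ q with cover q
          ...   | inj₁ r = ∪⁺ʳ {S = Q ⊕ a} (∪⁺ˡ r)
          ...   | inj₂ (inj₁ r) = ∪⁺ˡ (∪⁺ˡ r)
          ...   | inj₂ (inj₂ refl) = ∪⁺ˡ (a∈⊕ {S = Q})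

      row : (∀ i → e (suc i) ∈ G a) → ∀ i → G a (e i) ≡ hub (G a (e 0F)) i
      row h 0F = refl
      row h (suc i) = isTrue (h i)

      f5-f5 : Emb Q F5 → (∀ {v} → Tight Q v → v ∈ G a) → Big U
      f5-f5 q tQ = mkBig (g.inU 1F) (g.low 0F) (tQ (g.tight 0F)) (g.extF5 a∉Q (tQ (g.tight 0F)) (tQ (g.tight 1F)) (tQ (g.tight 2F))) g.emb-#
          (inj₁ (l₁ , l₂ , embed q (row (λ i → tP (tight i))) rowQ (F11 l₁ l₂) pos₁₁ idx₁₁ idx-pos₁₁ pos-idx₁₁ (F11-join l₁ l₂)))
        where
        module g = F5Facts q
        l₁ l₂ : Bool
        l₁ = G a (e 0F)
        l₂ = G a (g.e 0F)
        rowQ : ∀ i → G a (g.e i) ≡ hub l₂ i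
        rowQ 0F = refl
        rowQ (suc i) = isTrue (tQ (g.tight i))

      module F5HS (h : HS Q) (tQ : ∀ {v} → Tight Q v → v ∈ G a) where
        module h = HSBoth h

        -- The independent set J has four vertices, one of degree at most 3, so it is not light. Its
        -- weight then leaves room for at most one vertex in the other clique, and for none if i
        -- misses `a`. Applied to both cliques this forces H_{2,2}.
        small : (g : HS Q) → let module g = HSBoth g in
                ∀ {i} → i ∈ g.K → i ∈ G a × # g.L ≤ 1
        small g {i} iK = ia , other-side-small (subst (_≤ w U J) sizes heavy) (≤-trans (dP (inU _)) (s≤s (low 0F))) (≤-trans (dP (inU _)) (s≤s (low 2F)))
              (≤-trans (dQ g.c₁U) (s≤s g.dc₁)) (≤-trans (dQ (proj₁ (g.K⁻ iK))) (s≤s (g.dK iK))) emb-# g.order≥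
          where
          module g = HSBoth g
          J : List (Fin n)
          J = e 1F ∷ e 3F ∷ g.c₁ ∷ i ∷ []
          iQ : i ∈ Q
          iQ = proj₁ (g.K⁻ iK)
          heavy : # U ≤ w U J
          heavy with ≤-<-connex (# U) (w U J)
          ... | inj₁ p = p
          ... | inj₂ q = ⊥-elim (<-irrefl refl (≤-trans (hyp {J}
                    ((e≁ ∷ apart (inU _) g.c₁U ∷ apart (inU _) iQ ∷ []) ∷ (apart (inU _) g.c₁U ∷ apart (inU _) iQ ∷ []) ∷ (g.c₁K iK ∷ []) ∷ [] ∷ [])
                    (P⊆U (inU _) ∷ P⊆U (inU _) ∷ Q⊆U g.c₁U ∷ Q⊆U iQ ∷ []) q (here refl)) (≤-trans (dP (inU _)) (s≤s (low 0F)))))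
          ia : i ∈ G a
          ia with split (G a) i
          ... | inj₁ p = p
          ... | inj₂ p = ⊥-elim (<-irrefl refl (≤-trans (#-pos g.l∈L) (other-side-empty (subst (_≤ w U J) sizes heavy)
                  (≤-trans (dP (inU _)) (s≤s (low 0F))) (≤-trans (dP (inU _)) (s≤s (low 2F)))
                  (≤-trans (dQ g.c₁U) (s≤s g.dc₁)) (≤-trans (dQ≁ iQ p) (g.dK iK)) emb-# g.order≥)))

        a~k : h.k ∈ G a
        a~k = proj₁ (small h h.k∈K)

        a~l : h.l ∈ G a
        a~l = proj₁ (small (swapHS h) (HSFacts.k∈K (swapHS h)))

        unique : ∀ {S : VSet n} {i j} → # S ≤ 1 → i ∈ S → j ∈ S → i ≡ j
        unique {S} {i} {j} le p q with ≟⊎ i j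
        ... | inj₁ r = r
        ... | inj₂ r = ⊥-elim (<-irrefl refl (≤-trans (#-list≥ {l = i ∷ j ∷ []} ((r ∷ []) ∷ [] ∷ []) (p ∷ q ∷ [])) le))

        onlyL : ∀ {i} → i ∈ h.L → i ≡ h.l
        onlyL p = unique (proj₂ (small h h.k∈K)) p h.l∈L

        #K≤1 : # h.K ≤ 1
        #K≤1 = ≤-trans (#-⊆ λ i p → s.S.K⁺ (proj₁ (h.K⁻ p)) (cong (sw ∘ sw) (proj₂ (h.K⁻ p))))
          (proj₂ (small (swapHS h) (HSFacts.k∈K (swapHS h))))
          where
          module s = HSBoth (swapHS h)

        onlyK : ∀ {i} → i ∈ h.K → i ≡ h.k
        onlyK p = unique #K≤1 p h.k∈K

        only₆ : ∀ {i} → i ∈ Q → i ≡ h.k ⊎ i ≡ h.l ⊎ i ≡ h.a ⊎ i ≡ h.b ⊎ i ≡ h.c₁ ⊎ i ≡ h.c₂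
        only₆ iQ with h.only iQ
        ... | inj₁ p = inj₁ (onlyK (h.K⁺ iQ p))
        ... | inj₂ (inj₁ p) = inj₂ (inj₁ (onlyL (h.S.K⁺ iQ (cong sw p))))
        ... | inj₂ (inj₂ p) = inj₂ (inj₂ p)

        -- With both edges absent, b would keep only the neighbours k and l, and b, c₁, `e 1F` would
        -- form a light set of three vertices, as 2 + 3 + 3 < 11. This is the requirement that L
        -- meet {ac₉, b₂c₉}.
        flag : T (G a h.b ∨ h.ab)
        flag = go (G a h.b) refl h.ab refl
          where
          go : ∀ x → G a h.b ≡ x → ∀ y → h.ab ≡ y → T (x ∨ y)
          go true _ _ _ = tt
          go false _ true _ = tt
          go false p false q = ⊥-elim (<-irrefl refl (≤-trans (hyp {h.b ∷ h.c₁ ∷ e 1F ∷ []}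
              ((h.apartκ h.bU h.c₁U h.κb h.κc₁ (h.κ≢ h.κb h.κc₁ λ ()) refl ∷ apart-sym (apart (inU _) h.bU) ∷ []) ∷ (apart-sym (apart (inU _) h.c₁U) ∷ []) ∷ [] ∷ [])
              (Q⊆U h.bU ∷ Q⊆U h.c₁U ∷ P⊆U (inU _) ∷ [])
              (≤-trans (corner-light {d U h.b} db (≤-trans (dQ h.c₁U) (s≤s h.dc₁)) (≤-trans (dP (inU _)) (s≤s (low 0F))) emb-# (Weak.five (weakHS h))) (≤-reflexive (sym sizes)))
              (here refl)) db))
            where
            db : d U h.b ≤ 2
            db = ≤-trans (dQ≁ h.bU (nmem p)) (#-list≤ (h.k ∷ h.l ∷ []) sub)
              where
              sub : ∀ i → i ∈ Q ∩ G h.b → i ∈ˡ h.k ∷ h.l ∷ []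
              sub i r with only₆ (proj₁ (∩⁻ r))
              ... | inj₁ s = here s
              ... | inj₂ (inj₁ s) = there (here s)
              ... | inj₂ (inj₂ (inj₁ refl)) = ⊥-elim (clash (proj₂ (∩⁻ r)) (proj₂ (h.apartκ h.bU h.aU h.κb h.κa (h.a≢b ∘ sym) q)))
              ... | inj₂ (inj₂ (inj₂ (inj₁ refl))) = ⊥-elim (clash (proj₂ (∩⁻ r)) ≁irr)
              ... | inj₂ (inj₂ (inj₂ (inj₂ (inj₁ refl)))) = ⊥-elim (clash (proj₂ (∩⁻ r)) (proj₂ (h.apartκ h.bU h.c₁U h.κb h.κc₁ (h.κ≢ h.κb h.κc₁ λ ()) refl)))
              ... | inj₂ (inj₂ (inj₂ (inj₂ (inj₂ refl)))) = ⊥-elim (clash (proj₂ (∩⁻ r)) (proj₂ (h.apartκ h.bU h.c₂U h.κb h.κc₂ (h.κ≢ h.κb h.κc₂ λ ()) refl)))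

        e₆ : Fin 6 → Fin n
        e₆ 0F = h.a
        e₆ 1F = h.c₁
        e₆ 2F = h.c₂
        e₆ 3F = h.k
        e₆ 4F = h.l
        e₆ 5F = h.b

        e₆U : ∀ i → e₆ i ∈ Q
        e₆U 0F = h.aU
        e₆U 1F = h.c₁U
        e₆U 2F = h.c₂U
        e₆U 3F = h.kU
        e₆U 4F = h.lU
        e₆U 5F = h.bU

        κe₆ : ∀ i → h.κ (e₆ i) ≡ κ₆ i
        κe₆ 0F = h.κa
        κe₆ 1F = h.κc₁
        κe₆ 2F = h.κc₂
        κe₆ 3F = h.κk
        κe₆ 4F = h.κl
        κe₆ 5F = h.κb

        unκ : Cls → Fin 6
        unκ cA = 0F
        unκ cC1 = 1F
        unκ cC2 = 2F
        unκ cS1 = 3F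
        unκ cS2 = 4F
        unκ cB = 5F

        unκ₆ : ∀ i → unκ (κ₆ i) ≡ i
        unκ₆ 0F = refl
        unκ₆ 1F = refl
        unκ₆ 2F = refl
        unκ₆ 3F = refl
        unκ₆ 4F = refl
        unκ₆ 5F = refl

        inj₆ : ∀ i j → e₆ i ≡ e₆ j → i ≡ j
        inj₆ i j p = trans (sym (unκ₆ i)) (trans (cong unκ (trans (sym (κe₆ i)) (trans (cong h.κ p) (κe₆ j)))) (unκ₆ j))

        embQ : Emb Q (H₆ h.ab)
        embQ = record { e = e₆ ; inj = inj₆ ; inU = e₆U ; onto = on ; adj = ad }
          where
          on : ∀ {u} → u ∈ Q → ∃ λ i → e₆ i ≡ u
          on uQ with only₆ uQ
          ... | inj₁ refl = 3F , refl
          ... | inj₂ (inj₁ refl) = 4F , refl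
          ... | inj₂ (inj₂ (inj₁ refl)) = 0F , refl
          ... | inj₂ (inj₂ (inj₂ (inj₁ refl))) = 5F , refl
          ... | inj₂ (inj₂ (inj₂ (inj₂ (inj₁ refl)))) = 1F , refl
          ... | inj₂ (inj₂ (inj₂ (inj₂ (inj₂ refl)))) = 2F , refl
          ad : ∀ i j → G (e₆ i) (e₆ j) ≡ H₆ h.ab i j
          ad i j with ≟⊎ i j
          ... | inj₁ refl = trans (girr _) (sym (cong (λ b → not b ∧ E h.ab (κ₆ i) (κ₆ i)) (≡ᵇ-refl (toℕ i))))
          ... | inj₂ ne = trans (h.adj (e₆U i) (e₆U j) (λ p → ne (inj₆ i j p)))
                (trans (cong₂ (E h.ab) (κe₆ i) (κe₆ j)) (sym (cong (λ b → not b ∧ E h.ab (κ₆ i) (κ₆ j)) (==-≢ ne))))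

        rowQ : ∀ i → G a (e₆ i) ≡ hub₆ (G a h.a) (G a h.b) i
        rowQ 0F = refl
        rowQ 1F = isTrue (tQ h.tight₁)
        rowQ 2F = isTrue (tQ h.tight₂)
        rowQ 3F = isTrue a~k
        rowQ 4F = isTrue a~l
        rowQ 5F = refl

        result : Big U
        result = mkBig h.c₁U h.dc₁ (tQ h.tight₁)
          (h.extHS a∉Q (tQ h.tight₁) (tQ h.tight₂) (∪⁺ˡ (∪⁺ˡ h.k∈K)) (h.κ≢ h.κk h.κa λ ()) a~k) (Weak.five (weakHS h))
          (inj₂ (l₁ , l₂ , l₃ , h.ab , flag , embed embQ (row (λ i → tP (tight i))) rowQ (F12 l₁ l₂ l₃ h.ab) pos₁₂ idx₁₂ idx-pos₁₂ pos-idx₁₂ (F12-join l₁ l₂ l₃ h.ab)))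
          where
          l₁ l₂ l₃ : Bool
          l₁ = G a (e 0F)
          l₂ = G a h.a
          l₃ = G a h.b

  -- The induction

  -- An exceptional outcome comes with an empty A, which excludes it whenever a vertex has just been
  -- put into A.
  Result : VSet n → VSet n → Set
  Result U A = Good U A ⊎ (∀ i → i ∉ A) × Exc U

  withEmpty : ∀ {U A} → (∀ i → i ∉ A) → Good U A ⊎ Exc U → Result U A
  withEmpty e (inj₁ g) = inj₁ g
  withEmpty e (inj₂ x) = inj₂ (e , x)

  module TightAdjacent {U A : VSet n} {a : Fin n} {D : VSet n} {x : Fin n} (L : Lobe U a D) (hyp : Hyp U A) (xD : x ∈ D) (xA : x ∉ A)
      (rich : d U x + d U x ≤ suc (# D)) (A'∅ : ∀ i → i ∉ A ∖ (D ⊕ a)) where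
    open LobeFacts L
    module R = Rich hyp xD xA rich

    -- Adding x to the light set of a tight v demands 1 + |A| more than its degree in F', and the
    -- edge to `a` is all that U can add. So A is empty and v is adjacent to `a`.
    tooLong : ∀ {v} (t : Tight F' v) → suc (length (proj₁ t)) + # A ≤ d U v × v ∈ F' × d F' v ≤ length (proj₁ t)
    tooLong (J , i , ps , l , vJ , dv) =
      R.long i (All.map (λ p → ∖⁺ p (A'∅ _)) ps) l vJ , All.lookup ps vJ , dv

    A∅ : ∀ {v} → Tight F' v → ∀ i → i ∉ A
    A∅ t with tooLong t
    ... | p , vF , dv = #-zero⁻ (n≤0⇒n≡0 (tight-no-A {length (proj₁ t)} p (dF' vF) dv))

    adjacent : ∀ {v} → Tight F' v → v ∈ G a
    adjacent {v} t with tooLong t | split (G a) v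
    ... | _ | inj₁ r = r
    ... | p , vF , dv | inj₂ r = ⊥-elim (<-irrefl refl (≤-trans (≤-trans (s≤s (m≤m+n _ (# A))) p) (≤-trans (dF'≁ vF r) dv)))

  -- If a has no neighbour in F' besides c₁, c₂ and possibly the vertex a of H_{s,t}, then F' ⊕ a may be separable;
  -- but then {a, c₁, c₂} can be split off from it.
  module LoneHS {U A : VSet n} {a : Fin n} {D : VSet n} {x : Fin n} (L : Lobe U a D) (hyp : HypE U) (A∅ : ∀ i → i ∉ A) (nB : NS (D ⊕ a))
      (sD : 3 ≤ # D) (xD : x ∈ D) (h : HS (LobeFacts.F' L)) where
    open LobeFacts L
    module h = HSBoth h

    module _ (e₁ : h.c₁ ∈ G a) (e₂ : h.c₂ ∈ G a) (none : ∀ i → i ∉ (h.Q ─ h.a) ∩ G a) where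
      k≁a : h.k ∉ G a
      k≁a = ∉-intro λ p → clash (∩⁺ (─⁺ (∪⁺ˡ (∪⁺ˡ h.k∈K)) (h.κ≢ h.κk h.κa λ ())) p) (none h.k)

      dk : d U h.k ≤ suc (# h.K)
      dk = ≤-trans (dF'≁ h.kU k≁a) (h.dK h.k∈K)

      dc : d U h.c₁ ≤ 3
      dc = ≤-trans (dF' h.c₁U) (s≤s h.dc₁)

      F'U : ∀ {i} → i ∈ F' → i ∈ U
      F'U p = proj₁ (∖⁻ p)

      connD : Conn D
      connD = conn-resp ((λ p → [ id , (λ q → ⊥-elim (proj₂ (─⁻ p) q)) ]′ (⊕⁻ (proj₁ (─⁻ p))))
        , (λ p → ─⁺ (∪⁺ˡ p) (λ { refl → clash p a∉D }))) (conn─ nB (a∈⊕ {S = D}))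

      -- If y cut D, vertices u and v from two sides of y together with c₁ and k would be
      -- independent. Each of u, v sees at most its own side, y and `a`, so the set is light, while
      -- c₁ has degree at most 3.
      nsD : NS D
      nsD with decNS connD
      ... | inj₁ ns = ns
      ... | inj₂ (y , yD , K , s) = ⊥-elim (<-irrefl refl (≤-trans (hyp {u ∷ v ∷ h.c₁ ∷ h.k ∷ []}
            ((apart₁₂ uC vC ∷ apart' uD h.c₁U ∷ apart' uD h.kU ∷ []) ∷ (apart' vD h.c₁U ∷ apart' vD h.kU ∷ []) ∷ (h.c₁K h.k∈K ∷ []) ∷ [] ∷ [])
            (D⊆U uD ∷ D⊆U vD ∷ F'U h.c₁U ∷ F'U h.kU ∷ [])
            (lone-light₄ {d U u} (side C₁.dC uC) (side C₂.dC vC) sizes (≤-reflexive (sym (#-─ yD))) dc dk (#-pos h.l∈L) h.order≥ #U-B)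
            (there (there (here refl)))) dc))
        where
        open Split s
        open Disconnected {A = A} s
        uC : u ∈ U₁
        uC = ∩⁺ uT uK
        vC : v ∈ U₂
        vC = ∩⁺ vT (∁⁺ vK)
        uD : u ∈ D
        uD = proj₁ (─⁻ uT)
        vD : v ∈ D
        vD = proj₁ (─⁻ vT)
        side : ∀ {R z} → (∀ {v} → v ∈ (D ─ y) ∩ R → d (D ─ y) v ≤ d ((D ─ y) ∩ R) v) → z ∈ (D ─ y) ∩ R → d U z ≤ suc (# ((D ─ y) ∩ R))
        side {R} {z} f zR = ≤-trans (dD+ (proj₁ (─⁻ (proj₁ (∩⁻ zR))))) (s≤s (≤-trans one (≤-trans (s≤s (f zR)) (d< zR))))
          where
          one : d D z ≤ suc (d (D ─ y) z)
          one = ≤-trans (#-⊆ {T = ((D ─ y) ∩ G z) ⊕ y} λ i p → [ (λ { refl → a∈⊕ {S = (D ─ y) ∩ G z} }) , (λ q → ∪⁺ˡ (∩⁺ (─⁺ (proj₁ (∩⁻ p)) q) (proj₂ (∩⁻ p)))) ]′ (≟⊎ i y)) #-⊕≤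

      T₀ : VSet n
      T₀ = Tri a h.c₁ h.c₂

      T₀⁻ : ∀ {i} → i ∈ T₀ → i ≡ a ⊎ i ∈ F' × i ∉ h.Q
      T₀⁻ p with tri⁻ p
      ... | inj₁ e = inj₁ e
      ... | inj₂ (inj₁ refl) = inj₂ (h.c₁U , ∉-intro λ q → proj₁ (proj₂ (h.Q⁻ q)) refl)
      ... | inj₂ (inj₂ refl) = inj₂ (h.c₂U , ∉-intro λ q → proj₂ (proj₂ (h.Q⁻ q)) refl)

      loneGood : Good U A
      loneGood = record { X = ∅ ; X⊆A = λ { (mem ()) } ; Ps = T₀ ∷ D ∷ h.Q ∷ []
        ; okP = (triangle e₁ e₂ h.c₁~c₂ , ≤-reflexive (sym (tri-size (~⇒≢ e₁) (~⇒≢ e₂) h.c₁≢c₂))) ∷ (nsD , sD) ∷ (h.nsQ , h.#Q) ∷ []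
        ; subP = (λ p → ∖⁺ ([ (λ { refl → a∈U }) , F'U ∘ proj₁ ]′ (T₀⁻ p)) ∉∅) ∷ (λ p → ∖⁺ (D⊆U p) ∉∅) ∷ (λ p → ∖⁺ (F'U (proj₁ (h.Q⁻ p))) ∉∅) ∷ []
        ; disj = ((λ p → ∉-intro λ q → [ (λ { refl → clash q a∉D }) , (λ r → clash q (proj₁ (proj₂ (F'⁻ (proj₁ r))))) ]′ (T₀⁻ p))
               ∷ (λ p → ∉-intro λ q → [ (λ { refl → proj₂ (proj₂ (F'⁻ (proj₁ (h.Q⁻ q)))) refl }) , (λ r → clash q (proj₂ r)) ]′ (T₀⁻ p)) ∷ [])
               ∷ ((λ p → ∉-intro λ q → clash p (proj₁ (proj₂ (F'⁻ (proj₁ (h.Q⁻ q)))))) ∷ []) ∷ [] ∷ []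
        ; cover = λ {i} iU _ → cov iU
        -- The representatives of the triangle, of `Q` and of D respectively.
        ; J = h.c₁ ∷ h.k ∷ x ∷ []
        ; indep = (h.c₁K h.k∈K ∷ apart-sym (apart' xD h.c₁U) ∷ []) ∷ (apart-sym (apart' xD h.kU) ∷ []) ∷ [] ∷ []
        ; inJ = ∖⁺ (F'U h.c₁U) (A∅ _) ∷ ∖⁺ (F'U h.kU) (A∅ _) ∷ ∖⁺ (D⊆U xD) (A∅ _) ∷ []
        ; len = refl
        ; light = inj₁ (lone-light₃ {d U h.c₁} dc dk (dD xD) (#-pos h.l∈L) h.order≥ #U-B) }
        where
        cov : ∀ {i} → i ∈ U → Any (i ∈_) (T₀ ∷ D ∷ h.Q ∷ [])
        cov {i} iU with split D i | ≟⊎ i a | ≟⊎ i h.c₁ | ≟⊎ i h.c₂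
        ... | inj₁ p | _ | _ | _ = there (here p)
        ... | inj₂ _ | inj₁ refl | _ | _ = here (tri₁ {a} {h.c₁} {h.c₂})
        ... | inj₂ _ | inj₂ _ | inj₁ refl | _ = here (tri₂ {a} {h.c₁} {h.c₂})
        ... | inj₂ _ | inj₂ _ | inj₂ _ | inj₁ refl = here (tri₃ {a} {h.c₁} {h.c₂})
        ... | inj₂ p | inj₂ q | inj₂ r | inj₂ t = there (there (here (h.Q⁺ (F'⁺ iU p q) r t)))

  triangleK2 : ∀ {U A a D} (L : Lobe U a D) → HypE U → (∀ i → i ∉ A) → Emb D K2 → (∀ {v} → Tight D v → v ∈ G a) → Good U A ⊎ Exc U
  triangleK2 L hyp A∅ f t = Triangle.triangleCase L hyp A∅ (inU 0F) (inU 1F) only₂ (emb~ 0F 1F refl) (t (tightK2 f 0F)) (t (tightK2 f 1F))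
    where
    open Emb f
    only₂ : ∀ {i} → i ∈ _ → i ≡ e 0F ⊎ i ≡ e 1F
    only₂ p with onto p
    ... | 0F , refl = inj₁ refl
    ... | 1F , refl = inj₂ refl

  -- A vertex o of another component enlarges the light set of a tight vertex v, whose degree does
  -- not grow. If o lies in A, it raises the required degree through |A| instead. Any tight vertex
  -- serves, so the one to be avoided is arbitrary.
  componentNotExceptional : ∀ {U A K} → Hyp U A → (s : Split U K) → (∀ i → i ∉ A ∩ (U ∩ K)) → Exc (U ∩ K) → ⊥
  componentNotExceptional {U} {A} {K} hyp s e x with tight≢ x (Split.v s) | split A (Split.v s)
  ... | v , (J , i , ps , l , vJ , dv) , _ | which = no which
    where
    open Disconnected {A = A} s
    o∈ : Split.v s ∈ U₂
    o∈ = ∩⁺ (Split.vT s) (∁⁺ (Split.vK s))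
    inA : All (_∈ U ∖ A) J
    inA = All.map (λ p → C₁.inC (∖⁺ p (e _))) ps
    wJ : w U J < # U₁
    wJ = ≤-trans (s≤s (C₁.wC ps)) l
    dv' : d U v ≤ length J
    dv' = ≤-trans (C₁.dC (All.lookup ps vJ)) dv
    no : Split.v s ∈ A ⊎ Split.v s ∉ A → ⊥
    no (inj₁ oA) = <-irrefl refl (≤-trans (≤-trans (≤-reflexive (+-comm 1 (length J))) (+-monoʳ-≤ (length J) (#-pos oA)))
      (≤-trans (hyp i inA (≤-trans wJ (≤-trans (m≤m+n _ _) sizes)) vJ) dv'))
    no (inj₂ oA) = <-irrefl refl (≤-trans (s≤s (m≤m+n (length J) (# A)))
      (≤-trans (hyp {Split.v s ∷ J} (All.map (λ p → apart-sym (apart₁₂ p o∈)) ps ∷ i) (∖⁺ (Split.vT s) oA ∷ inA)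
        (≤-trans (sum-< {d U (Split.v s)} (C₂.dC o∈) (d< o∈) ≤-refl wJ) (≤-trans (≤-reflexive (+-comm (# U₂) (# U₁))) sizes))
        (there vJ)) dv'))

  -- The inductive step

  module _ (m : ℕ) (IH : ∀ U A → # U ≤ m → Hyp U A → Result U A) where

    module RichExceptional {U A : VSet n} {a : Fin n} {D : VSet n} {x : Fin n} (le : # U ≤ suc m) (L : Lobe U a D) (hyp : Hyp U A) (A∅ : ∀ i → i ∉ A) (nB : NS (D ⊕ a))
        (sD : 3 ≤ # D) (xD : x ∈ D)
        (tF : ∀ {v} → Tight (LobeFacts.F' L) v → v ∈ G a) where
      open LobeFacts L
      L' = mirror
      module L' = LobeFacts L'
      D' = L'.F'
      t : Two U a F' D'
      t = two L'
      hypU : HypE U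
      hypU = hypE A∅ hyp

      a∉F' : a ∉ F'
      a∉F' = Lobe.a∉D L'

      -- The sides exchange roles: F' ⊕ a becomes the part, a vertex z of low degree meets the
      -- threshold in F', and the induction hypothesis is applied to D', which has the same elements
      -- as D. If D' is exceptional as well, its tight vertices are also adjacent to `a`.
      second : ∀ {z} → NS (F' ⊕ a) → z ∈ F' → d U z + d U z ≤ suc (# F') → 2 ≤ # F' →
               (Exc D' → (∀ {v} → Tight D' v → v ∈ G a) → Good U A ⊎ Exc U) → Good U A ⊎ Exc U
      second {z} nF zF rich' sF k with IH D' (A ∖ L'.B) (≤-pred (≤-trans smaller le)) (LobeFacts.Rich.richHyp L' hyp zF (A∅ z) rich')
        where
        smaller : # D' < # U
        smaller = ≤-trans (s≤s (m≤n+m (# D') (# F'))) (≤-reflexive (sym L'.#U-B))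
      ... | inj₁ g = inj₁ (LobeFacts.Rich.richGood L' hyp zF (A∅ z) rich' nF (≤-trans (s≤s sF) (≤-reflexive (sym L'.#B))) g)
      ... | inj₂ (A'∅ , ex) = k ex (λ tv → TightAdjacent.adjacent L' hyp zF (A∅ z) rich' A'∅ tv)

      k2' : Emb D' K2 → (∀ {v} → Tight D' v → v ∈ G a) → Good U A ⊎ Exc U
      k2' f tD = triangleK2 L'.mirror hypU A∅ f tD

      cases : Exc F' → Good U A ⊎ Exc U
      cases (isK2 f) = triangleK2 L' hypU A∅ f tF
      cases (isF5 f) = second (f.extF5 a∉F' (tF (f.tight 0F)) (tF (f.tight 1F)) (tF (f.tight 2F))) (f.inU 1F)
          (rich-3 (≤-trans (Two.dP t (f.inU 1F)) (s≤s (f.low 0F))) f.emb-#) (≤-trans (s≤s (s≤s z≤n)) f.emb-#) k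
        where
        module f = F5Facts f
        k : Exc D' → (∀ {v} → Tight D' v → v ∈ G a) → Good U A ⊎ Exc U
        k (isK2 g) tD = k2' g tD
        k (isF5 g) tD = inj₂ (isBig (f5-f5 t hypU f tF g tD))
        k (isHS g) tD = inj₂ (isBig (F5HS.result t hypU f tF g tD))
        k (isBig g) tD = ⊥-elim (big-weak (swapTwo t) hypU g (weakF5 f))
      cases (isHS h) with search ((HSBoth.Q h ─ HS.a h) ∩ G a)
      ... | inj₂ none = inj₁ (LoneHS.loneGood L hypU A∅ nB sD xD h (tF (HSBoth.tight₁ h)) (tF (HSBoth.tight₂ h)) none)
      ... | inj₁ (u , uQ) = second (h.extHS a∉F' (tF h.tight₁) (tF h.tight₂) (proj₁ (─⁻ (proj₁ (∩⁻ uQ)))) (proj₂ (─⁻ (proj₁ (∩⁻ uQ)))) (proj₂ (∩⁻ uQ)))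
          h.c₁U (rich-3 (≤-trans (Two.dP t h.c₁U) (s≤s h.dc₁)) (Weak.five (weakHS h))) (≤-trans (s≤s (s≤s z≤n)) (Weak.five (weakHS h))) k
        where
        module h = HSBoth h
        k : Exc D' → (∀ {v} → Tight D' v → v ∈ G a) → Good U A ⊎ Exc U
        k (isK2 g) tD = k2' g tD
        k (isF5 g) tD = inj₂ (isBig (F5HS.result (swapTwo t) hypU g tD h tF))
        k (isHS g) tD = ⊥-elim (hs-hs t hypU h g)
        k (isBig g) tD = ⊥-elim (big-weak (swapTwo t) hypU g (weakHS h))
      cases (isBig b) = second (b.ext a∉F' tF) v₁F (rich-4 (≤-trans (Two.dP t v₁F) (s≤s b.low₁)) b.large) (≤-trans (s≤s (s≤s z≤n)) b.large) k
        where
        module b = Big b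
        v₁F : b.v₁ ∈ F'
        v₁F = All.head b.inU
        k : Exc D' → (∀ {v} → Tight D' v → v ∈ G a) → Good U A ⊎ Exc U
        k (isK2 g) tD = k2' g tD
        k (isF5 g) tD = ⊥-elim (big-weak t hypU b (weakF5 g))
        k (isHS g) tD = ⊥-elim (big-weak t hypU b (weakHS g))
        k (isBig g) tD = ⊥-elim (big-big t hypU b g)

    module LobeCase {U A : VSet n} {a : Fin n} {D : VSet n} (le : # U ≤ suc m) (hyp : Hyp U A) (L : Lobe U a D) (nB : NS (D ⊕ a)) where
      open LobeFacts L

      F<U : # F ≤ m
      F<U = ≤-pred (≤-trans (subst (suc (# F) ≤_) (sym #U-D) (+-monoˡ-≤ (# F) (#-pos x₀∈D))) le)

      F'<U : # F' ≤ m
      F'<U = ≤-pred (≤-trans (≤-trans (s≤s (m≤n+m (# F') (# D))) (≤-reflexive (sym #U-B))) le)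

      -- If the rest were exceptional, a tight vertex other than `a` would have the same degree in
      -- U, although there the required degree includes |A|, which is positive because D is
      -- nonempty.
      absorbed : D ⊆ A → Result U A
      absorbed D⊆A with IH F (A ∖ D) F<U (Absorb.absorbHyp hyp D⊆A)
      ... | inj₁ g = inj₁ (Absorb.absorbGood hyp D⊆A g)
      ... | inj₂ (e , x) with tight≢ x a
      ...   | v , (J , i , ps , l , vJ , dv) , va = ⊥-elim (n≮0 (absorb-tight {length J}
              (hyp i (All.map shrink-A (All.map (λ p → ∖⁺ p (e _)) ps)) (Absorb.light-U hyp D⊆A i ps l) vJ)
              (dF (All.lookup ps vJ) va) dv (#-pos (D⊆A x₀∈D))))

      module _ {x} (xD : x ∈ D) (xA : x ∉ A) where
        lowx : 2 + # (A ∩ D) ≤ d U x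
        lowx = low hyp xD xA

        richCase : d U x + d U x ≤ suc (# D) → Result U A
        richCase rich with IH F' (A ∖ B) F'<U (Rich.richHyp hyp xD xA rich)
        ... | inj₁ g = inj₁ (Rich.richGood hyp xD xA rich nB (subst (3 ≤_) (sym #B) (m≤n⇒m≤1+n sD)) g)
          where
          sD : 3 ≤ # D
          sD = rich-large {d U x} (≤-trans (m≤m+n 2 _) lowx) rich
        ... | inj₂ (A'∅ , ex) with TightAdjacent.A∅ L hyp xD xA rich A'∅ (proj₁ (proj₂ (tight≢ ex a)))
        ...   | A∅ = withEmpty A∅ (RichExceptional.cases le L hyp A∅ nB sD xD
                  (λ t → TightAdjacent.adjacent L hyp xD xA rich A'∅ t) ex)
          where
          sD : 3 ≤ # D
          sD = rich-large {d U x} (≤-trans (m≤m+n 2 _) lowx) rich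

        -- Here D ∖ A consists of exactly two vertices x, x', and |D| ≤ |A ∩ D| + 2 ≤ d(x), d(x')
        -- makes them adjacent to everything else in D ⊕ a. A third vertex of D would then see both,
        -- contrary to `one`; so D ⊕ a is a triangle.
        module SmallCore {E} (core : Core A E) (small : # E ≤ 2) where
          open Core core

          DA⊆E : ∀ {i} → i ∈ D ∖ A → i ∈ E
          DA⊆E {i} p with split E i
          ... | inj₁ q = q
          ... | inj₂ q = ⊥-elim (clash (rest⊆A (proj₁ (∖⁻ p)) q) (proj₂ (∖⁻ p)))

          #D≤ : # D ≤ # (A ∩ D) + # (D ∖ A)
          #D≤ = #-cover λ i p → [ (λ q → inj₁ (∩⁺ q p)) , (λ q → inj₂ (∖⁺ p q)) ]′ (split A i)

          another : ∃ λ i → i ∈ (D ∖ A) ─ x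
          another = #-pos⁻ (≤-pred (subst (2 ≤_) (#-─ (∖⁺ xD xA)) (two-outside lowx (dD xD) #D≤)))

          x' : Fin n
          x' = proj₁ another
          x'D : x' ∈ D
          x'D = proj₁ (∖⁻ (proj₁ (─⁻ (proj₂ another))))
          x'A : x' ∉ A
          x'A = proj₂ (∖⁻ (proj₁ (─⁻ (proj₂ another))))
          x'≢x : x' ≢ x
          x'≢x = proj₂ (─⁻ (proj₂ another))
          xE : x ∈ E
          xE = DA⊆E (∖⁺ xD xA)
          x'E : x' ∈ E
          x'E = DA⊆E (∖⁺ x'D x'A)

          onlyE : ∀ {i} → i ∈ E → i ≡ x ⊎ i ≡ x'
          onlyE {i} iE with ≟⊎ i x | ≟⊎ i x'
          ... | inj₁ p | _ = inj₁ p
          ... | inj₂ _ | inj₁ p = inj₂ p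
          ... | inj₂ p | inj₂ q = ⊥-elim (<-irrefl refl (≤-trans (#-list≥ {l = i ∷ x ∷ x' ∷ []}
                  ((p ∷ q ∷ []) ∷ ((x'≢x ∘ sym) ∷ []) ∷ [] ∷ []) (iE ∷ xE ∷ x'E ∷ [])) small))

          fullDegree : ∀ {z} → z ∈ D → z ∉ A → # D ≤ d U z
          fullDegree zD zA = full-degree (low hyp zD zA) #D≤ (≤-trans (#-⊆ λ _ → DA⊆E) small)

          onlyD : ∀ {i} → i ∈ D → i ≡ x ⊎ i ≡ x'
          onlyD {i} iD with split E i
          ... | inj₁ p = onlyE p
          ... | inj₂ p = ⊥-elim (x'≢x (one iD p x'E xE
                  (~sym (dD-full x'D (fullDegree x'D x'A) (∪⁺ˡ (─⁺ iD (λ { refl → clash x'E p })))))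
                  (~sym (dD-full xD (fullDegree xD xA) (∪⁺ˡ (─⁺ iD (λ { refl → clash xE p })))))))

          result : Result U A
          result with search (F' ∖ A)
          -- All of F' belongs to A and may be moved elsewhere, so the triangle is the only part.
          ... | inj₂ none = inj₁ (goodOne {P = B} {X = F'} {x = x} (λ p → ∖∉⁻ (none _) p) nB
                  (≤-trans (s≤s #D≥2) (≤-reflexive (sym #B)))
                  (λ p → ∖⁺ (B⊆U p) (∖∉ʳ p)) (λ p q → ∖∉⁻ q p) (∖⁺ (D⊆U xD) xA))
            where
            #D≥2 : 2 ≤ # D
            #D≥2 = #-list≥ {l = x ∷ x' ∷ []} (((x'≢x ∘ sym) ∷ []) ∷ [] ∷ []) (xD ∷ x'D ∷ [])
          ... | inj₁ (v , p) = withEmpty A∅ (Triangle.triangleCase L (hypE A∅ hyp) A∅ xD x'D onlyD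
                  (dD-full xD (fullDegree xD xA) (∪⁺ˡ (─⁺ x'D x'≢x)))
                  (~sym (dD-full xD (fullDegree xD xA) (a∈⊕ {S = D ─ x})))
                  (~sym (dD-full x'D (fullDegree x'D x'A) (a∈⊕ {S = D ─ x'}))))
            where
            vF : v ∈ F'
            vF = proj₁ (∖⁻ p)
            A∅ : ∀ i → i ∉ A
            A∅ = #-zero⁻ (n≤0⇒n≡0 (low-degree-no-A (hyp {x ∷ v ∷ []} ((apart' xD vF ∷ []) ∷ [] ∷ [])
              (∖⁺ (D⊆U xD) xA ∷ ∖⁺ (proj₁ (∖⁻ vF)) (proj₂ (∖⁻ p)) ∷ [])
              (pair-light {d U x} (dD xD) (dF'# vF) #U-B) (here refl))
              (≤-trans (dD xD) (#-list≤ (x ∷ x' ∷ []) λ i q → [ here , (λ r → there (here r)) ]′ (onlyD q)))))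

        denseCase : (∀ {z} → z ∈ D → z ∉ A → 2 + # D ≤ d U z + d U z) → Result U A
        denseCase dense with MakeCore.theCore dense
        ... | E , core with ≤-<-connex (# E) 2
        ...   | inj₁ small = SmallCore.result core small
        ...   | inj₂ sE with IH F ((A ∖ D) ⊕ a) F<U (Detach.detachHyp hyp core nB sE xD xA)
        ...     | inj₁ g = inj₁ (Detach.detachGood hyp core nB sE xD xA g)
        -- The exceptional outcome needs an empty set in the place of A, but that set now contains
        -- `a`.
        ...     | inj₂ (e , _) = ⊥-elim (clash (a∈⊕ {S = A ∖ D}) (e a))

      lobeCase : Result U A
      lobeCase with search (D ∖ A)
      ... | inj₂ none = absorbed λ p → ∖∉⁻ (none _) p
      ... | inj₁ (x , p) with search ((D ∖ A) ∩ λ z → (d U z + d U z) ≤ᵇ suc (# D))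
      ...   | inj₁ (z , q) with ∩⁻ q
      ...     | zDA , mem r = richCase (proj₁ (∖⁻ zDA)) (proj₂ (∖⁻ zDA)) (≤ᵇ⇒≤ _ _ (≡⇒T r))
      lobeCase | inj₁ (x , p) | inj₂ none = denseCase (proj₁ (∖⁻ p)) (proj₂ (∖⁻ p)) dense
        where
        dense : ∀ {z} → z ∈ D → z ∉ A → 2 + # D ≤ d U z + d U z
        dense {z} zD zA with ≤-<-connex (2 + # D) (d U z + d U z)
        ... | inj₁ q = q
        ... | inj₂ lt = ⊥-elim (clash (∩⁺ (∖⁺ zD zA) (mem (T⇒≡ (≤⇒≤ᵇ (≤-pred lt))))) (none z))

    nonseparable : ∀ {U A x} → Hyp U A → NS U → x ∈ U ∖ A → Result U A
    nonseparable {U} {A} {x} hyp ns xU with ≤-<-connex 3 (# U)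
    ... | inj₁ s = inj₁ (goodOne {X = ∅} (λ { (mem ()) }) ns s (λ p → ∖⁺ p ∉∅) (λ p _ → p) xU)
    -- With at most two vertices, 1 + |A| ≤ d(x) ≤ 1, so A is empty and x has a neighbour.
    ... | inj₂ s' = inj₂ (#-zero⁻ (n≤0⇒n≡0 (edge-no-A h (d< (proj₁ (∖⁻ xU))) s')) , isK2 record
              { e = e ; inj = inj ; inU = inU ; onto = onto ; adj = adj })
      where
      h : 1 + # A ≤ d U x
      h = hyp {x ∷ []} ([] ∷ []) (xU ∷ []) (subst (_< # U) (sym (+-identityʳ _)) (d< (proj₁ (∖⁻ xU)))) (here refl)
      nbr : ∃ λ z → z ∈ U ∩ G x
      nbr = #-pos⁻ (≤-trans (s≤s z≤n) h)
      z : Fin n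
      z = proj₁ nbr
      xz : z ∈ G x
      xz = proj₂ (∩⁻ (proj₂ nbr))
      e : Fin 2 → Fin n
      e 0F = x
      e 1F = z
      inj : ∀ i j → e i ≡ e j → i ≡ j
      inj 0F 0F _ = refl
      inj 0F 1F p = ⊥-elim (~⇒≢ xz p)
      inj 1F 0F p = ⊥-elim (~⇒≢ xz (sym p))
      inj 1F 1F _ = refl
      inU : ∀ i → e i ∈ U
      inU 0F = proj₁ (∖⁻ xU)
      inU 1F = proj₁ (∩⁻ (proj₂ nbr))
      onto : ∀ {u} → u ∈ U → ∃ λ i → e i ≡ u
      onto {u} uU with ≟⊎ u x | ≟⊎ u z
      ... | inj₁ p | _ = 0F , sym p
      ... | inj₂ _ | inj₁ p = 1F , sym p
      ... | inj₂ p | inj₂ q = ⊥-elim (<-irrefl refl (≤-trans (s≤s (#-list≥ {l = u ∷ x ∷ z ∷ []}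
              ((p ∷ q ∷ []) ∷ (~⇒≢ xz ∷ []) ∷ [] ∷ []) (uU ∷ inU 0F ∷ inU 1F ∷ []))) s'))
      adj : ∀ i j → G (e i) (e j) ≡ K2 i j
      adj 0F 0F = girr _
      adj 0F 1F = isTrue xz
      adj 1F 0F = isTrue (~sym xz)
      adj 1F 1F = girr _

    disconnected : ∀ {U A K} → # U ≤ suc m → Hyp U A → Split U K → Result U A
    disconnected {U} {A} {K} le hyp s
      with IH _ _ (half s) (Component.hypC (component s) hyp) | IH _ _ (half (split-∁ s)) (Component.hypC (component (split-∁ s)) hyp)
      where
      half : ∀ {K} → Split U K → # (U ∩ K) ≤ m
      half s = ≤-pred (≤-trans (#-strict (λ _ p → proj₁ (∩⁻ p)) (Split.vT s) (∉-intro λ p → clash (proj₂ (∩⁻ p)) (Split.vK s))) le)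
    ... | inj₁ g | inj₁ h = inj₁ (Disconnected.goodUnion s g h)
    ... | inj₂ (e , x) | _ = ⊥-elim (componentNotExceptional hyp s e x)
    ... | inj₁ _ | inj₂ (e , x) = ⊥-elim (componentNotExceptional hyp (split-∁ s) e x)

    step : ∀ U A → # U ≤ suc m → Hyp U A → Result U A
    step U A le hyp with search (U ∖ A)
    ... | inj₂ none = inj₁ (goodAbsorbed none)
    ... | inj₁ (x , xU) with decConn U
    ...   | inj₂ (K , s) = disconnected le hyp s
    ...   | inj₁ c with decNS c
    ...     | inj₁ ns = nonseparable hyp ns xU
    ...     | inj₂ (y , yU , K , s) with MinimalLobe.minimalLobe c yU s
    ...       | a , D , L , nB = LobeCase.lobeCase le hyp L nB

  main : ∀ m U A → # U ≤ m → Hyp U A → Result U A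
  main zero U A le hyp = inj₁ (goodAbsorbed λ i → ∖∉ˡ (#-zero⁻ (n≤0⇒n≡0 le) i))
  main (suc m) = step m (main m)

  -- Translation to the statement

  d-full : ∀ v → d full v ≡ deg G v
  d-full v = trans (#-eq {S = full ∩ G v} {G v} (λ _ p → proj₂ (∩⁻ p)) (λ _ p → ∩⁺ (mem refl) p)) (sym (size-# (G v)))

  distinct : ∀ {J} → Indep J → AllPairs _≢_ J
  distinct = AllPairs.map proj₁

  indep-pair : ∀ {J u v} → Indep J → u ∈ˡ J → v ∈ˡ J → v ∉ G u
  indep-pair (h ∷ hs) (here refl) (here refl) = ≁irr
  indep-pair (h ∷ hs) (here refl) (there q) = proj₂ (All.lookup h q)
  indep-pair (h ∷ hs) (there p) (here refl) = ≁sym (proj₂ (All.lookup h p))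
  indep-pair (h ∷ hs) (there p) (there q) = indep-pair hs p q

  -- I is only required to agree pointwise with `setOf J`, because `allSubsets` contains every set
  -- up to pointwise equality.
  module OfList {J : List (Fin n)} (i : Indep J) (I : VSet n) (I≡J : ∀ v → I v ≡ setOf J v) where
    fwd : ∀ {v} → I v ≡ true → v ∈ˡ J
    fwd {v} p = setOf⁻ (mem (trans (sym (I≡J v)) p))

    bwd : ∀ {v} → v ∈ˡ J → v ∈ I
    bwd {v} p = mem (trans (I≡J v) (isTrue (setOf⁺ p)))

    size-I : size I ≡ length J
    size-I = trans (size-# I) (trans (#-eq {S = I} {setOf J} (λ _ p → setOf⁺ (fwd (isTrue p))) (λ _ p → bwd (setOf⁻ p))) (#-setOf (distinct i)))

    w-setOf : ∀ {J} → AllPairs _≢_ J → ∑ (λ u → if setOf J u then deg G u else 0) ≡ w full J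
    w-setOf [] = ∑-zero n
    w-setOf {x ∷ J} (h ∷ hs) = trans (∑-⊕ (deg G) (∉setOf h)) (cong₂ _+_ (sym (d-full x)) (w-setOf hs))

    w-I : Defs.w G I ≡ w full J
    w-I = trans (sum-tabulate (λ u → if I u then deg G u else 0) id)
      (trans (∑-cong (λ u → cong (λ b → if b then deg G u else 0) (I≡J u))) (w-setOf (distinct i)))

    indep-I : ∀ {v} → v ∈ˡ J → T (indep? G I)
    indep-I {v} vJ = ≡⇒T (cong₂ _∧_ (any⁺ I (∈-allFin v) (isTrue (bwd vJ)))
        (all⁺ _ (allFin n) (λ x → all⁺ _ (allFin n) (pair x))))
      where
      pair : ∀ x y → not (I x ∧ I y ∧ G x y) ≡ true
      pair x y with I x in p | I y in q
      ... | false | _ = refl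
      ... | true | false = refl
      ... | true | true = cong not (isFalse (indep-pair i (fwd p) (fwd q)))

  -- If some v in J had degree below |J|, then J would be large and hence of weight at least n, so
  -- not light.
  hypFull : SigmaStarGe G n → Hyp full ∅
  hypFull σ {J} i ps lt {v} vJ with ≤-<-connex (length J) (d full v)
  ... | inj₁ p = ≤-trans (≤-reflexive (trans (cong (length J +_) #-∅) (+-identityʳ _))) p
  ... | inj₂ low = ⊥-elim (<-irrefl refl (≤-trans (≤-trans lt (≤-reflexive (#-full n)))
            (subst (n ≤_) w-I (σ (setOf J) (indep-I vJ) large))))
    where
    open OfList i (setOf J) (λ _ → refl)
    large : Large G (setOf J)
    large = ≤-trans (≤-reflexive (+-comm (δ G (setOf J)) 1))
      (≤-trans (s≤s (≤-trans (δ≤deg G (setOf J) (bwd vJ)) (≤-reflexive (sym (d-full v))))) (≤-trans low (≤-reflexive (sym size-I))))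

  α*-bound : ∀ {J} → Indep J → w full J < # {n} full ⊎ J ≡ [] → length J ≤ alphaStar G
  α*-bound i (inj₂ refl) = z≤n
  α*-bound {[]} i (inj₁ lt) = z≤n
  α*-bound {x ∷ J} i (inj₁ lt) with allSubsets-complete n (setOf (x ∷ J))
  ... | I , m , h = ≤-trans (≤-reflexive (sym size-I)) (≤-trans (≤-reflexive (sym value))
        (foldr-⊔ (∈-map⁺ (λ I → if indep? G I ∧ light? G I then size I else 0) m)))
    where
    open OfList i I h
    light : light? G I ≡ true
    light = T⇒≡ (≤⇒≤ᵇ (subst (_≤ n ∸ 1) (sym w-I) (<⇒≤pred (≤-trans lt (≤-reflexive (#-full n))))))
    value : (if indep? G I ∧ light? G I then size I else 0) ≡ size I
    value = cong (λ b → if b then size I else 0) (cong₂ _∧_ (T⇒≡ (indep-I (here refl))) light)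

  partition : Good full ∅ → Σ ℕ λ k → Σ (Fin k → VSet n) λ P → TwoProperPartition G P × k ≤ alphaStar G
  partition g = length Ps , lookup Ps , (covers , unique , proper) , subst (_≤ alphaStar G) len (α*-bound indep light)
    where
    open Good g
    covers : ∀ u → ∃ λ i → lookup Ps i u ≡ true
    covers u = Any.index c , isTrue (Anyₚ.lookup-index c)
      where
      c : Any (u ∈_) Ps
      -- X is contained in the empty set A, so no vertex has been moved away.
      c = cover (mem refl) (∉-intro λ p → clash (X⊆A p) ∉∅)
    unique : ∀ u i j → lookup Ps i u ≡ true → lookup Ps j u ≡ true → i ≡ j
    unique u = go disj
      where
      go : ∀ {Qs : List (VSet n)} → AllPairs (λ P Q → ∀ {i} → i ∈ P → i ∉ Q) Qs → ∀ i j → lookup Qs i u ≡ true → lookup Qs j u ≡ true → i ≡ j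
      go (h ∷ hs) zero zero p q = refl
      go {_ ∷ Qs} (h ∷ hs) zero (suc j) p q = ⊥-elim (clash {S = lookup Qs j} (mem q) (All.lookup h (∈-lookup {xs = Qs} j) (mem p)))
      go {_ ∷ Qs} (h ∷ hs) (suc i) zero p q = ⊥-elim (clash {S = lookup Qs i} (mem p) (All.lookup h (∈-lookup {xs = Qs} i) (mem q)))
      go (h ∷ hs) (suc i) (suc j) p q = cong suc (go hs i j p q)
    proper : ∀ i → TwoConnected G (lookup Ps i)
    proper i with All.lookup okP (∈-lookup {xs = Ps} i)
    ... | ns , three = subst (2 <_) (sym (size-# (lookup Ps i))) three
        , λ x xP → conn⇒connected (conn-resp (─-unfold (lookup Ps i) x) (conn─ ns (mem xP)))

  emb⇒≅ : ∀ {m} {H : Adj m} → Emb full H → G ≅ H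
  emb⇒≅ {m} {H} f = mk↔ₛ′ to e (λ i → inj _ _ (proj₂ (onto (mem refl)))) (λ u → proj₂ (onto (mem refl)))
      , λ u v → trans (sym (adj (to u) (to v))) (cong₂ G (proj₂ (onto (mem refl))) (proj₂ (onto (mem refl))))
    where
    open Emb f
    to : Fin n → Fin m
    to u = proj₁ (onto {u} (mem refl))

  emb-order : ∀ {m} {H : Adj m} → Emb full H → m ≡ n
  emb-order {m} f = ≤-antisym (≤-trans emb-# (≤-reflexive (#-full n)))
    (≤-trans (≤-reflexive (sym (#-full n))) (≤-trans (#-img≤ e {R = full} (λ u p → let i , h = onto p in i , mem refl , h)) (≤-reflexive (#-full m))))
    where open Emb f

  -- Listing K, then L, then a, b, c₁, c₂ reproduces the numbering of `H` with s = |K| + 1 and t =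
  -- |L| + 1.
  module Enumerate (h : HS full) where
    open HSBoth h

    k' l' : ℕ
    k' = # K
    l' = # L
    open ClsPositions k' l'

    front tail vertices : List (Fin n)
    tail = a ∷ b ∷ c₁ ∷ c₂ ∷ []
    front = elems K ++ elems L
    vertices = front ++ tail

    length-front : length front ≡ k' + l'
    length-front = trans (length-++ (elems K)) (cong₂ _+_ (length-elems K) (length-elems L))

    order : suc k' + suc l' + 2 ≡ length vertices
    order = sym (trans (length-++ front) (trans (cong (_+ 4) length-front) (front-order k' l')))

    at : ∀ i → κ (lookup vertices i) ≡ cls (suc k') (suc l') (toℕ i)
    at = lookup-++ (λ p u → κ u ≡ cls (suc k') (suc l') p) front tail
      (lookup-++ (λ p u → κ u ≡ cls (suc k') (suc l') p) (elems K) (elems L) atK atL) atTail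
      where
      bound : ∀ {A : Set} {m} (l : List A) → length l ≡ m → (i : Fin (length l)) → toℕ i < m
      bound l e i = subst (toℕ i <_) e (toℕ<n i)
      atK : ∀ i → κ (lookup (elems K) i) ≡ cls (suc k') (suc l') (toℕ i)
      atK i = trans (proj₂ (K⁻ (elems⁻ (∈-lookup {xs = elems K} i)))) (sym (cls-S1 (bound (elems K) (length-elems K) i)))
      atL : ∀ i → κ (lookup (elems L) i) ≡ cls (suc k') (suc l') (length (elems K) + toℕ i)
      atL i rewrite length-elems K = trans (proj₂ (L⁻ (elems⁻ (∈-lookup {xs = elems L} i))))
        (sym (cls-S2 (m≤m+n _ _) (+-monoʳ-< k' (bound (elems L) (length-elems L) i))))
      atTail : ∀ j → κ (lookup tail j) ≡ cls (suc k') (suc l') (length front + toℕ j)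
      atTail j rewrite length-front with j
      ... | 0F = trans κa (sym (trans (cong (cls (suc k') (suc l')) (+-identityʳ (k' + l'))) cls-A))
      ... | 1F = trans κb (sym (trans (cong (cls (suc k') (suc l')) (+-comm (k' + l') 1)) cls-B))
      ... | 2F = trans κc₁ (sym (trans (cong (cls (suc k') (suc l')) (+-comm (k' + l') 2)) cls-C1))
      ... | 3F = trans κc₂ (sym (trans (cong (cls (suc k') (suc l')) (+-comm (k' + l') 3)) cls-C2))

    distinct-vertices : AllPairs _≢_ vertices
    distinct-vertices = AllPairsₚ.++⁺
      (AllPairsₚ.++⁺ (elems-unique K) (elems-unique L) (All.tabulate λ p → All.tabulate λ q →
        κ≢ (proj₂ (K⁻ (elems⁻ p))) (proj₂ (L⁻ (elems⁻ q))) λ ()))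
      ((κ≢ κa κb (λ ()) ∷ κ≢ κa κc₁ (λ ()) ∷ κ≢ κa κc₂ (λ ()) ∷ []) ∷ (κ≢ κb κc₁ (λ ()) ∷ κ≢ κb κc₂ (λ ()) ∷ []) ∷ (c₁≢c₂ ∷ []) ∷ [] ∷ [])
      (All.tabulate λ p → κa' (∈-++⁻ (elems K) p))
      where
      κa' : ∀ {i} → i ∈ˡ elems K ⊎ i ∈ˡ elems L → All (i ≢_) tail
      κa' (inj₁ p) = κ≢ q κa (λ ()) ∷ κ≢ q κb (λ ()) ∷ κ≢ q κc₁ (λ ()) ∷ κ≢ q κc₂ (λ ()) ∷ []
        where q = proj₂ (K⁻ (elems⁻ p))
      κa' (inj₂ p) = κ≢ q κa (λ ()) ∷ κ≢ q κb (λ ()) ∷ κ≢ q κc₁ (λ ()) ∷ κ≢ q κc₂ (λ ()) ∷ []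
        where q = proj₂ (L⁻ (elems⁻ p))

    listed : ∀ u → u ∈ˡ vertices
    listed u with only {u} (mem refl)
    ... | inj₁ p = ∈-++⁺ˡ (∈-++⁺ˡ (elems⁺ (K⁺ (mem refl) p)))
    ... | inj₂ (inj₁ p) = ∈-++⁺ˡ (∈-++⁺ʳ (elems K) (elems⁺ (S.K⁺ (mem refl) (cong sw p))))
    ... | inj₂ (inj₂ (inj₁ p)) = ∈-++⁺ʳ front (here p)
    ... | inj₂ (inj₂ (inj₂ (inj₁ p))) = ∈-++⁺ʳ front (there (here p))
    ... | inj₂ (inj₂ (inj₂ (inj₂ (inj₁ p)))) = ∈-++⁺ʳ front (there (there (here p)))
    ... | inj₂ (inj₂ (inj₂ (inj₂ (inj₂ p)))) = ∈-++⁺ʳ front (there (there (there (here p))))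

    vertex : Fin (suc k' + suc l' + 2) → Fin n
    vertex i = lookup vertices (cast order i)

    vertex-inj : ∀ i j → vertex i ≡ vertex j → i ≡ j
    vertex-inj i j p = toℕ-injective (trans (sym (toℕ-cast order i))
      (trans (cong toℕ (lookup-inj distinct-vertices _ _ p)) (toℕ-cast order j)))

    emb : Emb full (H ab (suc k') (suc l'))
    emb = record { e = vertex ; inj = vertex-inj ; inU = λ _ → mem refl ; onto = λ {u} _ → on u ; adj = ad }
      where
      on : ∀ u → ∃ λ i → vertex i ≡ u
      on u = cast (sym order) (Any.index (listed u))
        , trans (cong (lookup vertices) (toℕ-injective (trans (toℕ-cast order _) (toℕ-cast (sym order) _)))) (sym (Anyₚ.lookup-index (listed u)))
      κv : ∀ i → κ (vertex i) ≡ cls (suc k') (suc l') (toℕ i)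
      κv i = trans (at (cast order i)) (cong (cls (suc k') (suc l')) (toℕ-cast order i))
      ad : ∀ i j → G (vertex i) (vertex j) ≡ H ab (suc k') (suc l') i j
      ad i j with ≟⊎ i j
      ... | inj₁ refl = trans (girr _) (sym (cong (λ x → not x ∧ E ab (cls (suc k') (suc l') (toℕ i)) (cls (suc k') (suc l') (toℕ i))) (≡ᵇ-refl (toℕ i))))
      ... | inj₂ ne = trans (HS.adj h (mem refl) (mem refl) (λ p → ne (vertex-inj i j p)))
            (trans (cong₂ (E ab) (κv i) (κv j)) (sym (cong (λ x → not x ∧ E ab (cls (suc k') (suc l') (toℕ i)) (cls (suc k') (suc l') (toℕ j))) (==-≢ ne))))

    inHn : k' ≤ l' → InHn G
    inHn le = suc k' , suc l' , ab , s≤s (#-pos k∈K) , s≤s le , emb-order emb , emb⇒≅ emb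

  hs⇒InHn : HS full → InHn G
  hs⇒InHn h with ≤-total (# (HSBoth.K h)) (# (HSBoth.L h))
  ... | inj₁ le = Enumerate.inHn h le
  ... | inj₂ ge = Enumerate.inHn (swapHS h) (≤-trans ge (#-⊆ λ i p → s.S.K⁺ (proj₁ (h.K⁻ p)) (cong (sw ∘ sw) (proj₂ (h.K⁻ p)))))
    where
    module h = HSBoth h
    module s = HSBoth (swapHS h)

  exceptional : Exc full → Exceptional G
  exceptional (isK2 f) = inj₁ (emb⇒≅ f)
  exceptional (isF5 f) = inj₂ (inj₁ (emb⇒≅ f))
  exceptional (isHS h) = inj₂ (inj₂ (inj₂ (inj₂ (hs⇒InHn h))))
  exceptional (isBig b) with Big.final b
  ... | inj₁ (l₁ , l₂ , f) = inj₂ (inj₂ (inj₁ (l₁ , l₂ , emb⇒≅ f)))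
  ... | inj₂ (l₁ , l₂ , l₃ , l₄ , t , f) = inj₂ (inj₂ (inj₂ (inj₁ (l₁ , l₂ , l₃ , l₄ , t , emb⇒≅ f))))

theorem4 : (n : ℕ) (G : Adj n) → Simple G → SigmaStarGe G n →
    (Σ ℕ λ k → Σ (Fin k → VSet n) λ P → TwoProperPartition G P × k ≤ alphaStar G)
    ⊎ Exceptional G
theorem4 n G (gsym , girr) σ with Partitions.main G gsym girr (# {n} full) full ∅ ≤-refl (Partitions.hypFull G gsym girr σ)
... | inj₁ g = inj₁ (Partitions.partition G gsym girr g)
... | inj₂ (_ , x) = inj₂ (Partitions.exceptional G gsym girr x)
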